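{- Let $G$ be a finite graph (parallel edges allowed, no loops) and let $d$ and $k$ be positive integers. Define the fractional arboricity $\gamma(G) = \max_{H \subseteq G,\, v(H) \geq 2} \frac{e(H)}{v(H)-1}$, where $e(H)=|E(H)|$ and $v(H)=|V(H)|$. If $\gamma(G) \leq k + \frac{d}{d+k+1}$, then there is a partition of $E(G)$ into $k+1$ forests such that in one of these forests every connected component has at most \[ d + \left\lceil k\left(\left\lceil \tfrac{d}{k+1}\right\rceil - 1\right)\left(\frac{d}{k+1} - \frac{1}{2}\left\lceil \tfrac{d}{k+1}\right\rceil\right)\right\rceil \] edges.
   Context: Graphs may have parallel edges but no loops. The maximum in the definition of $\gamma(G)$ ranges over all subgraphs $H$ of $G$ with at least two vertices. -}

module Defs where

open import Data.Bool.Base using (true; false)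
open import Data.Fin.Base using (Fin)
open import Data.Fin.Properties using (all?)
open import Data.Fin.Subset using (Subset; _∈_; _⊆_; ⊤; ⊥; ∣_∣; Nonempty)
open import Data.Fin.Subset.Properties using (_∈?_; ∈⊤; ∉⊥; ∣⊤∣≡n; ∣⊥∣≡0)
open import Data.Integer.Base as ℤ using (ℤ; +_)
open import Data.List.Base using (List; []; _∷_; _++_; map; mapMaybe; cartesianProduct)
import Data.List.Extrema as Extrema
import Data.List.Membership.Propositional as List
open import Data.List.Membership.Propositional.Properties using (∈-map⁺; ∈-++⁺ˡ; ∈-++⁺ʳ; ∈-cartesianProduct⁺)
open import Data.List.Relation.Unary.All as All using ()
open import Data.List.Relation.Unary.Any using (here; there)
open import Data.List.Relation.Unary.Unique.Propositional using (Unique)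
open import Data.Maybe.Base using (Maybe; just; nothing)
open import Data.Maybe.Properties using (just-injective)
open import Data.Nat.Base as ℕ using (ℕ; zero; suc; pred; 2+; NonZero; NonTrivial)
open import Data.Nat.Properties using (nonTrivial?)
open import Data.Product using (Σ; _×_; _,_; proj₁; proj₂; ∃!; ∃-syntax)
open import Data.Rational.Base as ℚ using (ℚ; 0ℚ; ½; _/_)
open import Data.Rational.Properties using (≤-decTotalOrder; 0/n≡0)
open import Data.Sum.Base using (_⊎_; inj₁; inj₂)
open import Data.Vec.Base using ([]; _∷_)
open import Relation.Binary.Bundles using (DecTotalOrder)
open import Relation.Binary.PropositionalEquality using (_≡_; _≢_; refl; sym; trans; cong; subst)
open import Relation.Nullary using (¬_; Dec; yes; no; contradiction)
open import Relation.Nullary.Decidable using (_×-dec_; _→-dec_)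

open Extrema (DecTotalOrder.totalOrder ≤-decTotalOrder) using (max; xs≤max; argmax-sel)

-- Distinct edges may have the same ends, so parallel edges are allowed.
-- The order in which `ends` lists the two ends of an edge carries no meaning.
record Graph : Set where
  field
    #V #E    : ℕ
    ends     : Fin #E → Fin #V × Fin #V
    loopless : ∀ e → proj₁ (ends e) ≢ proj₂ (ends e)

module _ (G : Graph) where
  open Graph G

  Closed : Subset #V → Subset #E → Set
  Closed S F = ∀ e → e ∈ F → proj₁ (ends e) ∈ S × proj₂ (ends e) ∈ S

  closed? : ∀ S F → Dec (Closed S F)
  closed? S F = all? λ e →
    (e ∈? F) →-dec ((proj₁ (ends e) ∈? S) ×-dec (proj₂ (ends e) ∈? S))

  record Subgraph : Set where
    constructor subgraph
    field
      V      : Subset #V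
      E      : Subset #E
      closed : Closed V E

  open Subgraph

  v e : Subgraph → ℕ
  v H = ∣ V H ∣
  e H = ∣ E H ∣

  pred-nonZero : ∀ n → .{{NonTrivial n}} → NonZero (pred n)
  pred-nonZero (2+ _) = _

  -- `NonTrivial n` is the library's instance-friendly form of `1 < n`.
  density : (H : Subgraph) → .{{NonTrivial (v H)}} → ℚ
  density H = _/_ (+ e H) (pred (v H)) {{pred-nonZero (v H)}}

subsets : ∀ n → List (Subset n)
subsets zero    = [] ∷ []
subsets (suc n) = map (true ∷_) (subsets n) ++ map (false ∷_) (subsets n)

∈-subsets : ∀ {n} (S : Subset n) → S List.∈ subsets n
∈-subsets []          = here refl
∈-subsets (true  ∷ S) = ∈-++⁺ˡ (∈-map⁺ (true ∷_) (∈-subsets S))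
∈-subsets (false ∷ S) = ∈-++⁺ʳ (map (true ∷_) (subsets _)) (∈-map⁺ (false ∷_) (∈-subsets S))

module _ (G : Graph) where
  open Graph G

  density? : Subset #V × Subset #E → Maybe ℚ
  density? (S , F) with closed? G S F | nonTrivial? ∣ S ∣
  ... | yes c | yes nt = just (density G (subgraph S F c) {{nt}})
  ... | _     | _      = nothing

  densities : List ℚ
  densities = mapMaybe density? (cartesianProduct (subsets #V) (subsets #E))

  -- All densities are nonnegative, so the default value 0 only matters when
  -- G has fewer than two vertices (and hence no edges); see γ-upper and
  -- γ-attained.
  γ : ℚ
  γ = max 0ℚ densities

private
  ∈-mapMaybe : ∀ {A B : Set} (f : A → Maybe B) {x y xs} →
               x List.∈ xs → f x ≡ just y → y List.∈ mapMaybe f xs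
  ∈-mapMaybe f {xs = x ∷ xs} (here refl) eq with f x
  ∈-mapMaybe f {xs = x ∷ xs} (here refl) refl | just y = here refl
  ∈-mapMaybe f {xs = x ∷ xs} (there p) eq with f x
  ... | just _  = there (∈-mapMaybe f p eq)
  ... | nothing = ∈-mapMaybe f p eq

  mapMaybe-∈ : ∀ {A B : Set} (f : A → Maybe B) {y} xs →
               y List.∈ mapMaybe f xs → ∃[ x ] f x ≡ just y
  mapMaybe-∈ f (x ∷ xs) p with f x in eq
  ... | nothing = mapMaybe-∈ f xs p
  mapMaybe-∈ f (x ∷ xs) (here refl) | just _ = x , eq
  mapMaybe-∈ f (x ∷ xs) (there p)   | just _ = mapMaybe-∈ f xs p

module _ (G : Graph) where
  open Graph G
  open Subgraph

  γ-upper : ∀ (H : Subgraph G) (nt : NonTrivial (v G H)) → density G H {{nt}} ℚ.≤ γ G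
  γ-upper H nt = All.lookup (xs≤max 0ℚ (densities G))
    (∈-mapMaybe (density? G) (∈-cartesianProduct⁺ (∈-subsets (V H)) (∈-subsets (E H))) eq)
    where
    eq : density? G (V H , E H) ≡ just (density G H {{nt}})
    eq with closed? G (V H) (E H) | nonTrivial? ∣ V H ∣
    ... | yes _ | yes _  = refl
    ... | yes _ | no ¬nt = contradiction nt ¬nt
    ... | no ¬c | _      = contradiction (closed H) ¬c

  γ-attained : NonTrivial #V →
               Σ (Subgraph G) λ H → Σ (NonTrivial (v G H)) λ nt → γ G ≡ density G H {{nt}}
  γ-attained nt with argmax-sel (λ q → q) 0ℚ (densities G)
  ... | inj₁ γ≡0 = edgeless , nt′ , trans γ≡0 (sym density≡0)
    where
    edgeless : Subgraph G
    edgeless = subgraph ⊤ ⊥ λ _ p → contradiction p ∉⊥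
    nt′ : NonTrivial ∣ ⊤ {#V} ∣
    nt′ = subst (λ n → NonTrivial n) (sym (∣⊤∣≡n #V)) nt
    instance _ = pred-nonZero G ∣ ⊤ {#V} ∣ {{nt′}}
    density≡0 : density G edgeless {{nt′}} ≡ 0ℚ
    density≡0 = trans (cong (λ n → (+ n) / pred ∣ ⊤ {#V} ∣) (∣⊥∣≡0 #E)) (0/n≡0 (pred ∣ ⊤ {#V} ∣))
  ... | inj₂ γ∈ with mapMaybe-∈ (density? G) (cartesianProduct (subsets #V) (subsets #E)) γ∈
  ...   | (S , F) , eq with closed? G S F | nonTrivial? ∣ S ∣
  γ-attained nt | inj₂ _ | (S , F) , eq | yes c | yes nt′ =
    subgraph S F c , nt′ , just-injective (sym eq)

module _ (G : Graph) where
  open Graph G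
  open Subgraph

  Joins : Fin #E → Fin #V → Fin #V → Set
  Joins e x y = ends e ≡ (x , y) ⊎ ends e ≡ (y , x)

  data Walk (F : Subset #E) : Fin #V → Fin #V → Set where
    []   : ∀ {x} → Walk F x x
    cons : ∀ {x y z} (e : Fin #E) → e ∈ F → Joins e x y → Walk F y z → Walk F x z

  edges : ∀ {F x y} → Walk F x y → List (Fin #E)
  edges []             = []
  edges (cons e _ _ w) = e ∷ edges w

  -- The final vertex is omitted, so that on a closed walk the base point is
  -- listed once.
  vertices : ∀ {F x y} → Walk F x y → List (Fin #V)
  vertices []                     = []
  vertices (cons {x = x} _ _ _ w) = x ∷ vertices w

  -- Distinctness of the edges rules out traversing one edge back and forth,
  -- while two parallel edges do form a cycle.
  record Cycle (F : Subset #E) : Set where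
    field
      base              : Fin #V
      walk              : Walk F base base
      nonempty          : edges walk ≢ []
      distinct-edges    : Unique (edges walk)
      distinct-vertices : Unique (vertices walk)

  Forest : Subset #E → Set
  Forest F = ¬ Cycle F

  -- Walks along edges of H stay inside H because H is closed.
  Connected : Subgraph G → Set
  Connected H = Nonempty (V H) × (∀ x y → x ∈ V H → y ∈ V H → Walk (E H) x y)

  -- H is a connected component of the spanning subgraph (V(G), F):
  -- a maximal connected subgraph.
  record Component (F : Subset #E) (H : Subgraph G) : Set where
    field
      within    : E H ⊆ F
      connected : Connected H
      maximal   : ∀ H′ → E H′ ⊆ F → Connected H′ → V H ⊆ V H′ → E H ⊆ E H′ →
                  V H′ ⊆ V H × E H′ ⊆ E H

  -- The parts may be empty.
  EdgePartition : ∀ {p} → (Fin p → Subset #E) → Set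
  EdgePartition F = ∀ e → ∃! _≡_ λ i → e ∈ F i

componentBound : (d k : ℕ) → ℤ
componentBound d k =
  + d ℤ.+ ℚ.ceiling ((+ k / 1) ℚ.* (c ℚ.- ℚ.1ℚ) ℚ.* (q ℚ.- ½ ℚ.* c))
  where
  q c : ℚ
  q = + d / suc k
  c = ℚ.ceiling q / 1

{-# OPTIONS --safe #-}
-- By Nash-Williams, E(G) splits into k + 1 forests; call one of them red and root the others at a
-- vertex r of a red component with more than the allowed D edges.  Explore from r along red edges and
-- along the first edge of the path to r in each of the k trees.  If a vertex cut off from r in some
-- tree is reached, exchanging edges backwards along the exploration makes one red edge redundant.
-- Otherwise the explored set spans k(v - 1) tree edges, so by sparsity its red components are small on
-- average.  Charging each small component to the component from which it was entered, some component L
-- has in one tree s + 2 children with at most s edges each, or a child with which it has fewer than D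
-- edges in total.  Give the tree edges to these children to the red forest; the tree is repaired by red
-- edges of L that separate the children, and by one red edge of a component explored before L.  This
-- decreases the total excess Σ (size - D) over the red components or, lexicographically, the sizes of
-- the components in the order of exploration.
module Submission where

open import Defs using (Graph; Joins)
open import Data.Bool.Base using (Bool; true; false; _∧_; not; if_then_else_)
open import Data.Bool.Properties using (∧-identityʳ; ∧-zeroʳ) renaming (_≟_ to _≟ᵇ_)
open import Data.Empty using (⊥; ⊥-elim)
open import Data.Fin.Base as Fin using (Fin; zero; suc; toℕ; fromℕ<; punchIn)
import Data.Fin.Properties as Fin
open import Data.List.Base as List using (List; []; _∷_; map; filter; lookup)
open import Data.List.Membership.Propositional using (_∈_; find)
open import Data.List.Membership.Propositional.Properties using (∈-lookup)
open import Data.List.Relation.Unary.All as All using (All; []; _∷_)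
import Data.List.Relation.Unary.All.Properties as All
open import Data.List.Relation.Unary.AllPairs as AllPairs using (AllPairs; []; _∷_)
import Data.List.Relation.Unary.AllPairs.Properties as AllPairs
open import Data.List.Relation.Unary.Any as Any using (Any; here; there)
open import Data.Nat.Base hiding (_/_)
open import Data.Nat.Properties
open import Data.Nat.Tactic.RingSolver using (solve-∀)
open import Data.Product using (Σ; _×_; _,_; proj₁; proj₂; ∃-syntax)
open import Data.Product.Properties using (,-injective)
open import Data.Sum.Base using (_⊎_; inj₁; inj₂; [_,_]′)
open import Function.Base using (_∘_; id)
open import Relation.Binary.PropositionalEquality
open import Relation.Nullary using (¬_; Dec; yes; no; does)
open import Relation.Nullary.Decidable using (dec-true; map′; _×-dec_; _⊎-dec_; ¬?)
open import Algebra.Properties.Semiring.Sum +-*-semiring using (sum; sum-cong-≗; ∑-distrib-+; ∑-comm; *-distribˡ-sum)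

-- The constant comes from the balance Σ ((k + 1) s - d) over the explored red components, s being
-- the number of edges: sparsity makes this sum negative. If no exchange applies, then in each tree
-- at most s + 1 children of a component have at most s edges, and parent and child together have at
-- least D edges. At worst the children in one tree have 0, 1, 2, ... edges and lack Σ max(0, d - (k
-- + 1) s) in total. A parent with D edges pays for k such families exactly if (k + 1) D ≥ d + k Σ
-- max(0, d - (k + 1) s); the stated bound is this sum in closed form, rounded up. The number s + 2
-- arises as follows. The vertices of L where q + 1 children hang lie in different pieces of the
-- broken tree, so L offers only q edges to repair it, unless L also meets the piece of r. Hence one
-- child may stay attached to L, which adds up to s + 1 edges, while each of the other q children
-- takes at least one edge away; q = s + 1 balances this. The missing repair edge comes from a
-- component explored before L.

true≢false : true ≢ false
true≢false ()

bool-ext : ∀ {a b} → (a ≡ true → b ≡ true) → (b ≡ true → a ≡ true) → a ≡ b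
bool-ext {true}  {true}  f g = refl
bool-ext {true}  {false} f g = sym (f refl)
bool-ext {false} {true}  f g = g refl
bool-ext {false} {false} f g = refl

∧-true : ∀ {a b} → a ≡ true → b ≡ true → a ∧ b ≡ true
∧-true refl refl = refl

∧-trueˡ : ∀ {a b} → a ∧ b ≡ true → a ≡ true
∧-trueˡ {true} p = refl

∧-trueʳ : ∀ {a b} → a ∧ b ≡ true → b ≡ true
∧-trueʳ {true} p = p

not-true : ∀ {a} → not a ≡ true → a ≡ false
not-true {false} p = refl

does⇒ : ∀ {P : Set} (p? : Dec P) → does p? ≡ true → P
does⇒ (yes p) _ = p

⇒does : ∀ {P : Set} (p? : Dec P) → P → does p? ≡ true
⇒does = dec-true

-- Finite sums and counting.

sum-mono : ∀ {n} {f g : Fin n → ℕ} → (∀ i → f i ≤ g i) → sum f ≤ sum g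
sum-mono {zero}  h = z≤n
sum-mono {suc n} h = +-mono-≤ (h zero) (sum-mono (λ i → h (suc i)))

sum-zero : ∀ {n} {f : Fin n → ℕ} → (∀ i → f i ≡ 0) → sum f ≡ 0
sum-zero {zero}  h = refl
sum-zero {suc n} h = cong₂ _+_ (h zero) (sum-zero (λ i → h (suc i)))

sum-const : ∀ n c → sum {n} (λ _ → c) ≡ n * c
sum-const zero    c = refl
sum-const (suc n) c = cong (c +_) (sum-const n c)

sum-≥ : ∀ {n} (f : Fin n → ℕ) i → f i ≤ sum f
sum-≥ f zero    = m≤m+n _ _
sum-≥ f (suc i) = ≤-trans (sum-≥ (λ j → f (suc j)) i) (m≤n+m _ _)

when : Bool → ℕ → ℕ
when b x = if b then x else 0

sum-when-unique : ∀ {n} (p : Fin n → Bool) (f : Fin n → ℕ) a → p a ≡ true →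
                  (∀ i → p i ≡ true → i ≡ a) → sum (λ i → when (p i) (f i)) ≡ f a
sum-when-unique p f zero pa u with p zero
sum-when-unique p f zero refl u | true =
  trans (cong (f zero +_) (sum-zero rest)) (+-identityʳ _)
  where
  rest : ∀ i → when (p (suc i)) (f (suc i)) ≡ 0
  rest i with p (suc i) in eq
  ... | false = refl
  ... | true with () ← u (suc i) eq
sum-when-unique p f (suc a) pa u with p zero in eq
... | true with () ← u zero eq
... | false = sum-when-unique (p ∘ suc) (f ∘ suc) a pa (λ i q → Fin.suc-injective (u (suc i) q))

count : ∀ {n} → (Fin n → Bool) → ℕ
count p = sum (λ i → when (p i) 1)

count-cong : ∀ {n} {p q : Fin n → Bool} → (∀ i → p i ≡ q i) → count p ≡ count q
count-cong h = sum-cong-≗ (λ i → cong (λ b → when b 1) (h i))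

when-mono : ∀ {a b x y} → (a ≡ true → b ≡ true) → (a ≡ true → x ≤ y) → when a x ≤ when b y
when-mono {false} h k = z≤n
when-mono {true}  h k rewrite h refl = k refl

count-mono : ∀ {n} {p q : Fin n → Bool} → (∀ i → p i ≡ true → q i ≡ true) → count p ≤ count q
count-mono h = sum-mono (λ i → when-mono (h i) (λ _ → ≤-refl))

count-remove : ∀ {n} (p : Fin n → Bool) a → p a ≡ true →
               count p ≡ suc (count (λ i → p i ∧ not (does (i Fin.≟ a))))
count-remove p a pa = begin
  count p                          ≡⟨ sum-cong-≗ split ⟩
  sum (λ i → when (does (i Fin.≟ a)) 1 + when (p i ∧ not (does (i Fin.≟ a))) 1)
                                   ≡⟨ ∑-distrib-+ (λ i → when (does (i Fin.≟ a)) 1) _ ⟩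
  sum (λ i → when (does (i Fin.≟ a)) 1) + count (λ i → p i ∧ not (does (i Fin.≟ a)))
                                   ≡⟨ cong (_+ count (λ i → p i ∧ not (does (i Fin.≟ a)))) (sum-when-unique (λ i → does (i Fin.≟ a)) (λ _ → 1) a
                                        (⇒does (a Fin.≟ a) refl) (λ i → does⇒ (i Fin.≟ a))) ⟩
  suc (count (λ i → p i ∧ not (does (i Fin.≟ a)))) ∎
  where
  open ≡-Reasoning
  split : ∀ i → when (p i) 1 ≡ when (does (i Fin.≟ a)) 1 + when (p i ∧ not (does (i Fin.≟ a))) 1
  split i with i Fin.≟ a
  ... | yes refl rewrite pa = refl
  ... | no _ with p i
  ...   | true  = refl
  ...   | false = refl

count-strict : ∀ {n} {p q : Fin n → Bool} a → q a ≡ true → p a ≡ false →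
               (∀ i → p i ≡ true → q i ≡ true) → count p < count q
count-strict {p = p} {q} a qa pa h = ≤-trans (s≤s (count-mono h′)) (≤-reflexive (sym (count-remove q a qa)))
  where
  h′ : ∀ i → p i ≡ true → q i ∧ not (does (i Fin.≟ a)) ≡ true
  h′ i pi with i Fin.≟ a
  ... | yes refl = ⊥-elim (true≢false (trans (sym pi) pa))
  ... | no _     = ∧-true (h i pi) refl

-- The map takes the membership proof as an argument because in `forest-count` the value is
-- extracted from such a proof. Each induction step strikes the value at `zero` from the target.
count-injection : ∀ {n m} (p : Fin n → Bool) (q : Fin m → Bool)
                  (f : ∀ i → p i ≡ true → Fin m) → (∀ i pi → q (f i pi) ≡ true) →
                  (∀ i j pi pj → f i pi ≡ f j pj → i ≡ j) → count p ≤ count q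
count-injection {zero} p q f qf inj = z≤n
count-injection {suc n} {m} p q f qf inj with p zero in eq
... | false = count-injection (p ∘ suc) q (λ i → f (suc i)) (λ i → qf (suc i))
                (λ i j pi pj e → Fin.suc-injective (inj _ _ pi pj e))
... | true  = ≤-trans (s≤s (count-injection (p ∘ suc) (λ i → q i ∧ not (does (i Fin.≟ b))) (λ i → f (suc i)) qf′
                (λ i j pi pj e → Fin.suc-injective (inj _ _ pi pj e))))
                (≤-reflexive (sym (count-remove q b (qf zero eq))))
  where
  b : Fin m
  b = f zero eq
  qf′ : ∀ i pi → q (f (suc i) pi) ∧ not (does (f (suc i) pi Fin.≟ b)) ≡ true
  qf′ i pi with f (suc i) pi Fin.≟ b
  ... | yes e with () ← inj (suc i) zero pi eq e
  ... | no _  = ∧-true (qf (suc i) pi) refl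

count-≤n : ∀ {n} (p : Fin n → Bool) → count p ≤ n
count-≤n {n} p = ≤-trans (sum-mono {g = λ _ → 1} le) (≤-reflexive (trans (sum-const n 1) (*-identityʳ n)))
  where
  le : ∀ i → when (p i) 1 ≤ 1
  le i with p i
  ... | true  = ≤-refl
  ... | false = z≤n

count>0⇒∃ : ∀ {n} (p : Fin n → Bool) → 0 < count p → ∃[ i ] p i ≡ true
count>0⇒∃ {suc n} p lt with p zero in eq
... | true  = zero , eq
... | false with count>0⇒∃ (p ∘ suc) lt
...   | i , pi = suc i , pi

∃⇒count>0 : ∀ {n} (p : Fin n → Bool) i → p i ≡ true → 0 < count p
∃⇒count>0 p i pi = ≤-trans (≤-reflexive (cong (λ b → when b 1) (sym pi))) (sum-≥ _ i)

count-disjoint : ∀ {n} {p q r : Fin n → Bool} → (∀ i → r i ≡ true → p i ≡ true ⊎ q i ≡ true) →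
                 (∀ i → p i ≡ true → r i ≡ true) → (∀ i → q i ≡ true → r i ≡ true) →
                 (∀ i → p i ≡ true → q i ≡ true → ⊥) → count r ≡ count p + count q
count-disjoint {p = p} {q} {r} split pr qr dis =
  trans (sum-cong-≗ pointwise) (∑-distrib-+ (λ i → when (p i) 1) (λ i → when (q i) 1))
  where
  pointwise : ∀ i → when (r i) 1 ≡ when (p i) 1 + when (q i) 1
  pointwise i with p i in eqp | q i in eqq | r i in eqr
  ... | true  | true  | _     = ⊥-elim (dis i eqp eqq)
  ... | true  | false | true  = refl
  ... | false | true  | true  = refl
  ... | false | false | false = refl
  ... | true  | false | false = ⊥-elim (true≢false (trans (sym (pr i eqp)) eqr))
  ... | false | true  | false = ⊥-elim (true≢false (trans (sym (qr i eqq)) eqr))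
  ... | false | false | true with split i eqr
  ...   | inj₁ e = ⊥-elim (true≢false (trans (sym e) eqp))
  ...   | inj₂ e = ⊥-elim (true≢false (trans (sym e) eqq))

sum-partition : ∀ {n} (c : Fin n → Bool) (f : Fin n → ℕ) →
                sum f ≡ sum (λ i → when (c i) (f i)) + sum (λ i → when (not (c i)) (f i))
sum-partition c f = trans (sum-cong-≗ pointwise) (∑-distrib-+ (λ i → when (c i) (f i)) (λ i → when (not (c i)) (f i)))
  where
  pointwise : ∀ i → f i ≡ when (c i) (f i) + when (not (c i)) (f i)
  pointwise i with c i
  ... | true  = sym (+-identityʳ _)
  ... | false = refl

search : ∀ {n} {P Q : Fin n → Set} → (∀ i → P i ⊎ Q i) → (∃[ i ] P i) ⊎ (∀ i → Q i)
search {zero}  h = inj₂ λ ()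
search {suc n} h with h zero | search (λ i → h (suc i))
... | inj₁ p | _            = inj₁ (zero , p)
... | inj₂ q | inj₁ (i , p) = inj₁ (suc i , p)
... | inj₂ q | inj₂ qs      = inj₂ λ { zero → q ; (suc i) → qs i }

count≥2 : ∀ {n} (A : Fin n → Bool) {a b} → A a ≡ true → A b ≡ true → a ≢ b → 2 ≤ count A
count≥2 A {a} {b} Aa Ab ne = ≤-trans (s≤s (∃⇒count>0 _ b b-in)) (≤-reflexive (sym (count-remove A a Aa)))
  where
  b-in : A b ∧ not (does (b Fin.≟ a)) ≡ true
  b-in with b Fin.≟ a
  ... | yes eq = ⊥-elim (ne (sym eq))
  ... | no  _  = ∧-true Ab refl

-- Connectivity, forests and components of edge sets.

module Connectivity (G : Graph) where

  open Graph G

  Vertex Edge EdgeSet : Set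
  Vertex  = Fin #V
  Edge    = Fin #E
  EdgeSet = Edge → Bool

  infix 4 _∋_ _⊑_
  infixl 6 _∖_

  _∋_ : EdgeSet → Edge → Set
  S ∋ e = S e ≡ true

  _⊑_ : EdgeSet → EdgeSet → Set
  S ⊑ S′ = ∀ e → S ∋ e → S′ ∋ e

  _∖_ : EdgeSet → Edge → EdgeSet
  (S ∖ g) e = S e ∧ not (does (e Fin.≟ g))

  ∖-intro : ∀ {S g e} → S ∋ e → e ≢ g → S ∖ g ∋ e
  ∖-intro {g = g} {e} p ne with e Fin.≟ g
  ... | yes eq = ⊥-elim (ne eq)
  ... | no  _  = ∧-true p refl

  ∖-⊑ : ∀ {S g} → S ∖ g ⊑ S
  ∖-⊑ e = ∧-trueˡ

  ∖-≢ : ∀ {S g e} → S ∖ g ∋ e → e ≢ g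
  ∖-≢ {S} {g} {e} p eq with S e | e Fin.≟ g
  ... | true | no ne = ne eq

  ∖-mono : ∀ {S S′ g} → S ⊑ S′ → S ∖ g ⊑ S′ ∖ g
  ∖-mono {S} {S′} {g} h e p = ∖-intro {S′} (h e (∖-⊑ {S} {g} e p)) (∖-≢ {S} p)

  joins-sym : ∀ {e a b} → Joins G e a b → Joins G e b a
  joins-sym (inj₁ p) = inj₂ p
  joins-sym (inj₂ p) = inj₁ p

  joins-unique : ∀ {e a b c d} → Joins G e a b → Joins G e c d → (a ≡ c × b ≡ d) ⊎ (a ≡ d × b ≡ c)
  joins-unique (inj₁ p) (inj₁ q) = inj₁ (,-injective (trans (sym p) q))
  joins-unique (inj₁ p) (inj₂ q) = inj₂ (,-injective (trans (sym p) q))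
  joins-unique (inj₂ p) (inj₁ q) with ,-injective (trans (sym p) q)
  ... | b≡c , a≡d = inj₂ (a≡d , b≡c)
  joins-unique (inj₂ p) (inj₂ q) with ,-injective (trans (sym p) q)
  ... | b≡d , a≡c = inj₁ (a≡c , b≡d)

  end₁ end₂ : Edge → Vertex
  end₁ e = proj₁ (ends e)
  end₂ e = proj₂ (ends e)

  joins-ends : ∀ e → Joins G e (end₁ e) (end₂ e)
  joins-ends e = inj₁ refl

  -- Arbitrary walks. Whatever would call for simple paths is phrased with walks in an edge set from
  -- which the critical edge is deleted.
  data Conn (S : EdgeSet) : Vertex → Vertex → Set where
    []   : ∀ {a} → Conn S a a
    step : ∀ {a b c} e → S ∋ e → Joins G e a b → Conn S b c → Conn S a c

  edge-conn : ∀ {S e a b} → S ∋ e → Joins G e a b → Conn S a b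
  edge-conn {e = e} p j = step e p j []

  conn-trans : ∀ {S a b c} → Conn S a b → Conn S b c → Conn S a c
  conn-trans []             q = q
  conn-trans (step e p j w) q = step e p j (conn-trans w q)

  conn-sym : ∀ {S a b} → Conn S a b → Conn S b a
  conn-sym []             = []
  conn-sym (step e p j w) = conn-trans (conn-sym w) (edge-conn p (joins-sym j))

  conn-restrict : ∀ {S S′ a b} → (∀ e c d → Conn S a c → Joins G e c d → S ∋ e → S′ ∋ e) →
                  Conn S a b → Conn S′ a b
  conn-restrict h []             = []
  conn-restrict h (step e p j w) =
    step e (h e _ _ [] j p) j (conn-restrict (λ e′ c d q → h e′ c d (step e p j q)) w)

  conn-mono : ∀ {S S′ a b} → S ⊑ S′ → Conn S a b → Conn S′ a b
  conn-mono h = conn-restrict (λ e _ _ _ _ → h e)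

  conn-avoid : ∀ {S g x y a b} → Joins G g x y → ¬ Conn S a x → ¬ Conn S a y → Conn S a b → Conn (S ∖ g) a b
  conn-avoid {S} {g} {a = a} j ¬x ¬y = conn-restrict keep
    where
    keep : ∀ e c d → Conn S a c → Joins G e c d → S ∋ e → S ∖ g ∋ e
    keep e c d ac je p with e Fin.≟ g
    ... | no  _    = ∧-true p refl
    ... | yes refl with joins-unique je j
    ...   | inj₁ (refl , _) = ⊥-elim (¬x ac)
    ...   | inj₂ (refl , _) = ⊥-elim (¬y ac)

  -- One keeps what precedes the first use of `g` and what follows the last one. If these parts meet
  -- at the same end of `g`, the edge is avoided altogether.
  conn-insert : ∀ {S S′ g x y a b} → (∀ e → S′ ∋ e → e ≢ g → S ∋ e) → Joins G g x y → Conn S′ a b →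
                Conn S a b ⊎ (Conn S a x × Conn S y b) ⊎ (Conn S a y × Conn S x b)
  conn-insert h j [] = inj₁ []
  conn-insert {g = g} h j (step e p je w) with e Fin.≟ g | conn-insert h j w
  ... | no ne | inj₁ q              = inj₁ (step e (h e p ne) je q)
  ... | no ne | inj₂ (inj₁ (q , t)) = inj₂ (inj₁ (step e (h e p ne) je q , t))
  ... | no ne | inj₂ (inj₂ (q , t)) = inj₂ (inj₂ (step e (h e p ne) je q , t))
  ... | yes refl | r with joins-unique je j | r
  ...   | inj₁ (refl , refl) | inj₁ q              = inj₂ (inj₁ ([] , q))
  ...   | inj₁ (refl , refl) | inj₂ (inj₁ (_ , t)) = inj₂ (inj₁ ([] , t))
  ...   | inj₁ (refl , refl) | inj₂ (inj₂ (_ , t)) = inj₁ t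
  ...   | inj₂ (refl , refl) | inj₁ q              = inj₂ (inj₂ ([] , q))
  ...   | inj₂ (refl , refl) | inj₂ (inj₁ (_ , t)) = inj₁ t
  ...   | inj₂ (refl , refl) | inj₂ (inj₂ (_ , t)) = inj₂ (inj₂ ([] , t))

  conn-split : ∀ {S g x y a b} → Joins G g x y → Conn S a b →
               Conn (S ∖ g) a b ⊎ (Conn (S ∖ g) a x × Conn (S ∖ g) y b) ⊎ (Conn (S ∖ g) a y × Conn (S ∖ g) x b)
  conn-split {S} = conn-insert (λ e p ne → ∖-intro {S} p ne)

  length : ∀ {S a b} → Conn S a b → ℕ
  length []             = 0
  length (step _ _ _ w) = suc (length w)

  private
    -- The cases are: `g` is not traversed, its last traversal leads from `x` to `y`, or it leads
    -- from `y` to `x`. The length is recorded in the last case so that `cross′` can restart from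
    -- `x`.
    last-use : ∀ {S g x y a b} → Joins G g x y → (w : Conn S a b) →
               Conn (S ∖ g) a b ⊎ Conn (S ∖ g) y b ⊎ Σ (Conn S x b) λ w′ → length w′ ≤ length w
    last-use j [] = inj₁ []
    last-use {S} {g} j (step e p je w) with e Fin.≟ g | last-use j w
    ... | _        | inj₂ (inj₁ q)        = inj₂ (inj₁ q)
    ... | _        | inj₂ (inj₂ (q , le)) = inj₂ (inj₂ (q , m≤n⇒m≤1+n le))
    ... | no ne    | inj₁ q               = inj₁ (step e (∖-intro {S} p ne) je q)
    ... | yes refl | inj₁ q with joins-unique je j
    ...   | inj₁ (refl , refl) = inj₂ (inj₁ q)
    ...   | inj₂ (refl , refl) = inj₂ (inj₂ (w , n≤1+n _))

  -- On a simple path the parts before and after `f` avoid `f` by themselves. Here this is demanded,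
  -- so that in a forest `f` separates `a` from `b`.
  record Crossing (S : EdgeSet) (Q : Vertex → Bool) (a b : Vertex) : Set where
    constructor crossing
    field
      {f}    : Edge
      {v w}  : Vertex
      f∈S    : S ∋ f
      joins  : Joins G f v w
      inside : Q v ≡ true
      outside : Q w ≡ false
      near   : Conn (S ∖ f) a v
      far    : Conn (S ∖ f) w b

  private
    cross′ : ∀ {S a b} (Q : Vertex → Bool) n (p : Conn S a b) → length p < n →
             Q a ≡ true → Q b ≡ false → Crossing S Q a b
    cross′ Q (suc n) [] lt qa qb = ⊥-elim (true≢false (trans (sym qa) qb))
    cross′ {S} {a} {b} Q (suc n) (step {b = c} e p je w) (s≤s lt) qa qb with Q c in qc
    ... | true = extend (cross′ Q n w lt qc qb)
      where
      extend : Crossing S Q c b → Crossing S Q a b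
      extend (crossing {f} p′ j iv ow nr fr) =
        crossing p′ j iv ow (step e (∖-intro {S} p e≢f) je nr) fr
        where
        e≢f : e ≢ f
        e≢f refl with joins-unique je j
        ... | inj₁ (refl , refl) = true≢false (trans (sym qc) ow)
        ... | inj₂ (refl , refl) = true≢false (trans (sym qa) ow)
    -- The first edge leaves `Q`. If the walk later comes back over it to `a`, the search restarts
    -- at `a` with a shorter walk.
    ... | false with last-use je w
    ...   | inj₁ q               = crossing p je qa qc [] q
    ...   | inj₂ (inj₁ q)        = crossing p je qa qc [] q
    ...   | inj₂ (inj₂ (q , le)) = cross′ Q n q (≤-<-trans le lt) qa qb

  abstract
    cross : ∀ {S a b} (Q : Vertex → Bool) → Conn S a b → Q a ≡ true → Q b ≡ false → Crossing S Q a b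
    cross Q p = cross′ Q _ p ≤-refl

  private
    -- Recursion deletes the edge of largest possible index: by `conn-split` a walk either avoids
    -- this edge or can be taken to use it once.
    conn-bounded? : ∀ S i → (∀ e → S ∋ e → toℕ e < i) → ∀ a b → Dec (Conn S a b)
    conn-bounded? S zero bd a b = map′ (λ { refl → [] }) from (a Fin.≟ b)
      where
      from : Conn S a b → a ≡ b
      from []             = refl
      from (step e p _ _) with () ← bd e p
    conn-bounded? S (suc i) bd a b with i <? #E
    ... | no i≮ = conn-bounded? S i (λ e p → ≤∧≢⇒< (≤-pred (bd e p)) (λ eq → i≮ (subst (_< #E) eq (Fin.toℕ<n e)))) a b
    ... | yes i< = map′ to from (IH a b ⊎-dec ((S g ≟ᵇ true) ×-dec
                     ((IH a (end₁ g) ×-dec IH (end₂ g) b) ⊎-dec (IH a (end₂ g) ×-dec IH (end₁ g) b))))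
      where
      g : Edge
      g = fromℕ< i<
      IH : ∀ a b → Dec (Conn (S ∖ g) a b)
      IH = conn-bounded? (S ∖ g) i λ e p → ≤∧≢⇒< (≤-pred (bd e (∖-⊑ {S} {g} e p)))
             (λ eq → ∖-≢ {S} p (Fin.toℕ-injective (trans eq (sym (Fin.toℕ-fromℕ< i<)))))
      up : ∀ {a b} → Conn (S ∖ g) a b → Conn S a b
      up = conn-mono (∖-⊑ {S} {g})
      to : Conn (S ∖ g) a b ⊎ (S ∋ g × ((Conn (S ∖ g) a (end₁ g) × Conn (S ∖ g) (end₂ g) b) ⊎
             (Conn (S ∖ g) a (end₂ g) × Conn (S ∖ g) (end₁ g) b))) → Conn S a b
      to (inj₁ q) = up q
      to (inj₂ (p , inj₁ (q , t))) = conn-trans (up q) (step g p (joins-ends g) (up t))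
      to (inj₂ (p , inj₂ (q , t))) = conn-trans (up q) (step g p (joins-sym (joins-ends g)) (up t))
      from : Conn S a b → Conn (S ∖ g) a b ⊎ (S ∋ g × ((Conn (S ∖ g) a (end₁ g) × Conn (S ∖ g) (end₂ g) b) ⊎
             (Conn (S ∖ g) a (end₂ g) × Conn (S ∖ g) (end₁ g) b)))
      from w with S g ≟ᵇ true
      ... | yes p with conn-split (joins-ends g) w
      ...   | inj₁ q = inj₁ q
      ...   | inj₂ q = inj₂ (p , q)
      from w | no ¬p = inj₁ (conn-mono (λ e p → ∖-intro {S} p λ { refl → ¬p p }) w)

  abstract
    conn? : ∀ S a b → Dec (Conn S a b)
    conn? S = conn-bounded? S #E (λ e _ → Fin.toℕ<n e)

  connᵇ : EdgeSet → Vertex → Vertex → Bool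
  connᵇ S a b = does (conn? S a b)

  connᵇ⇒ : ∀ {S a b} → connᵇ S a b ≡ true → Conn S a b
  connᵇ⇒ {S} {a} {b} = does⇒ (conn? S a b)

  ⇒connᵇ : ∀ {S a b} → Conn S a b → connᵇ S a b ≡ true
  ⇒connᵇ {S} {a} {b} = ⇒does (conn? S a b)

  ¬connᵇ⇒ : ∀ {S a b} → connᵇ S a b ≡ false → ¬ Conn S a b
  ¬connᵇ⇒ p q = true≢false (trans (sym (⇒connᵇ q)) p)

  ⇒¬connᵇ : ∀ {S a b} → ¬ Conn S a b → connᵇ S a b ≡ false
  ⇒¬connᵇ {S} {a} {b} ¬p with conn? S a b
  ... | yes p = ⊥-elim (¬p p)
  ... | no  _ = refl

  -- Every edge is a bridge. This form is preserved by exchanges of edges without any manipulation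
  -- of cycles; `acyclic-forest` returns to cycles at the end.
  Acyclic : EdgeSet → Set
  Acyclic S = ∀ e a b → S ∋ e → Joins G e a b → ¬ Conn (S ∖ e) a b

  acyclic-⊑ : ∀ {S S′} → S ⊑ S′ → Acyclic S′ → Acyclic S
  acyclic-⊑ {S} h ac e a b p j w = ac e a b (h e p) j (conn-mono (∖-mono {S} h) w)

  acyclic-insert : ∀ {S S′ g x y} → (∀ e → S′ ∋ e → e ≢ g → S ∋ e) → Joins G g x y →
                   ¬ Conn S x y → Acyclic S → Acyclic S′
  acyclic-insert {S} {S′} {g} {x} {y} h j ¬xy ac e a b p je w with e Fin.≟ g
  ... | yes refl with joins-unique je j
  ...   | inj₁ (refl , refl) = ¬xy (conn-mono (λ e′ q → h e′ (∖-⊑ {S′} {e} e′ q) (∖-≢ {S′} q)) w)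
  ...   | inj₂ (refl , refl) = ¬xy (conn-sym (conn-mono (λ e′ q → h e′ (∖-⊑ {S′} {e} e′ q) (∖-≢ {S′} q)) w))
  acyclic-insert {S} {S′} {g} {x} {y} h j ¬xy ac e a b p je w | no e≢g
    with conn-insert {S ∖ e} {S′ ∖ e} (λ e′ q ne → ∖-intro {S} (h e′ (∖-⊑ {S′} {e} e′ q) ne) (∖-≢ {S′} q)) j w
  ... | inj₁ q = ac e a b (h e p e≢g) je q
  ... | inj₂ (inj₁ (q , t)) = ¬xy (conn-trans (conn-sym (up q)) (step e (h e p e≢g) je (conn-sym (up t))))
    where
    up : ∀ {a b} → Conn (S ∖ e) a b → Conn S a b
    up = conn-mono (∖-⊑ {S} {e})
  ... | inj₂ (inj₂ (q , t)) = ¬xy (conn-trans (up t) (step e (h e p e≢g) (joins-sym je) (up q)))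
    where
    up : ∀ {a b} → Conn (S ∖ e) a b → Conn S a b
    up = conn-mono (∖-⊑ {S} {e})

  -- In a forest rooted at `r` this is the edge from `a` to its parent: `rest` avoids `g`, so `g`
  -- lies on the path from `a` to `r`.
  record FirstEdge (S : EdgeSet) (a r : Vertex) : Set where
    constructor first-edge
    field
      {g}   : Edge
      {z}   : Vertex
      g∈S   : S ∋ g
      joins : Joins G g a z
      rest  : Conn (S ∖ g) z r

  first-edge-of : ∀ {S a r} → Conn S a r → a ≢ r → FirstEdge S a r
  first-edge-of {S} {a} {r} w a≢r
    with cross (λ v → does (v Fin.≟ a)) w (⇒does (a Fin.≟ a) refl) r≢a
    where
    r≢a : does (r Fin.≟ a) ≡ false
    r≢a with r Fin.≟ a
    ... | yes eq = ⊥-elim (a≢r (sym eq))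
    ... | no  _  = refl
  ... | crossing {f} {v} p j iv _ _ fr with refl ← does⇒ (v Fin.≟ a) iv = first-edge p j fr

  -- Orienting each edge of a forest towards r, every vertex connected to r other than r owns one edge.
  forest-count : ∀ {S} r (A : Vertex → Bool) (B : Edge → Bool) → Acyclic S → A r ≡ true →
                 (∀ a → A a ≡ true → a ≢ r → Σ (FirstEdge S a r) λ fe → B (FirstEdge.g fe) ≡ true) →
                 count A ≤ suc (count B)
  forest-count {S} r A B ac Ar h = ≤-trans (≤-reflexive (count-remove A r Ar)) (s≤s
    (count-injection _ B (λ a p → FirstEdge.g (proj₁ (h′ a p))) (λ a p → proj₂ (h′ a p)) inj))
    where
    ne : ∀ a → A a ∧ not (does (a Fin.≟ r)) ≡ true → a ≢ r
    ne a p eq with A a | a Fin.≟ r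
    ... | true | no ne′ = ne′ eq
    h′ : ∀ a → A a ∧ not (does (a Fin.≟ r)) ≡ true → Σ (FirstEdge S a r) λ fe → B (FirstEdge.g fe) ≡ true
    h′ a p = h a (∧-trueˡ p) (ne a p)
    inj : ∀ a b p q → FirstEdge.g (proj₁ (h′ a p)) ≡ FirstEdge.g (proj₁ (h′ b q)) → a ≡ b
    inj a b p q eq with h′ a p | h′ b q
    ... | first-edge {g} g∈ j w , _ | first-edge g∈′ j′ w′ , _ with refl ← eq with joins-unique j j′
    ...   | inj₁ (a≡b , _) = a≡b
    ...   | inj₂ (refl , refl) = ⊥-elim (ac g _ _ g∈ j (conn-trans w′ (conn-sym w)))

  inside : (Vertex → Bool) → Edge → Bool
  inside A e = A (end₁ e) ∧ A (end₂ e)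

  inside-joins : ∀ A {e a b} → Joins G e a b → A a ≡ true → A b ≡ true → inside A e ≡ true
  inside-joins A {e} j Aa Ab with joins-unique (joins-ends e) j
  ... | inj₁ (p , q) = ∧-true (trans (cong A p) Aa) (trans (cong A q) Ab)
  ... | inj₂ (p , q) = ∧-true (trans (cong A p) Ab) (trans (cong A q) Aa)

  -- Edges outside `S` that touch the component of `v` are included, so nothing can be attached to
  -- it in `S′` and the whole component is the same in both sets.
  Agree : EdgeSet → EdgeSet → Vertex → Set
  Agree S S′ v = ∀ e c d → Conn S v c → Joins G e c d → S e ≡ S′ e

  agree-conn : ∀ {S S′ a b} → Agree S S′ a → Conn S a b → Conn S′ a b
  agree-conn h = conn-restrict λ e c d q j p → trans (sym (h e c d q j)) p

  agree-conn⁻ : ∀ {S S′ a b} → Agree S S′ a → Conn S′ a b → Conn S a b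
  agree-conn⁻ h [] = []
  agree-conn⁻ {S} {S′} {a} h (step {b = c} e p j w) = step e p′ j (agree-conn⁻ (λ e′ c′ d q → h e′ c′ d (step e p′ j q)) w)
    where
    p′ : S ∋ e
    p′ = trans (h e _ _ [] j) p

  agree-sym : ∀ {S S′ v} → Agree S S′ v → Agree S′ S v
  agree-sym h e c d q j = sym (h e c d (agree-conn⁻ h q) j)

  -- One end suffices, since an edge of `S` has both ends in the same component.
  component : EdgeSet → Vertex → EdgeSet
  component S v e = S e ∧ connᵇ S (end₁ e) v

  component⇒ : ∀ S v e → component S v ∋ e → S ∋ e × Conn S (end₁ e) v
  component⇒ S v e p = ∧-trueˡ p , connᵇ⇒ (∧-trueʳ {S e} p)

  ⇒component : ∀ {S v e} → S ∋ e → Conn S (end₁ e) v → component S v ∋ e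
  ⇒component p q = ∧-true p (⇒connᵇ q)

  size : EdgeSet → Vertex → ℕ
  size S v = count (component S v)

  size-conn : ∀ {S a b} → Conn S a b → size S a ≡ size S b
  size-conn {S} {a} {b} ab = count-cong λ e → cong (S e ∧_)
    (bool-ext (λ p → ⇒connᵇ (conn-trans (connᵇ⇒ p) ab)) (λ p → ⇒connᵇ (conn-trans (connᵇ⇒ p) (conn-sym ab))))

  size-agree : ∀ {S S′ v} → Agree S S′ v → size S v ≡ size S′ v
  size-agree {v = v} h = count-cong λ e → bool-ext (to h e) (to (agree-sym h) e)
    where
    to : ∀ {S S′} → Agree S S′ v → ∀ e → component S v ∋ e → component S′ v ∋ e
    to {S} h e p with component⇒ S v e p
    ... | e∈S , c = ⇒component (trans (sym (h e _ _ (conn-sym c) (joins-ends e))) e∈S)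
                               (conn-sym (agree-conn h (conn-sym c)))

  module Cut {S e x y} (e∈S : S ∋ e) (j : Joins G e x y) (bridge : ¬ Conn (S ∖ e) x y) where
    S⁻ : EdgeSet
    S⁻ = S ∖ e

    up : ∀ {a b} → Conn S⁻ a b → Conn S a b
    up = conn-mono (∖-⊑ {S} {e})

    down : ∀ {a} → Conn S a x → Conn S⁻ a x ⊎ Conn S⁻ a y
    down w with conn-split j w
    ... | inj₁ q              = inj₁ q
    ... | inj₂ (inj₁ (q , _)) = inj₁ q
    ... | inj₂ (inj₂ (q , _)) = inj₂ q

    yx : Conn S y x
    yx = edge-conn e∈S (joins-sym j)

    agree : ∀ {v} → ¬ Conn S v x → Agree S S⁻ v
    agree {v} ¬vx e′ c d vc j′ with e′ Fin.≟ e
    ... | no _ with S e′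
    ...   | true  = refl
    ...   | false = refl
    agree {v} ¬vx e′ c d vc j′ | yes refl with joins-unique j′ j
    ...   | inj₁ (refl , _) = ⊥-elim (¬vx vc)
    ...   | inj₂ (refl , _) = ⊥-elim (¬vx (conn-trans vc yx))

    size-cut : size S x ≡ suc (size S⁻ x + size S⁻ y)
    size-cut = trans (count-remove _ e e-in) (cong suc (count-disjoint split (lift []) (lift yx) disjoint))
      where
      e-in : component S x ∋ e
      e-in with joins-unique (joins-ends e) j
      ... | inj₁ (p , _) = ⇒component e∈S (subst (λ v → Conn S v x) (sym p) [])
      ... | inj₂ (p , _) = ⇒component e∈S (subst (λ v → Conn S v x) (sym p) yx)
      split : ∀ h → component S x ∖ e ∋ h → component S⁻ x ∋ h ⊎ component S⁻ y ∋ h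
      split h p with component⇒ S x h (∖-⊑ {component S x} h p)
      ... | h∈S , c with down c
      ...   | inj₁ q = inj₁ (⇒component (∖-intro {S} h∈S (∖-≢ {component S x} p)) q)
      ...   | inj₂ q = inj₂ (⇒component (∖-intro {S} h∈S (∖-≢ {component S x} p)) q)
      lift : ∀ {z} → Conn S z x → ∀ h → component S⁻ z ∋ h → component S x ∖ e ∋ h
      lift {z} zx h p with component⇒ S⁻ z h p
      ... | h∈ , c = ∖-intro {component S x} (⇒component (∖-⊑ {S} h h∈) (conn-trans (up c) zx)) (∖-≢ {S} h∈)
      disjoint : ∀ h → component S⁻ x ∋ h → component S⁻ y ∋ h → _
      disjoint h p q = bridge (conn-trans (conn-sym (proj₂ (component⇒ S⁻ x h p))) (proj₂ (component⇒ S⁻ y h q)))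

  -- Representatives of components and sums over components.

  Below : EdgeSet → Vertex → Set
  Below S v = ∃[ u ] (Conn S u v × u Fin.< v)

  below? : ∀ S v → Dec (Below S v)
  below? S v = Fin.any? λ u → conn? S u v ×-dec (u Fin.<? v)

  -- A component is represented by its vertex of least index.
  isRep : EdgeSet → Vertex → Bool
  isRep S v = not (does (below? S v))

  isRep⇒ : ∀ {S v} → isRep S v ≡ true → ¬ Below S v
  isRep⇒ {S} {v} p b = true≢false (trans (sym (⇒does (below? S v) b)) (not-true p))

  ⇒isRep : ∀ {S v} → ¬ Below S v → isRep S v ≡ true
  ⇒isRep {S} {v} ¬b with below? S v
  ... | yes b = ⊥-elim (¬b b)
  ... | no  _ = refl

  rep-exists : ∀ S v → ∃[ ρ ] (Conn S ρ v × ¬ Below S ρ)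
  rep-exists S v = go (suc (toℕ v)) v ≤-refl
    where
    go : ∀ n v → toℕ v < n → ∃[ ρ ] (Conn S ρ v × ¬ Below S ρ)
    go (suc n) v (s≤s lt) with below? S v
    ... | no ¬b = v , [] , ¬b
    ... | yes (u , uv , u<v) with go n u (≤-trans u<v lt)
    ...   | ρ , ρu , ¬b = ρ , conn-trans ρu uv , ¬b

  rep-unique : ∀ {S a b} → Conn S a b → ¬ Below S a → ¬ Below S b → a ≡ b
  rep-unique {S} {a} {b} ab ¬a ¬b = Fin.toℕ-injective (≤-antisym
    (≮⇒≥ λ lt → ¬a (b , conn-sym ab , lt)) (≮⇒≥ λ lt → ¬b (a , ab , lt)))

  module Potential (F : ℕ → ℕ) where
    term : EdgeSet → Vertex → ℕ
    term S v = when (isRep S v) (F (size S v))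

    potential : EdgeSet → ℕ
    potential S = sum (term S)

    component-sum : ∀ S x → sum (λ v → when (connᵇ S v x) (term S v)) ≡ F (size S x)
    component-sum S x with rep-exists S x
    ... | ρ , ρx , ¬b = trans (sum-cong-≗ merge)
          (trans (sum-when-unique p (λ v → F (size S v)) ρ (∧-true (⇒connᵇ ρx) (⇒isRep ¬b)) uniq) (cong F (size-conn ρx)))
      where
      p : Vertex → Bool
      p v = connᵇ S v x ∧ isRep S v
      merge : ∀ v → when (connᵇ S v x) (term S v) ≡ when (p v) (F (size S v))
      merge v with connᵇ S v x
      ... | true  = refl
      ... | false = refl
      uniq : ∀ v → p v ≡ true → v ≡ ρ
      uniq v pv = rep-unique (conn-trans (connᵇ⇒ (∧-trueˡ pv)) (conn-sym ρx)) (isRep⇒ (∧-trueʳ {connᵇ S v x} pv)) ¬b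

    -- Components not containing the bridge keep their representative and their size; the one of `x`
    -- is replaced by its two sides. Both sides of the equation carry the replaced terms, so no
    -- truncated subtraction occurs.
    potential-cut : ∀ {S e x y} → S ∋ e → Joins G e x y → ¬ Conn (S ∖ e) x y →
                    potential S + (F (size (S ∖ e) x) + F (size (S ∖ e) y)) ≡ potential (S ∖ e) + F (size S x)
    potential-cut {S} {e} {x} {y} e∈S j bridge = begin
      potential S + (F (size S⁻ x) + F (size S⁻ y))
        ≡⟨ cong (_+ (F (size S⁻ x) + F (size S⁻ y))) (trans (sum-partition (λ v → connᵇ S v x) (term S))
             (cong₂ _+_ (component-sum S x) (sum-cong-≗ others))) ⟩
      (F (size S x) + rest) + (F (size S⁻ x) + F (size S⁻ y))
        ≡⟨ +-comm _ (F (size S⁻ x) + F (size S⁻ y)) ⟩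
      (F (size S⁻ x) + F (size S⁻ y)) + (F (size S x) + rest)
        ≡⟨ cong ((F (size S⁻ x) + F (size S⁻ y)) +_) (+-comm _ rest) ⟩
      (F (size S⁻ x) + F (size S⁻ y)) + (rest + F (size S x))
        ≡⟨ +-assoc (F (size S⁻ x) + F (size S⁻ y)) rest (F (size S x)) ⟨
      (F (size S⁻ x) + F (size S⁻ y)) + rest + F (size S x)
        ≡⟨ cong (_+ F (size S x)) (cong (_+ rest) (trans (sum-cong-≗ parts)
             (trans (∑-distrib-+ (λ v → when (connᵇ S⁻ v x) (term S⁻ v)) (λ v → when (connᵇ S⁻ v y) (term S⁻ v)))
               (cong₂ _+_ (component-sum S⁻ x) (component-sum S⁻ y))))) ⟨
      sum (λ v → when (connᵇ S v x) (term S⁻ v)) + rest + F (size S x)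
        ≡⟨ cong (_+ F (size S x)) (sum-partition (λ v → connᵇ S v x) (term S⁻)) ⟨
      potential S⁻ + F (size S x) ∎
      where
      open ≡-Reasoning
      open Cut {S} {e} {x} {y} e∈S j bridge
      rest : ℕ
      rest = sum (λ v → when (not (connᵇ S v x)) (term S⁻ v))
      same-term : ∀ v → ¬ Conn S v x → term S v ≡ term S⁻ v
      same-term v ¬vx = cong₂ when
        (bool-ext (λ p → ⇒isRep λ { (u , uv , lt) → isRep⇒ p (u , up uv , lt) })
                  (λ p → ⇒isRep λ { (u , uv , lt) → isRep⇒ p (u , conn-sym (agree-conn (agree ¬vx) (conn-sym uv)) , lt) }))
        (cong F (size-agree (agree ¬vx)))
      others : ∀ v → when (not (connᵇ S v x)) (term S v) ≡ when (not (connᵇ S v x)) (term S⁻ v)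
      others v with connᵇ S v x in eq
      ... | true  = refl
      ... | false = same-term v (¬connᵇ⇒ eq)
      no-path : ∀ v → ¬ Conn S⁻ v x → ¬ Conn S⁻ v y → ¬ Conn S v x
      no-path v ¬x ¬y vx with down vx
      ... | inj₁ q = ¬x q
      ... | inj₂ q = ¬y q
      parts : ∀ v → when (connᵇ S v x) (term S⁻ v) ≡ when (connᵇ S⁻ v x) (term S⁻ v) + when (connᵇ S⁻ v y) (term S⁻ v)
      parts v with connᵇ S⁻ v x in eqx | connᵇ S⁻ v y in eqy
      ... | true | true = ⊥-elim (bridge (conn-trans (conn-sym (connᵇ⇒ eqx)) (connᵇ⇒ eqy)))
      ... | true | false rewrite ⇒connᵇ (up (connᵇ⇒ eqx)) = sym (+-identityʳ _)
      ... | false | true rewrite ⇒connᵇ (conn-trans (up (connᵇ⇒ eqy)) yx) = refl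
      ... | false | false rewrite ⇒¬connᵇ (no-path v (¬connᵇ⇒ eqx) (¬connᵇ⇒ eqy)) = refl

-- Colourings, explorations and augmentation along them.

module Colourings (G : Graph) (K : ℕ) where

  open Graph G using (#V; loopless)
  open Connectivity G

  Colouring : Set
  Colouring = Edge → Fin (2 + K)

  -- The components of the red forest are to be bounded; parked edges temporarily belong to no part.
  pattern red    = zero
  pattern parked = suc zero
  pattern tree i = suc (suc i)

  class : Colouring → Fin (2 + K) → EdgeSet
  class col c e = does (col e Fin.≟ c)

  Red : Colouring → EdgeSet
  Red col = class col red

  Tree : Colouring → Fin K → EdgeSet
  Tree col i = class col (tree i)

  class⇒ : ∀ col {c} e → class col c ∋ e → col e ≡ c
  class⇒ col {c} e = does⇒ (col e Fin.≟ c)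

  ⇒class : ∀ col {c} e → col e ≡ c → class col c ∋ e
  ⇒class col {c} e = ⇒does (col e Fin.≟ c)

  recolour : Colouring → Edge → Fin (2 + K) → Colouring
  recolour col g c e = if does (e Fin.≟ g) then c else col e

  recolour-same : ∀ col g c → recolour col g c g ≡ c
  recolour-same col g c with g Fin.≟ g
  ... | yes _ = refl
  ... | no ne = ⊥-elim (ne refl)

  recolour-other : ∀ col {g} c {e} → e ≢ g → recolour col g c e ≡ col e
  recolour-other col {g} c {e} ne with e Fin.≟ g
  ... | yes eq = ⊥-elim (ne eq)
  ... | no  _  = refl

  recolour-class : ∀ col {g} c c′ → col g ≢ c′ → c ≢ c′ → ∀ e → class col c′ e ≡ class (recolour col g c) c′ e
  recolour-class col {g} c c′ n₁ n₂ e with e Fin.≟ g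
  ... | no _ = refl
  ... | yes refl with col g Fin.≟ c′ | c Fin.≟ c′
  ...   | yes p | _     = ⊥-elim (n₁ p)
  ...   | no _  | yes p = ⊥-elim (n₂ p)
  ...   | no _  | no _  = refl

  recolour-out : ∀ col {g} c c′ → c ≢ c′ → ∀ e → class (recolour col g c) c′ e ≡ (class col c′ ∖ g) e
  recolour-out col {g} c c′ n e with e Fin.≟ g
  ... | no _ = sym (∧-identityʳ _)
  ... | yes refl with c Fin.≟ c′
  ...   | yes p = ⊥-elim (n p)
  ...   | no _  = sym (∧-zeroʳ _)

  recolour-in : ∀ col {g} c e → class (recolour col g c) c ∋ e → e ≢ g → class col c ∋ e
  recolour-in col {g} c e p ne with e Fin.≟ g
  ... | yes eq = ⊥-elim (ne eq)
  ... | no _   = p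

  recolour-⊒ : ∀ col {g} c c′ → col g ≢ c′ → class col c′ ⊑ class (recolour col g c) c′
  recolour-⊒ col {g} c c′ n e p with e Fin.≟ g
  ... | yes refl = ⊥-elim (n (class⇒ col g p))
  ... | no _     = p

  ≡⇒⊑ : ∀ {S S′ : EdgeSet} → (∀ e → S e ≡ S′ e) → S ⊑ S′
  ≡⇒⊑ h e p = trans (sym (h e)) p

  ≡⇒⊒ : ∀ {S S′ : EdgeSet} → (∀ e → S e ≡ S′ e) → S′ ⊑ S
  ≡⇒⊒ h e p = trans (h e) p

  Forests : Colouring → Set
  Forests col = ∀ i → Acyclic (Tree col i)

  Reach : EdgeSet → List Vertex → Vertex → Set
  Reach R zs v = Any (λ z → Conn R z v) zs

  reach-conn : ∀ {R zs a b} → Reach R zs a → Conn R a b → Reach R zs b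
  reach-conn p ab = Any.map (λ za → conn-trans za ab) p

  infix 4 _≼_
  -- Explorations list the latest component first, so a suffix is an earlier stage of the
  -- exploration.
  data _≼_ : List Vertex → List Vertex → Set where
    here  : ∀ {zs} → zs ≼ zs
    there : ∀ {y ys zs} → ys ≼ zs → ys ≼ y ∷ zs

  ≼-trans : ∀ {xs ys zs} → xs ≼ ys → ys ≼ zs → xs ≼ zs
  ≼-trans p here      = p
  ≼-trans p (there q) = there (≼-trans p q)

  ≼-length : ∀ {ys zs} → ys ≼ zs → List.length ys ≤ List.length zs
  ≼-length here      = ≤-refl
  ≼-length (there p) = m≤n⇒m≤1+n (≼-length p)

  reach-≼ : ∀ {R ys zs v} → ys ≼ zs → Reach R ys v → Reach R zs v
  reach-≼ here      p = p
  reach-≼ (there q) p = there (reach-≼ q p)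

  AgreeOn : EdgeSet → EdgeSet → List Vertex → Set
  AgreeOn R R′ zs = ∀ e c d → Reach R zs c → Joins G e c d → R e ≡ R′ e

  reach-agree : ∀ {R R′ zs v} → AgreeOn R R′ zs → Reach R zs v → Reach R′ zs v
  reach-agree h (here p)  = here (agree-conn (λ e c d q → h e c d (here q)) p)
  reach-agree h (there p) = there (reach-agree (λ e c d q → h e c d (there q)) p)

  reach-agree⁻ : ∀ {R R′ zs v} → AgreeOn R R′ zs → Reach R′ zs v → Reach R zs v
  reach-agree⁻ h (here p)  = here (agree-conn⁻ (λ e c d q → h e c d (here q)) p)
  reach-agree⁻ h (there p) = there (reach-agree⁻ (λ e c d q → h e c d (there q)) p)

  -- In the forest `S` the path from `w` to `r` is unique and begins with `g`. If the smaller set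
  -- still connects `w` to `r`, it contains this path.
  first-edge-kept : ∀ {S S′ w z g r} → Acyclic S → S′ ⊑ S → Conn S′ w r →
                    S ∋ g → Joins G g w z → Conn (S ∖ g) z r → S′ ∋ g × Conn (S′ ∖ g) z r
  first-edge-kept {S} {S′} {w} {z} {g} {r} ac le wr g∈S j zr = g∈S′ , kept
    where
    lost : ¬ Conn (S ∖ g) w r
    lost q = ac g w z g∈S j (conn-trans q (conn-sym zr))
    g∈S′ : S′ ∋ g
    g∈S′ with S′ g in eq
    ... | true  = refl
    ... | false = ⊥-elim (lost (conn-mono (λ e p → ∖-intro {S} (le e p) λ { refl → true≢false (trans (sym p) eq) }) wr))
    kept : Conn (S′ ∖ g) z r
    kept with conn-split j wr
    ... | inj₁ q              = ⊥-elim (lost (conn-mono (∖-mono {S′} {S} le) q))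
    ... | inj₂ (inj₁ (_ , q)) = q
    ... | inj₂ (inj₂ (_ , q)) = ⊥-elim (lost (conn-mono (∖-mono {S′} {S} le) q))

  module Rooted (r : Vertex) where

    -- The exploration from r, latest component first; each red component is given by its entry vertex.
    data Legal (col : Colouring) : List Vertex → Set where
      root   : Legal col (r ∷ [])
      extend : ∀ {zs w z i g} → Legal col zs → Reach (Red col) zs w → Tree col i ∋ g → Joins G g w z →
               Conn (Tree col i ∖ g) z r → ¬ Reach (Red col) zs z → Legal col (z ∷ zs)

    legal-≼ : ∀ {col y ys zs} → y ∷ ys ≼ zs → Legal col zs → Legal col (y ∷ ys)
    legal-≼ here      l = l
    legal-≼ (there ()) root
    legal-≼ (there p) (extend l _ _ _ _ _) = legal-≼ p l

    legal-fresh : ∀ {col z zs} → Legal col (z ∷ zs) → ¬ Reach (Red col) zs z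
    legal-fresh (extend _ _ _ _ _ n) = n

    ArcsKept : Colouring → Colouring → List Vertex → Set
    ArcsKept col col′ zs = ∀ i g w z → Reach (Red col) zs w → Tree col i ∋ g → Joins G g w z → Conn (Tree col i ∖ g) z r →
                           Tree col′ i ∋ g × Conn (Tree col′ i ∖ g) z r

    arcs-kept-⊑ : ∀ col col′ zs → (∀ i → Tree col i ⊑ Tree col′ i) → ArcsKept col col′ zs
    arcs-kept-⊑ col col′ zs le i g w z _ p _ q = le i g p , conn-mono (∖-mono {Tree col i} (le i)) q

    -- Legality sees only the entry vertex of the latest component. Agreement is asked on `zs`
    -- alone, which leaves the component of `z` free to be changed.
    legal-transfer : ∀ {col col′ z zs} → Legal col (z ∷ zs) → AgreeOn (Red col) (Red col′) zs → ArcsKept col col′ zs →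
                     Legal col′ (z ∷ zs)
    legal-transfer root ra ak = root
    legal-transfer {col} {col′} {zs = z′ ∷ zs′} (extend {i = i} l wr p j q n) ra ak with ak i _ _ _ wr p j q
    ... | p′ , q′ = extend
      (legal-transfer l (λ e c d r → ra e c d (there r)) (λ i g w z r → ak i g w z (there r)))
      (reach-agree ra wr) p′ j q′ (λ t → n (reach-agree⁻ ra t))

    Saturated : Colouring → List Vertex → Set
    Saturated col zs = ∀ i w → Reach (Red col) zs w → Conn (Tree col i) w r

    record FirstBad (col : Colouring) (Good : Vertex → Bool) (zs : List Vertex) : Set where
      constructor first-bad
      field
        {z′}   : Vertex
        {zs′}  : List Vertex
        {v}    : Vertex
        suffix : z′ ∷ zs′ ≼ zs
        good   : ∀ w → Reach (Red col) zs′ w → Good w ≡ true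
        reach  : Conn (Red col) z′ v
        bad    : Good v ≡ false

    -- The tail is examined first, so the earliest bad stage is returned. All vertices before it are
    -- good, which yields `Saturated` for the shorter exploration.
    find-bad : ∀ col Good zs → FirstBad col Good zs ⊎ (∀ w → Reach (Red col) zs w → Good w ≡ true)
    find-bad col Good [] = inj₂ λ _ ()
    find-bad col Good (z ∷ zs) with find-bad col Good zs
    ... | inj₁ (first-bad s g q b) = inj₁ (first-bad (there s) g q b)
    ... | inj₂ good with Fin.any? (λ v → conn? (Red col) z v ×-dec (Good v ≟ᵇ false))
    ...   | yes (v , q , b) = inj₁ (first-bad here good q b)
    ...   | no none = inj₂ λ { w (there q) → good w q ; w (here q) → good-here w q }
      where
      good-here : ∀ w → Conn (Red col) z w → Good w ≡ true
      good-here w q with Good w in eq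
      ... | true  = refl
      ... | false = ⊥-elim (none (w , q , eq))

    -- The net effect on connections is at most to merge the pieces of `v′` and `r` in tree `j`.
    -- `others` and `merged` state this as an upper bound, because later certain vertices have to
    -- stay apart (see `T₂-separates`). By `proper` the change happens before `z` if `z` itself is
    -- cut off.
    record Augmented (col : Colouring) (j : Fin K) (z : Vertex) (zs : List Vertex) : Set where
      field
        {col′}  : Colouring
        {e}     : Edge
        {z′}    : Vertex
        {zs′}   : List Vertex
        {p p′}  : Vertex
        {v′}    : Vertex
        e-red   : Red col ∋ e
        red-eq  : ∀ h → Red col′ h ≡ (Red col ∖ e) h
        park-eq : ∀ h → class col′ parked h ≡ class col parked h
        forests : Forests col′
        suffix  : z′ ∷ zs′ ≼ z ∷ zs
        proper  : ¬ Conn (Tree col j) z r → z′ ∷ zs′ ≼ zs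
        legal   : Legal col′ (z′ ∷ zs′)
        joins   : Joins G e p p′
        near    : Conn (Red col ∖ e) z′ p
        reach   : Conn (Red col) z v′
        others  : ∀ i → i ≢ j → ∀ {a b} → Conn (Tree col′ i) a b → Conn (Tree col i) a b
        merged  : ∀ {a b} → Conn (Tree col′ j) a b → Conn (Tree col j) a b ⊎
                  (Conn (Tree col j) a v′ ⊎ Conn (Tree col j) a r) × (Conn (Tree col j) b v′ ⊎ Conn (Tree col j) b r)

    -- If z is cut off from r in tree j, the edge g through which z was entered is moved to tree j, and
    -- the tree that loses g is repaired in turn at an earlier position of the exploration.
    abstract
      augment : ∀ n col j z zs v → List.length zs ≤ n → Forests col → Legal col (z ∷ zs) → Saturated col zs →
                Conn (Red col) z v → ¬ Conn (Tree col j) v r → Augmented col j z zs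
      augment n col j z zs v len fo l sat zv ¬vr with conn? (Tree col j) z r
      augment n col j z zs v len fo l sat zv ¬vr | yes zr
        -- In tree `j` the vertex `z` is tied to `r` and `v` is not, so the red path between them
        -- has an edge from the piece of `r` to another piece; this edge can pass to tree `j`.
        with cross (λ u → connᵇ (Tree col j) u r) zv (⇒connᵇ zr) (⇒¬connᵇ ¬vr)
      ... | crossing {f} {p} {p′} f∈ jf pin pout nr fr = record
        { col′ = col′ ; e-red = f∈ ; red-eq = recolour-out col (tree j) red (λ ())
        ; park-eq = λ h → sym (recolour-class col (tree j) parked fn (λ ()) h)
        ; forests = forests′
        ; suffix = here
        ; proper = λ ¬zr → ⊥-elim (¬zr zr)
        ; legal = legal-transfer l ra (arcs-kept-⊑ col col′ zs grow)
        ; joins = jf ; near = nr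
        ; reach = zp′
        ; others = λ i ne → conn-mono (≡⇒⊒ (same i ne))
        ; merged = merged′ }
        where
        col′ : Colouring
        col′ = recolour col f (tree j)
        f-red : col f ≡ red
        f-red = class⇒ col f f∈
        fn : ∀ {c : Fin (suc K)} → col f ≢ suc c
        fn eq with () ← trans (sym f-red) eq
        grow : ∀ i → Tree col i ⊑ Tree col′ i
        grow i = recolour-⊒ col (tree j) (tree i) fn
        same : ∀ i → i ≢ j → ∀ e → Tree col i e ≡ Tree col′ i e
        same i ne = recolour-class col (tree j) (tree i) fn (λ { refl → ne refl })
        pr : Conn (Tree col j) p r
        pr = connᵇ⇒ pin
        ¬p′r : ¬ Conn (Tree col j) p′ r
        ¬p′r = ¬connᵇ⇒ pout
        forests′ : Forests col′
        forests′ i with i Fin.≟ j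
        ... | yes refl = acyclic-insert (recolour-in col (tree j)) jf (λ q → ¬p′r (conn-trans (conn-sym q) pr)) (fo j)
        ... | no ne    = acyclic-⊑ (≡⇒⊒ (same i ne)) (fo i)
        zp : Conn (Red col) z p
        zp = conn-mono (∖-⊑ {Red col} {f}) nr
        zp′ : Conn (Red col) z p′
        zp′ = conn-trans zp (edge-conn f∈ jf)
        ra : AgreeOn (Red col) (Red col′) zs
        ra e c d rc je with e Fin.≟ f
        ... | no _ = refl
        ... | yes refl with joins-unique je jf
        ...   | inj₁ (refl , _) = ⊥-elim (legal-fresh l (reach-conn rc (conn-sym zp)))
        ...   | inj₂ (refl , _) = ⊥-elim (legal-fresh l (reach-conn rc (conn-sym zp′)))
        merged′ : ∀ {a b} → Conn (Tree col′ j) a b → Conn (Tree col j) a b ⊎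
                  (Conn (Tree col j) a p′ ⊎ Conn (Tree col j) a r) × (Conn (Tree col j) b p′ ⊎ Conn (Tree col j) b r)
        merged′ ab with conn-insert {S = Tree col j} (recolour-in col (tree j)) jf ab
        ... | inj₁ q              = inj₁ q
        ... | inj₂ (inj₁ (q , t)) = inj₂ (inj₂ (conn-trans q pr) , inj₁ (conn-sym t))
        ... | inj₂ (inj₂ (q , t)) = inj₂ (inj₁ q , inj₂ (conn-trans (conn-sym t) pr))
      augment n col j z zs v len fo root sat zv ¬vr | no ¬zr = ⊥-elim (¬zr [])
      augment zero col j z [] v len fo (extend () _ _ _ _ _) sat zv ¬vr | no ¬zr
      augment (suc n) col j z zs v len fo (extend {w = w} {i = j₁} {g = g} l wr g∈ jg zr₁ fresh) sat zv ¬vr | no ¬zr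
        with find-bad (recolour col g (tree j)) (λ u → connᵇ (Tree (recolour col g (tree j)) j₁) u r) zs
      -- Impossible: the tail `w` of `g` was tied to `r` in tree `j₁` only by a path through `z`, so
      -- it is bad once `g` has moved, as `lost` shows.
      ... | inj₂ good = ⊥-elim (lost (connᵇ⇒ (good w (reach-agree ra wr))))
        where
        j₁≢j : j₁ ≢ j
        j₁≢j refl = ¬zr (conn-trans (edge-conn g∈ (joins-sym jg)) (sat j w wr))
        ra : ∀ {zs} → AgreeOn (Red col) (Red (recolour col g (tree j))) zs
        ra e _ _ _ _ = recolour-class col (tree j) red gn (λ ()) e
          where
          gn : col g ≢ red
          gn eq with () ← trans (sym (class⇒ col g g∈)) eq
        lost : ¬ Conn (Tree (recolour col g (tree j)) j₁) w r
        lost q = fo j₁ g w z g∈ jg (conn-trans (conn-mono (≡⇒⊑ (recolour-out col (tree j) (tree j₁) λ { refl → j₁≢j refl })) q) (conn-sym zr₁))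
      ... | inj₁ (first-bad {z″} {zs″} {v₁} suf good reach₁ bad) = record
        { col′ = A.col′ ; e-red = ≡⇒⊒ red-same A.e A.e-red
        ; red-eq = λ h → trans (A.red-eq h) (cong (_∧ not (does (h Fin.≟ A.e))) (sym (red-same h)))
        ; park-eq = λ h → trans (A.park-eq h) (sym (recolour-class col (tree j) parked (gn λ ()) (λ ()) h))
        ; forests = A.forests
        ; suffix = ≼-trans A.suffix (there suf)
        ; proper = λ _ → ≼-trans A.suffix suf
        ; legal = A.legal
        ; joins = A.joins
        ; near = conn-mono (∖-mono {Red col₁} (≡⇒⊒ red-same)) A.near
        ; reach = []
        ; others = others′
        ; merged = merged′ }
        where
        col₁ : Colouring
        col₁ = recolour col g (tree j)
        j₁≢j : j₁ ≢ j
        j₁≢j refl = ¬zr (conn-trans (edge-conn g∈ (joins-sym jg)) (sat j w wr))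
        gn : ∀ {c} → tree j₁ ≢ c → col g ≢ c
        gn ne eq = ne (trans (sym (class⇒ col g g∈)) eq)
        red-same : ∀ e → Red col e ≡ Red col₁ e
        red-same = recolour-class col (tree j) red (gn λ ()) (λ ())
        ra : ∀ zs → AgreeOn (Red col) (Red col₁) zs
        ra zs e _ _ _ _ = red-same e
        shrink : Tree col₁ j₁ ⊑ Tree col j₁
        shrink e p = ∖-⊑ {Tree col j₁} {g} e (≡⇒⊑ (recolour-out col (tree j) (tree j₁) λ { refl → j₁≢j refl }) e p)
        grow : ∀ i → i ≢ j₁ → Tree col i ⊑ Tree col₁ i
        grow i ne = recolour-⊒ col (tree j) (tree i) (gn λ { refl → ne refl })
        same : ∀ i → i ≢ j₁ → i ≢ j → Tree col₁ i ⊑ Tree col i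
        same i ne ne′ = ≡⇒⊒ (recolour-class col (tree j) (tree i) (gn λ { refl → ne refl }) λ { refl → ne′ refl })
        ¬wz : ¬ Conn (Tree col j) w z
        ¬wz q = ¬zr (conn-trans (conn-sym q) (sat j w wr))
        fo₁ : Forests col₁
        fo₁ i with i Fin.≟ j | i Fin.≟ j₁
        ... | yes refl | _        = acyclic-insert (recolour-in col (tree j)) jg ¬wz (fo j)
        ... | no _     | yes refl = acyclic-⊑ shrink (fo j₁)
        ... | no ne    | no ne′   = acyclic-⊑ (same i ne′ ne) (fo i)
        back : ∀ {zs v} → Reach (Red col₁) zs v → Reach (Red col) zs v
        back {zs} = reach-agree⁻ (ra zs)
        sub : zs″ ≼ zs
        sub = ≼-trans (there here) suf
        ak : ArcsKept col col₁ zs″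
        ak i h w′ z′ wr′ h∈ jh q with i Fin.≟ j₁
        -- Tree `j₁` has lost `g`, but before the first bad stage all vertices are still tied to `r`
        -- in it, so their paths are intact.
        ... | yes refl = first-edge-kept (fo j₁) shrink (connᵇ⇒ (good w′ (reach-agree (ra zs″) wr′))) h∈ jh q
        ... | no ne    = grow i ne h h∈ , conn-mono (∖-mono {Tree col i} (grow i ne)) q
        sat₁ : Saturated col₁ zs″
        sat₁ i w′ wr′ with i Fin.≟ j₁
        ... | yes refl = connᵇ⇒ (good w′ wr′)
        ... | no ne    = conn-mono (grow i ne) (sat i w′ (reach-≼ sub (back wr′)))
        IH : Augmented col₁ j₁ z″ zs″
        IH = augment n col₁ j₁ z″ zs″ v₁ (≤-pred (≤-trans (≼-length suf) len)) fo₁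
               (legal-transfer (legal-≼ suf l) (ra zs″) ak) sat₁ reach₁ (¬connᵇ⇒ bad)
        module A = Augmented IH
        -- Already in `col` the vertex `A.v′` is tied to `r` in tree `j₁`, so the merging done by
        -- the recursive call creates no connection that is new with respect to `col`.
        v₁′r : Conn (Tree col j₁) A.v′ r
        v₁′r = sat j₁ A.v′ (reach-≼ suf (here (conn-mono (≡⇒⊒ red-same) A.reach)))
        home : ∀ {a} → Conn (Tree col₁ j₁) a A.v′ ⊎ Conn (Tree col₁ j₁) a r → Conn (Tree col j₁) a r
        home (inj₁ q) = conn-trans (conn-mono shrink q) v₁′r
        home (inj₂ q) = conn-mono shrink q
        others′ : ∀ i → i ≢ j → ∀ {a b} → Conn (Tree A.col′ i) a b → Conn (Tree col i) a b
        others′ i ne ab with i Fin.≟ j₁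
        ... | no ne′ = conn-mono (same i ne′ ne) (A.others i ne′ ab)
        ... | yes refl with A.merged ab
        ...   | inj₁ q       = conn-mono shrink q
        ...   | inj₂ (p , q) = conn-trans (home p) (conn-sym (home q))
        merged′ : ∀ {a b} → Conn (Tree A.col′ j) a b → Conn (Tree col j) a b ⊎
                  (Conn (Tree col j) a z ⊎ Conn (Tree col j) a r) × (Conn (Tree col j) b z ⊎ Conn (Tree col j) b r)
        merged′ ab with conn-insert {S = Tree col j} (recolour-in col (tree j)) jg (A.others j (λ eq → j₁≢j (sym eq)) ab)
        ... | inj₁ q              = inj₁ q
        ... | inj₂ (inj₁ (q , t)) = inj₂ (inj₂ (conn-trans q (sat j w wr)) , inj₁ (conn-sym t))
        ... | inj₂ (inj₂ (q , t)) = inj₂ (inj₁ q , inj₂ (conn-trans (conn-sym t) (sat j w wr)))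

  record Valid (col : Colouring) : Set where
    field
      forests   : Forests col
      acyclic   : Acyclic (Red col)
      no-parked : ∀ h → col h ≢ parked

  reach? : ∀ R zs v → Dec (Reach R zs v)
  reach? R zs v = Any.any? (λ z → conn? R z v) zs

  record Augmentation (col : Colouring) : Set where
    field
      {col′}  : Colouring
      {e}     : Edge
      e-red   : Red col ∋ e
      red-eq  : ∀ h → Red col′ h ≡ (Red col ∖ e) h
      park-eq : ∀ h → class col′ parked h ≡ class col parked h
      forests : Forests col′

    red-count : count (Red col) ≡ suc (count (Red col′))
    red-count = trans (count-remove (Red col) e e-red) (cong suc (count-cong (λ h → sym (red-eq h))))

  count-classes : ∀ col (B : Edge → Bool) →
                  count B ≡ sum (λ c → count (λ e → class col c e ∧ B e))
  count-classes col B = trans (sum-cong-≗ pointwise) (∑-comm (λ e c → when (class col c e ∧ B e) 1))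
    where
    merge : ∀ a b → when (a ∧ b) 1 ≡ when a (when b 1)
    merge true  b = refl
    merge false b = refl
    pointwise : ∀ e → when (B e) 1 ≡ sum (λ c → when (class col c e ∧ B e) 1)
    pointwise e = sym (trans (sum-cong-≗ (λ c → merge (class col c e) (B e)))
      (sum-when-unique (λ c → class col c e) (λ _ → when (B e) 1) (col e) (⇒class col e refl) (λ c p → sym (class⇒ col e p))))

  -- Complete explorations and decomposition into forests.

  module Exploration (r : Vertex) where
    open Rooted r

    record Closed (col : Colouring) (zs : List Vertex) : Set where
      field
        saturated : Saturated col zs
        closed    : ∀ i w → Reach (Red col) zs w → w ≢ r →
                    Σ (FirstEdge (Tree col i) w r) λ fe → Reach (Red col) zs (FirstEdge.z fe)

    explore : ∀ col zs → Forests col → Legal col zs →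
              Augmentation col ⊎ (∃[ z ] Legal col (z ∷ zs)) ⊎ Closed col zs
    explore col zs fo l with find-bad col (λ v → does (Fin.all? λ i → conn? (Tree col i) v r)) zs
    ... | inj₁ (first-bad {z′} {zs′} {v} suf good reach bad)
      with Fin.¬∀⟶∃¬ K _ (λ i → conn? (Tree col i) v r)
             (λ all → true≢false (trans (sym (⇒does (Fin.all? λ i → conn? (Tree col i) v r) all)) bad))
    ...   | i , ¬vr = inj₁ record { col′ = A.col′ ; e-red = A.e-red ; red-eq = A.red-eq ; park-eq = A.park-eq ; forests = A.forests }
      where
      module A = Augmented (augment _ col i z′ zs′ v ≤-refl fo (legal-≼ suf l)
        (λ i w p → does⇒ (Fin.all? λ i → conn? (Tree col i) w r) (good w p) i) reach ¬vr)
    explore col zs fo l | inj₂ good = inj₂ result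
      where
      sat : Saturated col zs
      sat i w p = does⇒ (Fin.all? λ i → conn? (Tree col i) w r) (good w p) i
      out : ∀ i w → (∃[ z ] Legal col (z ∷ zs)) ⊎
            (Reach (Red col) zs w → w ≢ r → Σ (FirstEdge (Tree col i) w r) λ fe → Reach (Red col) zs (FirstEdge.z fe))
      out i w with reach? (Red col) zs w | w Fin.≟ r
      ... | no ¬p | _      = inj₂ λ p → ⊥-elim (¬p p)
      ... | yes p | yes eq = inj₂ λ _ ne → ⊥-elim (ne eq)
      ... | yes p | no ne with first-edge-of (sat i w p) ne
      ...   | fe@(first-edge {g} {z} g∈ j rest) with reach? (Red col) zs z
      ...     | yes q = inj₂ λ _ _ → fe , q
      ...     | no ¬q = inj₁ (z , extend l p g∈ j rest ¬q)
      result : (∃[ z ] Legal col (z ∷ zs)) ⊎ Closed col zs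
      result with search (λ i → search (out i))
      ... | inj₁ (_ , _ , p) = inj₁ p
      ... | inj₂ q = inj₂ record { saturated = sat ; closed = q }

    legal-root : ∀ {col zs} → Legal col zs → Reach (Red col) zs r
    legal-root root                 = here []
    legal-root (extend l _ _ _ _ _) = there (legal-root l)

    reached : Colouring → List Vertex → Vertex → Bool
    reached col zs v = does (reach? (Red col) zs v)

    reached⇒ : ∀ col zs v → reached col zs v ≡ true → Reach (Red col) zs v
    reached⇒ col zs v = does⇒ (reach? (Red col) zs v)

    ⇒reached : ∀ col zs v → Reach (Red col) zs v → reached col zs v ≡ true
    ⇒reached col zs v = ⇒does (reach? (Red col) zs v)

    legal-length : ∀ {col zs} → Legal col zs → List.length zs ≤ #V
    legal-length {col} {zs} l = ≤-trans (go l) (count-≤n _)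
      where
      go : ∀ {zs} → Legal col zs → List.length zs ≤ count (reached col zs)
      go root = ∃⇒count>0 _ r (⇒reached col (r ∷ []) r (here []))
      go (extend {zs} {z = z} l _ _ _ _ fresh) = ≤-trans (s≤s (go l))
        (count-strict z (⇒reached col (z ∷ zs) z (here [])) not-yet
          (λ v p → ⇒reached col (z ∷ zs) v (there (reached⇒ col zs v p))))
        where
        not-yet : reached col zs z ≡ false
        not-yet with reach? (Red col) zs z
        ... | yes q = ⊥-elim (fresh q)
        ... | no  _ = refl

    -- Closedness keeps the first edge of every reached vertex inside the reached set, so by
    -- `forest-count` each of the `K` trees has at least `count A ∸ 1` edges there. The red edges
    -- come on top.
    closed-count : ∀ {col zs} → Forests col → Legal col zs → Closed col zs →
                   K * (count (reached col zs) ∸ 1) + count (λ e → Red col e ∧ inside (reached col zs) e)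
                     ≤ count (inside (reached col zs))
    closed-count {col} {zs} fo l cl = begin
      K * (count A ∸ 1) + R                ≡⟨ +-comm _ R ⟩
      R + K * (count A ∸ 1)                ≡⟨ cong (R +_) (sum-const K (count A ∸ 1)) ⟨
      -- The sum over all colours unfolds to red, parked and the trees; `m≤n+m` drops the parked
      -- summand.
      R + sum {K} (λ _ → count A ∸ 1)      ≤⟨ +-monoʳ-≤ R (≤-trans (sum-mono per-tree) (m≤n+m _ (count (λ e → class col parked e ∧ inside A e)))) ⟩
      sum (λ c → count (λ e → class col c e ∧ inside A e)) ≡⟨ count-classes col (inside A) ⟨
      count (inside A)                     ∎
      where
      open ≤-Reasoning
      A : Vertex → Bool
      A = reached col zs
      R : ℕ
      R = count (λ e → Red col e ∧ inside A e)
      owned : ∀ i a → A a ≡ true → a ≢ r →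
              Σ (FirstEdge (Tree col i) a r) λ fe → Tree col i (FirstEdge.g fe) ∧ inside A (FirstEdge.g fe) ≡ true
      owned i a p ne with Closed.closed cl i a (reached⇒ col zs a p) ne
      ... | fe@(first-edge g∈ j _) , q = fe , ∧-true g∈ (inside-joins A j p (⇒reached col zs _ q))
      per-tree : ∀ i → count A ∸ 1 ≤ count (λ e → Tree col i e ∧ inside A e)
      per-tree i = ∸-monoˡ-≤ 1 (forest-count r A _ (fo i) (⇒reached col zs r (legal-root l)) (owned i))

    explore-fully : ∀ n col zs → #V ≤ n + List.length zs → Forests col → Legal col zs →
                    Augmentation col ⊎ (∃[ zs′ ] Legal col zs′ × Closed col zs′)
    explore-fully n col zs len fo l with explore col zs fo l
    ... | inj₁ a = inj₁ a
    ... | inj₂ (inj₂ c) = inj₂ (zs , l , c)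
    explore-fully zero col zs len fo l | inj₂ (inj₁ (z , l′)) = ⊥-elim (1+n≰n (≤-trans (legal-length l′) len))
    explore-fully (suc n) col zs len fo l | inj₂ (inj₁ (z , l′)) =
      explore-fully n col (z ∷ zs) (≤-trans len (≤-reflexive (sym (+-suc n _)))) fo l′

  -- Starting with all edges red, one explores from an end of a red edge. An augmentation moves one
  -- red edge into the trees; a closed exploration would contain `K * (count A ∸ 1)` tree edges and
  -- a red one, too many for `sparse`. The red edges need not form a forest here.
  nash-williams : (∀ A → 2 ≤ count A → count (inside A) ≤ K * (count A ∸ 1)) →
                  ∃[ col ] Forests col × (∀ e → ∃[ i ] col e ≡ tree i)
  nash-williams sparse = go (count (Red (λ _ → red))) (λ _ → red) ≤-refl
    (λ i e a b p → ⊥-elim (red≢tree (class⇒ (λ _ → red) {tree i} e p))) (λ e → refl)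
    where
    red≢tree : ∀ {i : Fin K} → _≢_ {A = Fin (2 + K)} red (tree i)
    red≢tree ()
    go : ∀ n col → count (Red col) ≤ n → Forests col → (∀ e → class col parked e ≡ false) →
         ∃[ col′ ] Forests col′ × (∀ e → ∃[ i ] col′ e ≡ tree i)
    go n col le fo np with search {P = λ e → Red col ∋ e} {Q = λ e → Red col e ≡ false} dec
      where
      dec : ∀ e → Red col ∋ e ⊎ Red col e ≡ false
      dec e with Red col e
      ... | true  = inj₁ refl
      ... | false = inj₂ refl
    ... | inj₂ none = col , fo , coloured
      where
      coloured : ∀ e → ∃[ i ] col e ≡ tree i
      coloured e with col e in eq
      ... | red    = ⊥-elim (true≢false (trans (sym (⇒class col e eq)) (none e)))
      ... | parked = ⊥-elim (true≢false (trans (sym (⇒class col e eq)) (np e)))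
      ... | tree i = i , refl
    ... | inj₁ (e , e∈) with Exploration.explore-fully (end₁ e) #V col (end₁ e ∷ []) (m≤m+n _ _) fo Rooted.root
    ...   | inj₁ a = next n le
      where
      module A = Augmentation a
      next : ∀ n → count (Red col) ≤ n → ∃[ col′ ] Forests col′ × (∀ e → ∃[ i ] col′ e ≡ tree i)
      next zero    le = ⊥-elim (1+n≰n (≤-trans (≤-reflexive (sym A.red-count)) (≤-trans le z≤n)))
      next (suc n) le = go n A.col′ (≤-pred (≤-trans (≤-reflexive (sym A.red-count)) le)) A.forests
                          (λ h → trans (A.park-eq h) (np h))
    ...   | inj₂ (zs , l , cl) = ⊥-elim (1+n≰n (begin
      suc (K * (count A ∸ 1))       ≡⟨ +-comm 1 _ ⟩
      K * (count A ∸ 1) + 1         ≤⟨ +-monoʳ-≤ _ (∃⇒count>0 _ e (∧-true e∈ (∧-true A₁ A₂))) ⟩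
      K * (count A ∸ 1) + count (λ e → Red col e ∧ inside A e) ≤⟨ closed-count fo l cl ⟩
      count (inside A)              ≤⟨ sparse A (count≥2 A A₁ A₂ (loopless e)) ⟩
      K * (count A ∸ 1)             ∎))
      where
      open ≤-Reasoning
      open Exploration (end₁ e)
      A : Vertex → Bool
      A = reached col zs
      A₁ : A (end₁ e) ≡ true
      A₁ = ⇒reached col zs _ (legal-root l)
      A₂ : A (end₂ e) ≡ true
      A₂ = ⇒reached col zs _ (reach-conn (legal-root l) (edge-conn e∈ (joins-ends e)))

-- Excess of red components and detachment of children.

module Improvement (G : Graph) (K D : ℕ) where

  open Connectivity G
  open Colourings G K

  excess : ℕ → ℕ
  excess n = n ∸ D

  open Potential excess

  -- If `a` or `b` is within `D`, its excess is zero and monotonicity suffices. Otherwise `D` is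
  -- subtracted twice on the left and once on the right, which is the slack in the last hypothesis.
  excess-convex : ∀ {a b c} → a ≤ c → b ≤ c → a + b ≤ c + D → excess a + excess b ≤ excess c
  excess-convex {a} {b} {c} a≤c b≤c ab with ≤-total a D | ≤-total b D
  ... | inj₁ a≤D | _ rewrite m≤n⇒m∸n≡0 a≤D = ∸-monoˡ-≤ D b≤c
  ... | inj₂ _ | inj₁ b≤D rewrite m≤n⇒m∸n≡0 b≤D | +-identityʳ (a ∸ D) = ∸-monoˡ-≤ D a≤c
  ... | inj₂ D≤a | inj₂ D≤b = m+n≤o⇒m≤o∸n (excess a + excess b) (+-cancelʳ-≤ D _ _ (begin
    a ∸ D + (b ∸ D) + D + D     ≡⟨ rearrange (a ∸ D) (b ∸ D) D ⟩
    (a ∸ D + D) + (b ∸ D + D)   ≡⟨ cong₂ _+_ (m∸n+n≡m D≤a) (m∸n+n≡m D≤b) ⟩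
    a + b                       ≤⟨ ab ⟩
    c + D                       ∎))
    where
    open ≤-Reasoning
    rearrange : ∀ p q D → p + q + D + D ≡ (p + D) + (q + D)
    rearrange = solve-∀

  potential-cong : ∀ {S S′} → (∀ e → S e ≡ S′ e) → potential S ≡ potential S′
  potential-cong {S} {S′} eq = sum-cong-≗ pointwise
    where
    pointwise : ∀ v → term S v ≡ term S′ v
    pointwise v = cong₂ when
      (bool-ext {isRep S v} {isRep S′ v}
        (λ p → ⇒isRep {S′} λ { (u , uv , lt) → isRep⇒ {S} p (u , conn-mono (≡⇒⊒ eq) uv , lt) })
        (λ p → ⇒isRep {S} λ { (u , uv , lt) → isRep⇒ {S′} p (u , conn-mono (≡⇒⊑ eq) uv , lt) }))
      (cong excess (size-agree (λ e _ _ _ _ → eq e)))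

  -- In a forest `S`, deleting `f` cuts `x i` off from `u` but leaves all other `x j` with `u`. The
  -- ends of `f` lie in different pieces of `T`, so `f` may join `T`.
  record Leaf (S T : EdgeSet) (u : Vertex) {p : ℕ} (x : Fin (suc p) → Vertex) : Set where
    field
      i       : Fin (suc p)
      {f}     : Edge
      {v w}   : Vertex
      f∈S     : S ∋ f
      joins   : Joins G f v w
      v∼x     : Conn T v (x i)
      w≁x     : ¬ Conn T w (x i)
      x-side  : Conn (S ∖ f) (x i) v
      u-side  : Conn (S ∖ f) w u
      others  : ∀ j → j ≢ i → Conn (S ∖ f) w (x j)

  -- Rooting the red tree at u, the edge where the path from x i to u first leaves the T-component of x i
  -- is pushed downwards until no other x j lies below it.
  abstract
    find-leaf : ∀ {S T u p} (x : Fin (suc p) → Vertex) → Acyclic S → (∀ i → Conn S u (x i)) →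
                (∀ i → ¬ Conn T u (x i)) → (∀ i j → i ≢ j → ¬ Conn T (x i) (x j)) → Leaf S T u x
    find-leaf {S} {T} {u} {p} x ac ux u≁x x≁x
      with cross (λ a → connᵇ T a (x zero)) (conn-sym (ux zero)) (⇒connᵇ []) (⇒¬connᵇ (u≁x zero))
    ... | crossing f∈ j v∈ w∉ nr fr = go _ zero f∈ j (connᵇ⇒ v∈) (¬connᵇ⇒ w∉) nr fr ≤-refl
      where
      go : ∀ n i {f v w} → S ∋ f → Joins G f v w → Conn T v (x i) → ¬ Conn T w (x i) →
           Conn (S ∖ f) (x i) v → Conn (S ∖ f) w u → count (λ a → connᵇ (S ∖ f) a v) < n → Leaf S T u x
      go (suc n) i {f} {v} {w} f∈ j vx wx xv wu (s≤s lt)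
        with Fin.any? (λ l → ¬? (l Fin.≟ i) ×-dec conn? (S ∖ f) (x l) v)
      ... | no none = record { i = i ; f∈S = f∈ ; joins = j ; v∼x = vx ; w≁x = wx ; x-side = xv ; u-side = wu ; others = others }
        where
        others : ∀ l → l ≢ i → Conn (S ∖ f) w (x l)
        others l ne with conn-split j (conn-sym (ux l))
        ... | inj₁ q              = conn-trans wu (conn-sym q)
        ... | inj₂ (inj₁ (q , _)) = ⊥-elim (none (l , ne , q))
        ... | inj₂ (inj₂ (q , _)) = conn-sym q
      ... | yes (l , ne , lv)
        with cross (λ a → connᵇ T a (x l)) lv (⇒connᵇ []) (⇒¬connᵇ (λ q → x≁x l i ne (conn-trans (conn-sym q) vx)))
      ...   | crossing {f′} {v′} {w′} f′∈ j′ v′∈ w′∉ nr fr =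
        -- The number of vertices below the edge decreases: all those below `f′` are below `f`, and
        -- `v` is below `f` only.
        go n l f′∈S j′ (connᵇ⇒ v′∈) (¬connᵇ⇒ w′∉) (shrink nr) (conn-trans w′v (step f f∈′ j (shrink wu′)))
           (≤-trans (count-strict v (⇒connᵇ []) (⇒¬connᵇ vv′) inc) lt)
        where
        f′∈S : S ∋ f′
        f′∈S = ∖-⊑ {S} {f} f′ f′∈
        shrink : ∀ {a b} → Conn (S ∖ f ∖ f′) a b → Conn (S ∖ f′) a b
        shrink = conn-mono (∖-mono {S ∖ f} {S} (∖-⊑ {S} {f}))
        w′v : Conn (S ∖ f′) w′ v
        w′v = shrink fr
        f∈′ : S ∖ f′ ∋ f
        f∈′ = ∖-intro {S} f∈ λ eq → ∖-≢ {S} f′∈ (sym eq)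
        v′v : Conn (S ∖ f) v′ v
        v′v = conn-trans (conn-sym (conn-mono (∖-⊑ {S ∖ f} {f′}) nr)) lv
        ¬wv : ¬ Conn (S ∖ f) w v
        ¬wv q = ac f v w f∈ j (conn-sym q)
        wu′ : Conn (S ∖ f ∖ f′) w u
        wu′ = conn-avoid j′ (λ q → ¬wv (conn-trans q v′v))
                (λ q → ¬wv (conn-trans q (conn-mono (∖-⊑ {S ∖ f} {f′}) fr))) wu
        vv′ : ¬ Conn (S ∖ f′) v v′
        vv′ q = ac f′ v′ w′ f′∈S j′ (conn-sym (conn-trans w′v q))
        inc : ∀ a → connᵇ (S ∖ f′) a v′ ≡ true → connᵇ (S ∖ f) a v ≡ true
        inc a p = ⇒connᵇ (conn-trans (conn-mono (∖-mono {S ∖ f′} {S} (∖-⊑ {S} {f′}))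
                    (conn-avoid j (λ q → vv′ (conn-trans (conn-sym q) av′))
                      (λ q → vv′ (conn-trans (edge-conn f∈′ j) (conn-trans (conn-sym q) av′))) av′)) v′v)
          where
          av′ : Conn (S ∖ f′) a v′
          av′ = connᵇ⇒ p

  record Child : Set where
    constructor child
    field
      x y : Vertex
      g   : Edge
  open Child

  -- The parked edges have already left tree `t`, which has to be repaired by as many red edges from
  -- the component of `u`. The separation of the `x` and `u` in tree `t` guarantees that these can
  -- be found.
  record Detachable (col : Colouring) (t : Fin K) (u : Vertex) (s : ℕ) {p : ℕ} (X : Fin p → Child) : Set where
    field
      u∼x     : ∀ i → Conn (Red col) u (x (X i))
      u≁y     : ∀ i → ¬ Conn (Red col) u (y (X i))
      y≁y     : ∀ i j → i ≢ j → ¬ Conn (Red col) (y (X i)) (y (X j))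
      park    : ∀ i → col (g (X i)) ≡ parked
      joins   : ∀ i → Joins G (g (X i)) (x (X i)) (y (X i))
      small   : ∀ i → size (Red col) (y (X i)) ≤ s
      u≁x     : ∀ i → ¬ Conn (Tree col t) u (x (X i))
      x≁x     : ∀ i j → i ≢ j → ¬ Conn (Tree col t) (x (X i)) (x (X j))

  record Detached (col : Colouring) (u : Vertex) (s : ℕ) {p : ℕ} (X : Fin p → Child) : Set where
    field
      {col′}    : Colouring
      forests   : Forests col′
      acyclic   : Acyclic (Red col′)
      grow      : ∀ i → Tree col i ⊑ Tree col′ i
      red-count : count (Red col′) ≡ count (Red col)
      size-drop : size (Red col′) u + p ≤ size (Red col) u
      -- Each detached child costs the component of u an edge, which pays for attaching a last child at u.
      budget    : potential (Red col′) + excess (size (Red col′) u + suc s) + excess (size (Red col) u)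
                  ≤ potential (Red col) + excess (size (Red col′) u) + excess ((size (Red col) u + suc s) ∸ p)
      untouched : ∀ a → ¬ Conn (Red col) u a → (∀ i → ¬ Conn (Red col) (y (X i)) a) → Agree (Red col) (Red col′) a
      park-⊆    : ∀ h → col′ h ≡ parked → col h ≡ parked × (∀ i → h ≢ g (X i))
      park-⊇    : ∀ h → col h ≡ parked → (∀ i → h ≢ g (X i)) → col′ h ≡ parked

  -- A single exchange: the leaf edge `f` goes to tree `t` and the parked edge `g₀` becomes red. The
  -- red forests before and after both consist of `S₁` and one more edge, and they are compared
  -- through `S₁`.
  module DetachOne {col t u s p} {X : Fin (suc p) → Child} (fo : Forests col) (ac : Acyclic (Red col))
                   (s<D : suc s ≤ D) (dt : Detachable col t u s X) where
    open Detachable dt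

    S : EdgeSet
    S = Red col

    leaf : Leaf S (Tree col t) u (x ∘ X)
    leaf = find-leaf (x ∘ X) ac u∼x u≁x x≁x

    module L = Leaf leaf
    open L using (i; f; v; w)

    x₀ y₀ : Vertex
    x₀ = x (X i)
    y₀ = y (X i)
    g₀ : Edge
    g₀ = g (X i)

    col₁ col₂ : Colouring
    col₁ = recolour col f (tree t)
    col₂ = recolour col₁ g₀ red

    S₁ S₂ : EdgeSet
    S₁ = S ∖ f
    S₂ = Red col₂

    f-red : col f ≡ red
    f-red = class⇒ col f L.f∈S

    f≢ : ∀ {h} → col h ≡ parked → h ≢ f
    f≢ ph refl with () ← trans (sym f-red) ph

    g₀-parked : col₁ g₀ ≡ parked
    g₀-parked = trans (recolour-other col (tree t) (f≢ (park i))) (park i)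

    S₂∖g₀ : ∀ e → (S₂ ∖ g₀) e ≡ S₁ e
    S₂∖g₀ e with e Fin.≟ g₀
    ... | no ne = trans (∧-identityʳ _) (recolour-out col (tree t) red (λ ()) e)
    ... | yes refl = sym (cong (_∧ not (does (g₀ Fin.≟ f))) g₀∉)
      where
      g₀∉ : S g₀ ≡ false
      g₀∉ rewrite park i = refl

    g₀∈S₂ : S₂ ∋ g₀
    g₀∈S₂ = ⇒class col₂ g₀ (recolour-same col₁ g₀ red)

    in-S₁ : ∀ e → S₂ ∋ e → e ≢ g₀ → S₁ ∋ e
    in-S₁ e p ne = ≡⇒⊑ S₂∖g₀ e (∖-intro {S₂} p ne)

    S₁⊑S : S₁ ⊑ S
    S₁⊑S = ∖-⊑ {S} {f}

    S₁⊑S₂ : S₁ ⊑ S₂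
    S₁⊑S₂ e p = ∖-⊑ {S₂} {g₀} e (≡⇒⊒ S₂∖g₀ e p)

    x₀≁y₀ : ¬ Conn S x₀ y₀
    x₀≁y₀ q = u≁y i (conn-trans (u∼x i) q)

    v≁w : ¬ Conn S₁ v w
    v≁w = ac f v w L.f∈S L.joins

    u∼v : Conn S u v
    u∼v = conn-trans (u∼x i) (conn-mono S₁⊑S L.x-side)

    bridge₂ : ¬ Conn (S₂ ∖ g₀) x₀ y₀
    bridge₂ q = x₀≁y₀ (conn-mono S₁⊑S (conn-mono (≡⇒⊑ S₂∖g₀) q))

    acyclic₂ : Acyclic S₂
    acyclic₂ = acyclic-insert {S₁} in-S₁ (joins i) (λ q → x₀≁y₀ (conn-mono S₁⊑S q)) (acyclic-⊑ S₁⊑S ac)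

    tree₂ : ∀ j e → Tree col₁ j e ≡ Tree col₂ j e
    tree₂ j = recolour-class col₁ red (tree j) (λ eq → parked≢ (trans (sym g₀-parked) eq)) (λ ())
      where
      parked≢ : _≢_ {A = Fin (2 + K)} parked (tree j)
      parked≢ ()

    f-not-tree : ∀ {j} → col f ≢ tree j
    f-not-tree eq with () ← trans (sym f-red) eq

    grow₂ : ∀ j → Tree col j ⊑ Tree col₂ j
    grow₂ j e p = ≡⇒⊑ (tree₂ j) e (recolour-⊒ col (tree t) (tree j) f-not-tree e p)

    v≁ₜw : ¬ Conn (Tree col t) v w
    v≁ₜw q = L.w≁x (conn-trans (conn-sym q) L.v∼x)

    in-T : ∀ e → Tree col₂ t ∋ e → e ≢ f → Tree col t ∋ e
    in-T e p ne = recolour-in col (tree t) e (≡⇒⊒ (tree₂ t) e p) ne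

    forests₂ : Forests col₂
    forests₂ j with j Fin.≟ t
    ... | yes refl = acyclic-insert {Tree col t} in-T L.joins v≁ₜw (fo t)
    ... | no ne    = acyclic-⊑ (λ e p → ≡⇒⊒ (recolour-class col (tree t) (tree j) f-not-tree λ { refl → ne refl }) e
                       (≡⇒⊒ (tree₂ j) e p)) (fo j)

    red-count₂ : count S₂ ≡ count S
    red-count₂ = trans (count-remove S₂ g₀ g₀∈S₂) (trans (cong suc (count-cong S₂∖g₀)) (sym (count-remove S f L.f∈S)))

    untouched₂ : ∀ a → ¬ Conn S u a → ¬ Conn S y₀ a → Agree S S₂ a
    untouched₂ a ¬ua ¬ya e c d ac′ je with e Fin.≟ g₀
    ... | yes refl with joins-unique je (joins i)
    ...   | inj₁ (refl , _) = ⊥-elim (¬ua (conn-trans (u∼x i) (conn-sym ac′)))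
    ...   | inj₂ (refl , _) = ⊥-elim (¬ya (conn-sym ac′))
    untouched₂ a ¬ua ¬ya e c d ac′ je | no ne with e Fin.≟ f
    ... | no _ = refl
    ... | yes refl with joins-unique je L.joins
    ...   | inj₁ (refl , _) = ⊥-elim (¬ua (conn-trans u∼v (conn-sym ac′)))
    ...   | inj₂ (refl , _) = ⊥-elim (¬ua (conn-trans u∼v (step f L.f∈S L.joins (conn-sym ac′))))

    u≁₂x₀ : ¬ Conn S₂ u x₀
    u≁₂x₀ q with conn-insert {S₁} in-S₁ (joins i) q
    ... | inj₁ t              = v≁w (conn-sym (conn-trans L.u-side (conn-trans t L.x-side)))
    ... | inj₂ (inj₁ (t , _)) = v≁w (conn-sym (conn-trans L.u-side (conn-trans t L.x-side)))
    ... | inj₂ (inj₂ (t , _)) = u≁y i (conn-mono S₁⊑S t)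

    module C₁ = Cut {S} {f} {v} {w} L.f∈S L.joins v≁w
    module C₂ = Cut {S₂} {g₀} {x₀} {y₀} g₀∈S₂ (joins i) bridge₂

    to-S₁ : ∀ a → size (S₂ ∖ g₀) a ≡ size S₁ a
    to-S₁ a = size-agree (λ e _ _ _ _ → S₂∖g₀ e)

    agree-u : Agree S₂ (S₂ ∖ g₀) u
    agree-u = C₂.agree u≁₂x₀

    down-u : ∀ {a} → Conn S₂ u a → Conn S u a
    down-u q = conn-mono S₁⊑S (conn-mono (≡⇒⊑ S₂∖g₀) (agree-conn agree-u q))

    size-u₂ : size S₂ u ≡ size S₁ u
    size-u₂ = trans (size-agree agree-u) (to-S₁ u)

    a₀ σ : ℕ
    a₀ = size S₁ x₀
    σ  = size S₁ y₀

    size-u : size S u ≡ suc (a₀ + size S₂ u)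
    size-u = trans (size-conn u∼v) (trans C₁.size-cut (cong suc (cong₂ _+_ (sym (size-conn L.x-side))
      (trans (size-conn L.u-side) (sym size-u₂)))))

    agree-y : Agree S S₁ y₀
    agree-y = C₁.agree (λ q → u≁y i (conn-trans u∼v (conn-sym q)))

    σ≤s : σ ≤ s
    σ≤s = ≤-trans (≤-reflexive (sym (size-agree agree-y))) (small i)

    size-x₂ : size S₂ x₀ ≡ suc (a₀ + σ)
    size-x₂ = trans C₂.size-cut (cong suc (cong₂ _+_ (to-S₁ x₀) (to-S₁ y₀)))

    -- `potential-cut` is applied to `f` in `S` and to `g₀` in `S₂`; eliminating the common
    -- potential of `S₁` leaves this equation. The child contributes no excess because `σ ≤ s < D`.
    potential₂ : potential S₂ + excess (size S u) ≡ potential S + excess (size S₂ u) + excess (suc (a₀ + σ))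
    potential₂ = +-cancelʳ-≡ (excess a₀) _ _ (begin
      Φ₂ + excess ℓ + excess a₀                      ≡⟨ r₁ Φ₂ (excess ℓ) (excess a₀) ⟩
      (Φ₂ + (excess a₀ + 0)) + excess ℓ              ≡⟨ cong (λ n → (Φ₂ + (excess a₀ + n)) + excess ℓ) (sym σ-zero) ⟩
      (Φ₂ + (excess a₀ + excess σ)) + excess ℓ       ≡⟨ cong (_+ excess ℓ) cut₂ ⟩
      (Φ₁ + excess b) + excess ℓ                     ≡⟨ r₂ Φ₁ (excess b) (excess ℓ) ⟩
      (Φ₁ + excess ℓ) + excess b                     ≡⟨ cong (_+ excess b) (sym cut₁) ⟩
      (Φ + (excess a₀ + excess m)) + excess b        ≡⟨ r₃ Φ (excess a₀) (excess m) (excess b) ⟩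
      Φ + excess m + excess b + excess a₀            ∎)
      where
      open ≡-Reasoning
      Φ Φ₁ Φ₂ ℓ m b : ℕ
      Φ  = potential S
      Φ₁ = potential S₁
      Φ₂ = potential S₂
      ℓ  = size S u
      m  = size S₂ u
      b  = suc (a₀ + σ)
      σ-zero : excess σ ≡ 0
      σ-zero = m≤n⇒m∸n≡0 (≤-trans σ≤s (≤-trans (n≤1+n _) s<D))
      cut₁ : Φ + (excess a₀ + excess m) ≡ Φ₁ + excess ℓ
      cut₁ = trans (cong (Φ +_) (cong₂ (λ p q → excess p + excess q) (size-conn L.x-side)
                     (trans size-u₂ (sym (size-conn L.u-side)))))
               (trans (potential-cut L.f∈S L.joins v≁w) (cong (λ n → Φ₁ + excess n) (sym (size-conn u∼v))))
      cut₂ : Φ₂ + (excess a₀ + excess σ) ≡ Φ₁ + excess b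
      cut₂ = trans (cong (Φ₂ +_) (cong₂ (λ p q → excess p + excess q) (sym (to-S₁ x₀)) (sym (to-S₁ y₀))))
               (trans (potential-cut g₀∈S₂ (joins i) bridge₂) (cong₂ _+_ (potential-cong S₂∖g₀) (cong excess size-x₂)))
      r₁ : ∀ a b c → a + b + c ≡ (a + (c + 0)) + b
      r₁ = solve-∀
      r₂ : ∀ a b c → (a + b) + c ≡ (a + c) + b
      r₂ = solve-∀
      r₃ : ∀ a b c d → (a + (b + c)) + d ≡ a + c + d + b
      r₃ = solve-∀

    X′ : Fin p → Child
    X′ j = X (punchIn i j)

    other : ∀ j → punchIn i j ≢ i
    other j = Fin.punchInᵢ≢i i j

    g≢g : ∀ j → j ≢ i → g (X j) ≢ g₀
    g≢g j ne eq with joins-unique (joins j) (subst (λ h → Joins G h x₀ y₀) (sym eq) (joins i))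
    ... | inj₁ (p , _) = x≁x j i ne (subst (Conn _ (x (X j))) p [])
    ... | inj₂ (p , _) = u≁y i (subst (Conn S u) p (u∼x j))

    parked₂ : ∀ h → h ≢ g₀ → col h ≡ parked → col₂ h ≡ parked
    parked₂ h ne ph = trans (recolour-other col₁ red ne) (trans (recolour-other col (tree t) (f≢ ph)) ph)

    parked₂⁻ : ∀ h → col₂ h ≡ parked → col h ≡ parked × h ≢ g₀
    parked₂⁻ h ph with h Fin.≟ g₀ | h Fin.≟ f
    parked₂⁻ h () | yes _ | _
    parked₂⁻ h () | no _ | yes _
    ... | no ne | no _ = ph , ne

    untouched-y : ∀ j → j ≢ i → Agree S S₂ (y (X j))
    untouched-y j ne = untouched₂ (y (X j)) (u≁y j) (y≁y i j (λ eq → ne (sym eq)))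

    remaining : Detachable col₂ t u s X′
    remaining = record
      { u∼x   = λ j → conn-mono S₁⊑S₂ (conn-trans (conn-sym L.u-side) (L.others (punchIn i j) (other j)))
      ; u≁y   = λ j q → u≁y (punchIn i j) (down-u q)
      ; y≁y   = λ j l ne q → y≁y (punchIn i j) (punchIn i l) (λ eq → ne (Fin.punchIn-injective i j l eq))
                               (agree-conn⁻ (untouched-y (punchIn i j) (other j)) q)
      ; park  = λ j → parked₂ _ (g≢g (punchIn i j) (other j)) (park (punchIn i j))
      ; joins = λ j → joins (punchIn i j)
      ; small = λ j → ≤-trans (≤-reflexive (sym (size-agree (untouched-y (punchIn i j) (other j))))) (small (punchIn i j))
      ; u≁x   = λ j → separated (u≁x (punchIn i j)) (λ q → u≁x i (conn-trans q L.v∼x))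
                        (λ q → x≁x (punchIn i j) i (other j) (conn-trans (conn-sym q) L.v∼x))
      ; x≁x   = λ j l ne → separated (x≁x (punchIn i j) (punchIn i l) (λ eq → ne (Fin.punchIn-injective i j l eq)))
                        (λ q → x≁x (punchIn i j) i (other j) (conn-trans q L.v∼x))
                        (λ q → x≁x (punchIn i l) i (other l) (conn-trans (conn-sym q) L.v∼x)) }
      where
      -- A new connection in tree `t` runs through `f`, so one of its ends is tied to `v`, hence to
      -- the `x` of the detached child, from which the remaining ones are separated.
      separated : ∀ {a b} → ¬ Conn (Tree col t) a b → ¬ Conn (Tree col t) a v → ¬ Conn (Tree col t) v b →
                  ¬ Conn (Tree col₂ t) a b
      separated ¬ab ¬av ¬vb q with conn-insert {Tree col t} in-T L.joins q
      ... | inj₁ r              = ¬ab r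
      ... | inj₂ (inj₁ (r , _)) = ¬av r
      ... | inj₂ (inj₂ (_ , r)) = ¬vb r

  -- Induction on the number of children. The choice of a leaf edge matters: the remaining `x` stay
  -- red-connected to the same `u`, so the other children can be detached in turn.
  detach : ∀ p col t u s (X : Fin p → Child) → Forests col → Acyclic (Red col) → suc s ≤ D →
           Detachable col t u s X → Detached col u s X
  detach zero col t u s X fo ac s<D dt = record
    { col′ = col ; forests = fo ; acyclic = ac ; grow = λ _ _ p → p ; red-count = refl
    ; size-drop = ≤-reflexive (+-identityʳ _)
    ; budget = ≤-reflexive (rearrange (potential (Red col)) _ _)
    ; untouched = λ a _ _ _ _ _ _ _ → refl
    ; park-⊆ = λ h ph → ph , λ () ; park-⊇ = λ h ph _ → ph }
    where
    rearrange : ∀ a b c → a + b + c ≡ a + c + b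
    rearrange = solve-∀
  detach (suc p) col t u s X fo ac s<D dt = record
    { col′ = R.col′ ; forests = R.forests ; acyclic = R.acyclic
    ; grow = λ j e q → R.grow j e (grow₂ j e q)
    ; red-count = trans R.red-count red-count₂
    ; size-drop = drop ; budget = bound
    ; untouched = λ a ¬ua ¬ya → combine a ¬ua ¬ya
    ; park-⊆ = λ h ph → let (ph₂ , ne) = R.park-⊆ h ph ; (ph₀ , ne₀) = parked₂⁻ h ph₂ in ph₀ , distinct h ne ne₀
    ; park-⊇ = λ h ph ne → R.park-⊇ h (parked₂ h (ne i) ph) (λ j → ne (punchIn i j)) }
    where
    open DetachOne {X = X} fo ac s<D dt
    open Leaf leaf using (i)
    module R = Detached (detach p col₂ t u s X′ forests₂ acyclic₂ s<D remaining)
    combine : ∀ a → ¬ Conn S u a → (∀ j → ¬ Conn S (y (X j)) a) → Agree S (Red R.col′) a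
    combine a ¬ua ¬ya e c d ac′ j = trans (h₂ e c d ac′ j)
      (R.untouched a (λ q → ¬ua (down-u q)) (λ l q → ¬ya (punchIn i l) (conn-sym (agree-conn⁻ h₂ (conn-sym q)))) e c d
        (agree-conn h₂ ac′) j)
      where
      h₂ : Agree S S₂ a
      h₂ = untouched₂ a ¬ua (¬ya i)
    distinct : ∀ h → (∀ j → h ≢ g (X′ j)) → h ≢ g₀ → ∀ j → h ≢ g (X j)
    distinct h ne ne₀ j with i Fin.≟ j
    ... | yes refl = ne₀
    ... | no i≢j   = subst (λ l → h ≢ g (X l)) (Fin.punchIn-punchOut i≢j) (ne (Fin.punchOut i≢j))
    m₂ n₁ : ℕ
    m₂ = size (Red R.col′) u
    n₁ = size S₂ u
    drop : m₂ + suc p ≤ size S u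
    drop = begin
      m₂ + suc p      ≡⟨ +-suc m₂ p ⟩
      suc (m₂ + p)    ≤⟨ s≤s (≤-trans R.size-drop (m≤n+m n₁ a₀)) ⟩
      suc (a₀ + n₁)   ≡⟨ size-u ⟨
      size S u        ∎
      where open ≤-Reasoning
    p≤n₁ : p ≤ n₁
    p≤n₁ = ≤-trans (m≤n+m p m₂) R.size-drop
    top : (size S u + suc s) ∸ suc p ≡ a₀ + (n₁ ∸ p) + suc s
    top = begin
      (size S u + suc s) ∸ suc p           ≡⟨ cong (λ n → (n + suc s) ∸ suc p) size-u ⟩
      (a₀ + n₁ + suc s) ∸ p                ≡⟨ cong (λ n → (a₀ + n + suc s) ∸ p) (m∸n+n≡m p≤n₁) ⟨
      (a₀ + (n₁ ∸ p + p) + suc s) ∸ p      ≡⟨ cong (_∸ p) (rearrange a₀ (n₁ ∸ p) p (suc s)) ⟩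
      (a₀ + (n₁ ∸ p) + suc s + p) ∸ p      ≡⟨ m+n∸n≡m _ p ⟩
      a₀ + (n₁ ∸ p) + suc s                ∎
      where
      open ≡-Reasoning
      rearrange : ∀ a b c d → a + (b + c) + d ≡ a + b + d + c
      rearrange = solve-∀
    rest : (n₁ + suc s) ∸ p ≡ n₁ ∸ p + suc s
    rest = begin
      (n₁ + suc s) ∸ p               ≡⟨ cong (λ n → (n + suc s) ∸ p) (m∸n+n≡m p≤n₁) ⟨
      (n₁ ∸ p + p + suc s) ∸ p       ≡⟨ cong (_∸ p) (rearrange (n₁ ∸ p) p (suc s)) ⟩
      (n₁ ∸ p + suc s + p) ∸ p       ≡⟨ m+n∸n≡m _ p ⟩
      n₁ ∸ p + suc s                 ∎
      where
      open ≡-Reasoning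
      rearrange : ∀ b c d → b + c + d ≡ b + d + c
      rearrange = solve-∀
    -- The two arguments on the left exceed the one on the right by `suc σ` in total, and `σ < D` is
    -- what `excess-convex` allows. This fixes the form of the last term of `budget`.
    convex : excess (suc (a₀ + σ)) + excess ((n₁ + suc s) ∸ p) ≤ excess ((size S u + suc s) ∸ suc p)
    convex rewrite top | rest = excess-convex left right both
      where
      open ≤-Reasoning
      q : ℕ
      q = n₁ ∸ p
      left : suc (a₀ + σ) ≤ a₀ + q + suc s
      left = begin
        suc (a₀ + σ)    ≤⟨ s≤s (+-monoʳ-≤ a₀ σ≤s) ⟩
        suc (a₀ + s)    ≡⟨ +-suc a₀ s ⟨
        a₀ + suc s      ≤⟨ +-monoˡ-≤ (suc s) (m≤m+n a₀ q) ⟩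
        a₀ + q + suc s  ∎
      right : q + suc s ≤ a₀ + q + suc s
      right = +-monoˡ-≤ (suc s) (m≤n+m q a₀)
      both : suc (a₀ + σ) + (q + suc s) ≤ a₀ + q + suc s + D
      both = begin
        suc (a₀ + σ) + (q + suc s)   ≡⟨ rearrange a₀ σ q s ⟩
        a₀ + q + suc s + suc σ       ≤⟨ +-monoʳ-≤ (a₀ + q + suc s) (≤-trans (s≤s σ≤s) s<D) ⟩
        a₀ + q + suc s + D           ∎
        where
        rearrange : ∀ a σ q s → suc (a + σ) + (q + suc s) ≡ a + q + suc s + suc σ
        rearrange = solve-∀
    bound : potential (Red R.col′) + excess (m₂ + suc s) + excess (size S u)
            ≤ potential S + excess m₂ + excess ((size S u + suc s) ∸ suc p)
    bound = +-cancelʳ-≤ (excess n₁) _ _ (begin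
      Φ′ + E + excess ℓ + excess n₁                 ≡⟨ r₁ Φ′ E (excess ℓ) (excess n₁) ⟩
      (Φ′ + E + excess n₁) + excess ℓ               ≤⟨ +-monoˡ-≤ (excess ℓ) R.budget ⟩
      (potential S₂ + excess m₂ + B) + excess ℓ     ≡⟨ r₂ (potential S₂) (excess m₂) B (excess ℓ) ⟩
      (potential S₂ + excess ℓ) + (excess m₂ + B)   ≡⟨ cong (_+ (excess m₂ + B)) potential₂ ⟩
      (potential S + excess n₁ + A) + (excess m₂ + B) ≡⟨ r₃ (potential S) (excess n₁) A (excess m₂) B ⟩
      (potential S + excess m₂ + excess n₁) + (A + B) ≤⟨ +-monoʳ-≤ (potential S + excess m₂ + excess n₁) convex ⟩
      (potential S + excess m₂ + excess n₁) + C     ≡⟨ r₄ (potential S) (excess m₂) (excess n₁) C ⟩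
      potential S + excess m₂ + C + excess n₁       ∎)
      where
      open ≤-Reasoning
      Φ′ E ℓ A B C : ℕ
      Φ′ = potential (Red R.col′)
      E  = excess (m₂ + suc s)
      ℓ  = size S u
      A  = excess (suc (a₀ + σ))
      B  = excess ((n₁ + suc s) ∸ p)
      C  = excess ((ℓ + suc s) ∸ suc p)
      r₁ : ∀ a b c d → a + b + c + d ≡ (a + b + d) + c
      r₁ = solve-∀
      r₂ : ∀ a b c d → (a + b + c) + d ≡ (a + d) + (b + c)
      r₂ = solve-∀
      r₃ : ∀ a b c d e → (a + b + c) + (d + e) ≡ (a + d + b) + (c + e)
      r₃ = solve-∀
      r₄ : ∀ a b c d → (a + b + c) + d ≡ a + b + d + c
      r₄ = solve-∀

  -- Exchanges that improve a colouring.

  open Child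

  excess-split : ∀ a b → excess a + excess b ≤ excess (suc (a + b))
  excess-split a b = excess-convex (m≤n⇒m≤1+n (m≤m+n a b)) (m≤n⇒m≤1+n (m≤n+m b a)) (m≤n⇒m≤1+n (m≤m+n (a + b) D))

  -- The edge between the two parts disappears, and since the total is above `D`, this edge was
  -- counted in the excess.
  excess-split-strict : ∀ a b → D < suc (a + b) → excess a + excess b < excess (suc (a + b))
  excess-split-strict a b (s≤s D≤) = ≤-trans (s≤s (excess-convex {c = a + b} (m≤m+n a b) (m≤n+m b a) (m≤m+n (a + b) D)))
    (≤-reflexive (sym (+-∸-assoc 1 D≤)))

  module _ (r : Vertex) where
    open Rooted r

    record Children (col : Colouring) (t : Fin K) (z : Vertex) (zs : List Vertex) (s : ℕ) {q : ℕ} (X : Fin q → Child) : Set where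
      field
        z∼x   : ∀ i → Conn (Red col) z (x (X i))
        g∈T   : ∀ i → Tree col t ∋ g (X i)
        joins : ∀ i → Joins G (g (X i)) (x (X i)) (y (X i))
        y∼r   : ∀ i → Conn (Tree col t ∖ g (X i)) (y (X i)) r
        fresh : ∀ i → ¬ Reach (Red col) (z ∷ zs) (y (X i))
        y≁y   : ∀ i j → i ≢ j → ¬ Conn (Red col) (y (X i)) (y (X j))
        small : ∀ i → size (Red col) (y (X i)) ≤ s

    -- The components explored before `z′` are unchanged and that of `z′` shrinks, a lexicographic
    -- decrease along the exploration. If `z′` is the first component, there is nothing before it to
    -- decrease later, and `strict` provides a drop of the potential instead.
    record Improved (col : Colouring) (zs : List Vertex) : Set where
      field
        {col′}    : Colouring
        {z′}      : Vertex
        {zs′}     : List Vertex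
        forests   : Forests col′
        acyclic   : Acyclic (Red col′)
        no-parked : ∀ h → col′ h ≢ parked
        red-count : count (Red col′) ≡ count (Red col)
        potential-≤ : potential (Red col′) ≤ potential (Red col)
        suffix    : z′ ∷ zs′ ≼ zs
        legal     : Legal col′ (z′ ∷ zs′)
        agree     : AgreeOn (Red col) (Red col′) zs′
        smaller   : size (Red col′) z′ < size (Red col) z′
        strict    : zs′ ≡ [] → D < size (Red col) z′ → potential (Red col′) < potential (Red col)

    -- Parking the edges to all children first splits tree t so that the x i are cut off from each other
    -- and from r.
    module Improve {col t z zs s q} {X : Fin (suc q) → Child}
      (fo : Forests col) (ac : Acyclic (Red col)) (np : ∀ h → col h ≢ parked)
      (l : Legal col (z ∷ zs)) (sat : Saturated col (z ∷ zs)) (s<D : suc s ≤ D)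
      (ch : Children col t z zs s X)
      (gain : suc s ≤ q ⊎ size (Red col) z + suc s ≤ D) where

      open Children ch

      S : EdgeSet
      S = Red col

      ℓ : ℕ
      ℓ = size S z

      g-col : ∀ i → col (g (X i)) ≡ tree t
      g-col i = class⇒ col _ (g∈T i)

      abstract
        listed? : ∀ h → Dec (∃[ i ] h ≡ g (X i))
        listed? h = Fin.any? λ i → h Fin.≟ g (X i)

      col₁ : Colouring
      col₁ h = if does (listed? h) then parked else col h

      park₁ : ∀ i → col₁ (g (X i)) ≡ parked
      park₁ i with listed? (g (X i))
      ... | yes _ = refl
      ... | no n  = ⊥-elim (n (i , refl))

      park₁⁻ : ∀ h → col₁ h ≡ parked → ∃[ i ] h ≡ g (X i)
      park₁⁻ h eq with listed? h
      ... | yes p = p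
      ... | no _  = ⊥-elim (np h eq)

      same₁ : ∀ c → c ≢ parked → c ≢ tree t → ∀ h → class col c h ≡ class col₁ c h
      same₁ c n₁ n₂ h with listed? h
      ... | no _ = refl
      ... | yes (i , refl) with col (g (X i)) Fin.≟ c | parked Fin.≟ c
      ...   | yes p | _     = ⊥-elim (n₂ (trans (sym p) (g-col i)))
      ...   | no _  | yes p = ⊥-elim (n₁ (sym p))
      ...   | no _  | no _  = refl

      red₁ : ∀ h → S h ≡ Red col₁ h
      red₁ = same₁ red (λ ()) (λ ())

      T₁ : EdgeSet
      T₁ = Tree col₁ t

      T₁⊑ : ∀ i → T₁ ⊑ Tree col t ∖ g (X i)
      T₁⊑ i h p with listed? h
      T₁⊑ i h () | yes _
      ... | no n = ∖-intro {Tree col t} p λ eq → n (i , eq)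

      shrink₁ : ∀ i → Tree col₁ i ⊑ Tree col i
      shrink₁ i with i Fin.≟ t
      ... | yes refl = λ h p → ∖-⊑ {Tree col t} {g (X zero)} h (T₁⊑ zero h p)
      ... | no ne    = ≡⇒⊒ (same₁ (tree i) (λ ()) λ { refl → ne refl })

      grow₁ : ∀ i → i ≢ t → Tree col i ⊑ Tree col₁ i
      grow₁ i ne = ≡⇒⊑ (same₁ (tree i) (λ ()) λ { refl → ne refl })

      fo₁ : Forests col₁
      fo₁ i = acyclic-⊑ (shrink₁ i) (fo i)

      lost : ∀ i → ¬ Conn (Tree col t ∖ g (X i)) (x (X i)) r
      lost i q = fo t _ _ _ (g∈T i) (joins i) (conn-trans q (conn-sym (y∼r i)))

      x≁r : ∀ i → ¬ Conn T₁ (x (X i)) r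
      x≁r i q = lost i (conn-mono (T₁⊑ i) q)

      g≢g : ∀ i j → i ≢ j → g (X i) ≢ g (X j)
      g≢g i j ne eq with joins-unique (joins i) (subst (λ h → Joins G h (x (X j)) (y (X j))) (sym eq) (joins j))
      ... | inj₁ (_ , p) = y≁y i j ne (subst (Conn S (y (X i))) p [])
      ... | inj₂ (p , _) = fresh j (here (subst (Conn S z) p (z∼x i)))

      -- `T₁` lacks both parked edges. Were `x i` and `x j` tied in it, then either `x i` would
      -- reach `r` without its own edge, possibly over that of `x j`, or the edge of `x j` would lie
      -- on a cycle.
      x≁x : ∀ i j → i ≢ j → ¬ Conn T₁ (x (X i)) (x (X j))
      x≁x i j ne q with conn-split {T ∖ g (X j)} {g (X i)} (joins i) (y∼r j)
        where
        T : EdgeSet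
        T = Tree col t
      ... | inj₁ p = lost i (conn-trans (conn-mono (T₁⊑ i) q)
                       (step (g (X j)) (∖-intro {Tree col t} (g∈T j) (g≢g j i (λ eq → ne (sym eq)))) (joins j)
                         (conn-mono (∖-mono {Tree col t ∖ g (X j)} (∖-⊑ {Tree col t} {g (X j)})) p)))
      ... | inj₂ (inj₁ (p , _)) = fo t _ _ _ (g∈T j) (joins j)
            (conn-sym (conn-trans (conn-mono (∖-⊑ {Tree col t ∖ g (X j)} {g (X i)}) p) (conn-mono (T₁⊑ j) q)))
      ... | inj₂ (inj₂ (_ , p)) = lost i (conn-mono (∖-mono {Tree col t ∖ g (X j)} (∖-⊑ {Tree col t} {g (X j)})) p)

      ra₁ : ∀ zs → AgreeOn S (Red col₁) zs
      ra₁ zs e _ _ _ _ = red₁ e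

      Good : Vertex → Bool
      Good v = connᵇ T₁ v r

      legal₁ : ∀ {y ys} → y ∷ ys ≼ z ∷ zs → (∀ w → Reach (Red col₁) ys w → Good w ≡ true) → Legal col₁ (y ∷ ys)
      legal₁ {y} {ys} le good = legal-transfer (legal-≼ le l) (ra₁ ys) kept
        where
        kept : ArcsKept col col₁ ys
        kept i h w z′ wr h∈ jh p with i Fin.≟ t
        ... | yes refl = first-edge-kept (fo t) (shrink₁ t) (connᵇ⇒ (good w (reach-agree (ra₁ ys) wr))) h∈ jh p
        ... | no ne    = grow₁ i ne h h∈ , conn-mono (∖-mono {Tree col i} (grow₁ i ne)) p

      -- Attaching one child adds at most s + 1 edges and each detached child removes at least one,
      -- so s + 1 detached children make up for it. In the other case everything stays within `D`
      -- and has no excess.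
      gain-bound : ∀ n → q ≤ n → excess ((ℓ + suc s) ∸ n) ≤ excess ℓ
      gain-bound n q≤n = [ enough , few ]′ gain
        where
        enough : suc s ≤ q → excess ((ℓ + suc s) ∸ n) ≤ excess ℓ
        enough s<q = ∸-monoˡ-≤ D (≤-trans (∸-monoʳ-≤ (ℓ + suc s) (≤-trans s<q q≤n)) (≤-reflexive (m+n∸n≡m ℓ (suc s))))
        few : ℓ + suc s ≤ D → excess ((ℓ + suc s) ∸ n) ≤ excess ℓ
        few le = ≤-trans (≤-reflexive (m≤n⇒m∸n≡0 (≤-trans (m∸n≤m (ℓ + suc s) n) le))) z≤n

      gain-strict : D < ℓ → excess ((ℓ + suc s) ∸ suc q) < excess ℓ
      gain-strict D<ℓ = [ enough , few ]′ gain
        where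
        open ≤-Reasoning
        instance
          ℓ≢0 : NonZero ℓ
          ℓ≢0 = >-nonZero (≤-<-trans z≤n D<ℓ)
        few : ℓ + suc s ≤ D → excess ((ℓ + suc s) ∸ suc q) < excess ℓ
        few le = ⊥-elim (<-irrefl refl (<-≤-trans D<ℓ (≤-trans (m≤m+n ℓ (suc s)) le)))
        enough : suc s ≤ q → excess ((ℓ + suc s) ∸ suc q) < excess ℓ
        enough s<q = begin-strict
          excess ((ℓ + suc s) ∸ suc q)        ≤⟨ ∸-monoˡ-≤ D (∸-monoʳ-≤ (ℓ + suc s) (s≤s s<q)) ⟩
          excess ((ℓ + suc s) ∸ (1 + suc s))  ≡⟨ cong (λ n → excess ((ℓ + suc s) ∸ n)) (+-comm 1 (suc s)) ⟩
          excess ((ℓ + suc s) ∸ (suc s + 1))  ≡⟨ cong excess (∸-+-assoc (ℓ + suc s) (suc s) 1) ⟨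
          excess ((ℓ + suc s) ∸ suc s ∸ 1)    ≡⟨ cong (λ n → excess (n ∸ 1)) (m+n∸n≡m ℓ (suc s)) ⟩
          excess (ℓ ∸ 1)                      <⟨ ∸-monoˡ-< (≤-reflexive (suc-pred ℓ)) (≤-pred (≤-trans D<ℓ (≤-reflexive (sym (suc-pred ℓ))))) ⟩
          excess ℓ                            ∎

      not-z : ∀ {c} → Reach S zs c → ¬ Conn S z c
      not-z rc q = legal-fresh l (reach-conn rc (conn-sym q))

      not-y : ∀ i {c} → Reach S zs c → ¬ Conn S (y (X i)) c
      not-y i rc q = fresh i (there (reach-conn rc (conn-sym q)))

      -- Here `z` lies in the piece of `r` and serves as `u`. The red component of `z` then
      -- separates all `suc q` vertices `x` from `r`, so it repairs the tree alone and every child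
      -- is detached.
      module AtHead (good : ∀ w → Reach (Red col₁) zs w → Good w ≡ true) (zr : Conn T₁ z r) where
        R : Detached col₁ z s X
        R = detach (suc q) col₁ t z s X fo₁ (acyclic-⊑ (≡⇒⊒ red₁) ac) s<D record
          { u∼x = λ i → conn-mono (≡⇒⊑ red₁) (z∼x i)
          ; u≁y = λ i p → fresh i (here (conn-mono (≡⇒⊒ red₁) p))
          ; y≁y = λ i j ne p → y≁y i j ne (conn-mono (≡⇒⊒ red₁) p)
          ; park = park₁
          ; joins = joins
          ; small = λ i → ≤-trans (≤-reflexive (sym (size-agree (λ e _ _ _ _ → red₁ e)))) (small i)
          ; u≁x = λ i p → x≁r i (conn-trans (conn-sym p) zr)
          ; x≁x = x≁x }
        module R = Detached R

        ℓ≡ : size (Red col₁) z ≡ ℓ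
        ℓ≡ = sym (size-agree (λ e _ _ _ _ → red₁ e))

        agree₁ : AgreeOn (Red col₁) (Red R.col′) zs
        agree₁ e c d rc = R.untouched c (λ p → not-z rc′ (conn-mono (≡⇒⊒ red₁) p))
          (λ i p → not-y i rc′ (conn-mono (≡⇒⊒ red₁) p)) e c d []
          where
          rc′ : Reach S zs c
          rc′ = reach-agree⁻ (ra₁ zs) rc

        bound : potential (Red R.col′) + excess ℓ ≤ potential S + excess ((ℓ + suc s) ∸ suc q)
        bound = +-cancelʳ-≤ (excess m) _ _ (begin
          Φ′ + excess ℓ + excess m              ≡⟨ r₁ Φ′ (excess ℓ) (excess m) ⟩
          Φ′ + excess m + excess ℓ              ≤⟨ +-monoˡ-≤ (excess ℓ) (+-monoʳ-≤ Φ′ (∸-monoˡ-≤ D (m≤m+n m (suc s)))) ⟩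
          Φ′ + excess (m + suc s) + excess ℓ    ≤⟨ budget ⟩
          potential S + excess m + B            ≡⟨ r₁ (potential S) (excess m) B ⟩
          potential S + B + excess m            ∎)
          where
          open ≤-Reasoning
          Φ′ m B : ℕ
          Φ′ = potential (Red R.col′)
          m  = size (Red R.col′) z
          B  = excess ((ℓ + suc s) ∸ suc q)
          r₁ : ∀ a b c → a + b + c ≡ a + c + b
          r₁ = solve-∀
          budget : Φ′ + excess (m + suc s) + excess ℓ ≤ potential S + excess m + B
          budget = subst₂ (λ n Φ → Φ′ + excess (m + suc s) + excess n ≤ Φ + excess m + excess ((n + suc s) ∸ suc q))
                     ℓ≡ (potential-cong (λ e → sym (red₁ e))) R.budget

        improved : Improved col (z ∷ zs)
        improved = record
          { col′ = R.col′ ; forests = R.forests ; acyclic = R.acyclic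
          ; no-parked = λ h ph → let (ph₁ , ne) = R.park-⊆ h ph ; (i , eq) = park₁⁻ h ph₁ in ne i eq
          ; red-count = trans R.red-count (count-cong λ e → sym (red₁ e))
          ; potential-≤ = +-cancelʳ-≤ (excess ℓ) _ _ (≤-trans bound (+-monoʳ-≤ (potential S) (gain-bound (suc q) (n≤1+n q))))
          ; suffix = here
          ; legal = legal-transfer (legal₁ here good) agree₁ (arcs-kept-⊑ col₁ R.col′ zs R.grow)
          ; agree = λ e c d rc j → trans (red₁ e) (agree₁ e c d (reach-agree (ra₁ zs) rc) j)
          ; smaller = begin-strict
              size (Red R.col′) z          <⟨ m<m+n _ {suc q} (s≤s z≤n) ⟩
              size (Red R.col′) z + suc q  ≤⟨ R.size-drop ⟩
              size (Red col₁) z            ≡⟨ ℓ≡ ⟩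
              ℓ                            ∎
          ; strict = λ _ D<ℓ → +-cancelʳ-< (excess ℓ) _ _ (≤-<-trans bound (+-monoʳ-< (potential S) (gain-strict D<ℓ))) }
          where open ≤-Reasoning

      -- The augmentation has taken a red edge from an earlier component. Its own component then
      -- needs to supply one repair edge less: the first child stays attached at `x₀`, which serves
      -- as `u`, and only the other `q` children are detached.
      module AtEarlier {z₁ zs₁} (A : Augmented col₁ t z₁ zs₁)
                       (suf : Augmented.z′ A ∷ Augmented.zs′ A ≼ zs) where
        module A = Augmented A
        open A using (z′; zs′) renaming (col′ to col₂)

        S₂ : EdgeSet
        S₂ = Red col₂

        red₂ : ∀ h → S₂ h ≡ (S ∖ A.e) h
        red₂ h = trans (A.red-eq h) (cong (_∧ not (does (h Fin.≟ A.e))) (sym (red₁ h)))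

        e∈S : S ∋ A.e
        e∈S = ≡⇒⊒ red₁ A.e A.e-red

        S₂⊑S : S₂ ⊑ S
        S₂⊑S h p = ∖-⊑ {S} {A.e} h (≡⇒⊑ red₂ h p)

        up : ∀ {a b} → Conn S₂ a b → Conn S a b
        up = conn-mono S₂⊑S

        near : Conn (S ∖ A.e) z′ A.p
        near = conn-mono (∖-mono {Red col₁} {S} (≡⇒⊒ red₁)) A.near

        z′p : Conn S z′ A.p
        z′p = conn-mono (∖-⊑ {S} {A.e}) near

        z′p′ : Conn S z′ A.p′
        z′p′ = conn-trans z′p (edge-conn e∈S A.joins)

        reach-e : ∀ {c d} → Joins G A.e c d → Conn S z′ c
        reach-e j with joins-unique j A.joins
        ... | inj₁ (refl , _) = z′p
        ... | inj₂ (refl , _) = z′p′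

        agree₂ : ∀ {a} → ¬ Conn S z′ a → Agree S S₂ a
        agree₂ {a} ¬z′a e c d ac j = trans (same e (λ { refl → ¬z′a (conn-trans (reach-e j) (conn-sym ac)) })) (sym (red₂ e))
          where
          same : ∀ e → e ≢ A.e → S e ≡ (S ∖ A.e) e
          same e ne with e Fin.≟ A.e
          ... | yes eq = ⊥-elim (ne eq)
          ... | no _   = sym (∧-identityʳ _)

        z′∈zs : Reach S zs z′
        z′∈zs = reach-≼ suf (here [])

        z′≁z : ¬ Conn S z′ z
        z′≁z q = not-z z′∈zs (conn-sym q)

        z′≁y : ∀ i → ¬ Conn S z′ (y (X i))
        z′≁y i q = not-y i z′∈zs (conn-sym q)

        x₀ y₀ : Vertex
        x₀ = x (X zero)
        y₀ = y (X zero)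
        g₀ : Edge
        g₀ = g (X zero)

        -- The augmentation merges at most the pieces of `v′` and `r`. No `x` lies in the piece of
        -- `r`, and at most one lies in that of `v′`.
        T₂-separates : ∀ i j → i ≢ j → ¬ Conn (Tree col₂ t) (x (X i)) (x (X j))
        T₂-separates i j ne q with A.merged q
        ... | inj₁ p = x≁x i j ne p
        ... | inj₂ (inj₂ p , _) = x≁r i p
        ... | inj₂ (inj₁ _ , inj₂ p) = x≁r j p
        ... | inj₂ (inj₁ p , inj₁ p′) = x≁x i j ne (conn-trans p (conn-sym p′))

        park₂ : ∀ i → col₂ (g (X i)) ≡ parked
        park₂ i = class⇒ col₂ _ (≡⇒⊒ A.park-eq _ (⇒class col₁ _ (park₁ i)))

        0≢suc : ∀ {n} {i : Fin n} → _≢_ {A = Fin (suc n)} zero (suc i)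
        0≢suc ()

        z∼₂x : ∀ i → Conn S₂ z (x (X i))
        z∼₂x i = agree-conn (agree₂ z′≁z) (z∼x i)

        R : Detached col₂ x₀ s (X ∘ suc)
        R = detach q col₂ t x₀ s (X ∘ suc) A.forests (acyclic-⊑ S₂⊑S ac) s<D record
          { u∼x = λ i → conn-trans (conn-sym (z∼₂x zero)) (z∼₂x (suc i))
          ; u≁y = λ i p → fresh (suc i) (here (conn-trans (z∼x zero) (up p)))
          ; y≁y = λ i j ne p → y≁y (suc i) (suc j) (λ eq → ne (Fin.suc-injective eq)) (up p)
          ; park = λ i → park₂ (suc i)
          ; joins = λ i → joins (suc i)
          ; small = λ i → ≤-trans (≤-reflexive (sym (size-agree (agree₂ (z′≁y (suc i)))))) (small (suc i))
          ; u≁x = λ i → T₂-separates zero (suc i) 0≢suc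
          ; x≁x = λ i j ne → T₂-separates (suc i) (suc j) (λ eq → ne (Fin.suc-injective eq)) }
        module R = Detached R
        open R using () renaming (col′ to col₃)

        S₃ S₄ : EdgeSet
        S₃ = Red col₃
        col₄ : Colouring
        col₄ = recolour col₃ g₀ red
        S₄ = Red col₄

        agree₃ : ∀ {a} → ¬ Conn S z a → (∀ i → ¬ Conn S (y (X (suc i))) a) → Agree S₂ S₃ a
        agree₃ ¬za ¬ya = R.untouched _ (λ p → ¬za (conn-trans (z∼x zero) (up p))) (λ i p → ¬ya i (up p))

        agree-y₀ : Agree S₂ S₃ y₀
        agree-y₀ = agree₃ (λ p → fresh zero (here p)) (λ i → y≁y (suc i) zero (λ ()))

        x₀≁y₀ : ¬ Conn S₃ x₀ y₀
        x₀≁y₀ p = fresh zero (here (conn-trans (z∼x zero) (conn-sym (up (agree-conn⁻ agree-y₀ (conn-sym p))))))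

        g₀-parked : col₃ g₀ ≡ parked
        g₀-parked = R.park-⊇ g₀ (park₂ zero) (λ i → g≢g zero (suc i) 0≢suc)

        S₄∖g₀ : ∀ e → (S₄ ∖ g₀) e ≡ S₃ e
        S₄∖g₀ e with e Fin.≟ g₀
        ... | no _ = ∧-identityʳ _
        ... | yes refl rewrite g₀-parked = refl

        g₀∈S₄ : S₄ ∋ g₀
        g₀∈S₄ = ⇒class col₄ g₀ (recolour-same col₃ g₀ red)

        in-S₃ : ∀ e → S₄ ∋ e → e ≢ g₀ → S₃ ∋ e
        in-S₃ e p ne = ≡⇒⊑ S₄∖g₀ e (∖-intro {S₄} p ne)

        trees₄ : ∀ i e → Tree col₃ i e ≡ Tree col₄ i e
        trees₄ i = recolour-class col₃ red (tree i) (λ eq → parked≢ (trans (sym g₀-parked) eq)) (λ ())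
          where
          parked≢ : _≢_ {A = Fin (2 + K)} parked (tree i)
          parked≢ ()

        bridge₄ : ¬ Conn (S₄ ∖ g₀) x₀ y₀
        bridge₄ p = x₀≁y₀ (conn-mono (≡⇒⊑ S₄∖g₀) p)

        agree₄ : AgreeOn S₂ S₄ (z′ ∷ zs′)
        agree₄ e c d rc j = trans (agree₃ (not-z rc′) (λ i → not-y (suc i) rc′) e c d [] j) (same e not-g₀)
          where
          rc′ : Reach S zs c
          rc′ = reach-≼ suf (Any.map up rc)
          not-g₀ : e ≢ g₀
          not-g₀ refl with joins-unique j (joins zero)
          ... | inj₁ (refl , _) = not-z rc′ (z∼x zero)
          ... | inj₂ (refl , _) = not-y zero rc′ []
          same : ∀ e → e ≢ g₀ → S₃ e ≡ S₄ e
          same e ne with e Fin.≟ g₀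
          ... | yes eq = ⊥-elim (ne eq)
          ... | no _   = refl

        agree-prefix : AgreeOn S S₂ zs′
        agree-prefix e c d rc j = agree₂ (λ p → legal-fresh (legal-≼ (there suf) l) (reach-conn rc (conn-sym p))) e c d [] j

        legal₄ : Legal col₄ (z′ ∷ zs′)
        legal₄ = legal-transfer A.legal (λ e c d rc → agree₄ e c d (there rc))
          (arcs-kept-⊑ col₂ col₄ zs′ (λ i e p → ≡⇒⊑ (trees₄ i) e (R.grow i e p)))

        bridge-e : ¬ Conn (S ∖ A.e) A.p A.p′
        bridge-e = ac A.e A.p A.p′ e∈S A.joins

        module C = Cut {S} {A.e} {A.p} {A.p′} e∈S A.joins bridge-e
        module C₄ = Cut {S₄} {g₀} {x₀} {y₀} g₀∈S₄ (joins zero) bridge₄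

        to-S₂ : ∀ a → size (S ∖ A.e) a ≡ size S₂ a
        to-S₂ a = size-agree (λ e _ _ _ _ → sym (red₂ e))

        size-z′ : size S z′ ≡ suc (size S₂ z′ + size S₂ A.p′)
        size-z′ = trans (size-conn z′p) (trans C.size-cut (cong suc (cong₂ _+_
          (trans (sym (size-conn near)) (to-S₂ z′)) (to-S₂ A.p′))))

        smaller : size S₄ z′ < size S z′
        smaller = begin-strict
          size S₄ z′   ≡⟨ size-agree (λ e c d p → agree₄ e c d (here p)) ⟨
          size S₂ z′   <⟨ s≤s (m≤m+n _ _) ⟩
          suc (size S₂ z′ + size S₂ A.p′) ≡⟨ size-z′ ⟨
          size S z′    ∎
          where open ≤-Reasoning

        potential₂ : potential S + (excess (size S₂ z′) + excess (size S₂ A.p′)) ≡ potential S₂ + excess (size S z′)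
        potential₂ = trans (cong (λ n → potential S + n) (cong₂ (λ m n → excess m + excess n)
            (trans (sym (to-S₂ z′)) (size-conn near)) (sym (to-S₂ A.p′))))
          (trans (potential-cut e∈S A.joins bridge-e)
            (cong₂ _+_ (potential-cong (λ e → sym (red₂ e))) (cong excess (sym (size-conn z′p)))))

        potential₂-≤ : potential S₂ ≤ potential S
        potential₂-≤ = +-cancelʳ-≤ (excess (size S z′)) _ _ (≤-trans (≤-reflexive (sym potential₂))
          (+-monoʳ-≤ (potential S) (subst (λ n → excess (size S₂ z′) + excess (size S₂ A.p′) ≤ excess n) (sym size-z′)
            (excess-split (size S₂ z′) (size S₂ A.p′)))))

        potential₂-< : D < size S z′ → potential S₂ < potential S
        potential₂-< lt = +-cancelʳ-< (excess (size S z′)) _ _ (≤-<-trans (≤-reflexive (sym potential₂))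
          (+-monoʳ-< (potential S) (subst (λ n → excess (size S₂ z′) + excess (size S₂ A.p′) < excess n) (sym size-z′)
            (excess-split-strict (size S₂ z′) (size S₂ A.p′) (subst (D <_) size-z′ lt)))))

        -- Attaching the first child enlarges the component of `x₀` from `m` to at most `m + suc s`
        -- edges, the size for which `budget` has reserved an excess term.
        potential₄-≤ : potential S₄ ≤ potential S₂
        potential₄-≤ = +-cancelʳ-≤ (excess m + excess ℓ) _ _ (begin
          Φ₄ + (excess m + excess ℓ)             ≡⟨ r₁ Φ₄ (excess m) (excess ℓ) ⟩
          Φ₄ + (excess m + 0) + excess ℓ         ≡⟨ cong (λ n → Φ₄ + (excess m + n) + excess ℓ) (sym σ-zero) ⟩
          Φ₄ + (excess m + excess σ) + excess ℓ  ≡⟨ cong (_+ excess ℓ) cut₄ ⟩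
          Φ₃ + excess (suc (m + σ)) + excess ℓ   ≤⟨ +-monoˡ-≤ (excess ℓ) (+-monoʳ-≤ Φ₃ (∸-monoˡ-≤ D grown)) ⟩
          Φ₃ + excess (m + suc s) + excess ℓ     ≤⟨ budget ⟩
          Φ₂ + excess m + excess ((ℓ + suc s) ∸ q) ≤⟨ +-monoʳ-≤ (Φ₂ + excess m) (gain-bound q ≤-refl) ⟩
          Φ₂ + excess m + excess ℓ               ≡⟨ +-assoc Φ₂ (excess m) (excess ℓ) ⟩
          Φ₂ + (excess m + excess ℓ)             ∎)
          where
          open ≤-Reasoning
          Φ₂ Φ₃ Φ₄ m σ : ℕ
          Φ₂ = potential S₂
          Φ₃ = potential S₃
          Φ₄ = potential S₄
          m  = size S₃ x₀
          σ  = size S₃ y₀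
          r₁ : ∀ a b c → a + (b + c) ≡ a + (b + 0) + c
          r₁ = solve-∀
          σ≤s : σ ≤ s
          σ≤s = ≤-trans (≤-reflexive (sym (trans (size-agree (agree₂ (z′≁y zero))) (size-agree agree-y₀)))) (small zero)
          σ-zero : excess σ ≡ 0
          σ-zero = m≤n⇒m∸n≡0 (≤-trans σ≤s (≤-trans (n≤1+n s) s<D))
          grown : suc (m + σ) ≤ m + suc s
          grown = ≤-trans (≤-reflexive (sym (+-suc m σ))) (+-monoʳ-≤ m (s≤s σ≤s))
          to-S₃ : ∀ a → size (S₄ ∖ g₀) a ≡ size S₃ a
          to-S₃ a = size-agree (λ e _ _ _ _ → S₄∖g₀ e)
          cut₄ : Φ₄ + (excess m + excess σ) ≡ Φ₃ + excess (suc (m + σ))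
          cut₄ = trans (cong (Φ₄ +_) (cong₂ (λ a b → excess a + excess b) (sym (to-S₃ x₀)) (sym (to-S₃ y₀))))
            (trans (potential-cut g₀∈S₄ (joins zero) bridge₄)
              (cong₂ _+_ (potential-cong S₄∖g₀) (cong excess (trans C₄.size-cut (cong suc (cong₂ _+_ (to-S₃ x₀) (to-S₃ y₀)))))))
          ℓ≡ : size S₂ x₀ ≡ ℓ
          ℓ≡ = trans (sym (size-conn (z∼₂x zero))) (sym (size-agree (agree₂ z′≁z)))
          budget : Φ₃ + excess (m + suc s) + excess ℓ ≤ Φ₂ + excess m + excess ((ℓ + suc s) ∸ q)
          budget = subst (λ n → Φ₃ + excess (m + suc s) + excess n ≤ Φ₂ + excess m + excess ((n + suc s) ∸ q)) ℓ≡ R.budget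

        no-parked₄ : ∀ h → col₄ h ≢ parked
        no-parked₄ h ph with h Fin.≟ g₀
        no-parked₄ h () | yes _
        ... | no ne with R.park-⊆ h ph
        ...   | ph₂ , ne′ with park₁⁻ h (class⇒ col₁ h (≡⇒⊑ A.park-eq h (⇒class col₂ h ph₂)))
        ...     | zero  , eq = ne eq
        ...     | suc i , eq = ne′ i eq

        red-count₄ : count S₄ ≡ count S
        red-count₄ = trans (count-remove S₄ g₀ g₀∈S₄) (trans (cong suc (trans (count-cong S₄∖g₀)
          (trans R.red-count (count-cong red₂)))) (sym (count-remove S A.e e∈S)))

        improved : Improved col (z ∷ zs)
        improved = record
          { col′ = col₄
          ; forests = λ i → acyclic-⊑ (≡⇒⊒ (trees₄ i)) (R.forests i)
          ; acyclic = acyclic-insert {S₃} in-S₃ (joins zero) x₀≁y₀ R.acyclic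
          ; no-parked = no-parked₄
          ; red-count = red-count₄
          ; potential-≤ = ≤-trans potential₄-≤ potential₂-≤
          ; suffix = there suf
          ; legal = legal₄
          ; agree = λ e c d rc j → trans (agree-prefix e c d rc j)
              (agree₄ e c d (there (reach-agree agree-prefix rc)) j)
          ; smaller = smaller
          ; strict = λ _ lt → ≤-<-trans potential₄-≤ (potential₂-< lt) }

      improve : Improved col (z ∷ zs)
      improve with find-bad col₁ Good zs
      ... | inj₁ (first-bad {z₁} {zs₁} {v} suf good reach bad) =
        AtEarlier.improved A (≼-trans (Augmented.suffix A) suf)
        where
        sat₁ : Saturated col₁ zs₁
        sat₁ i w p with i Fin.≟ t
        ... | yes refl = connᵇ⇒ (good w p)
        ... | no ne = conn-mono (grow₁ i ne) (sat i w (reach-≼ (there (≼-trans (there here) suf)) (reach-agree⁻ (ra₁ zs₁) p)))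
        A : Augmented col₁ t z₁ zs₁
        A = augment _ col₁ t z₁ zs₁ v ≤-refl fo₁ (legal₁ (there suf) good) sat₁ reach (¬connᵇ⇒ bad)
      -- All earlier components are tied to `r`. If `z` is not, `proper` still places the
      -- augmentation strictly before `z`, so the component of the children is not touched by it.
      ... | inj₂ good with conn? T₁ z r
      ...   | yes zr = AtHead.improved good zr
      ...   | no ¬zr = AtEarlier.improved A (Augmented.proper A ¬zr)
        where
        sat₁ : Saturated col₁ zs
        sat₁ i w p with i Fin.≟ t
        ... | yes refl = connᵇ⇒ (good w p)
        ... | no ne = conn-mono (grow₁ i ne) (sat i w (there (reach-agree⁻ (ra₁ zs) p)))
        A : Augmented col₁ t z zs
        A = augment _ col₁ t z zs z ≤-refl fo₁ (legal₁ here good) sat₁ [] ¬zr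

-- The edges that small components lack.

module Gaps (k d : ℕ) where

  total : ∀ {A : Set} → (A → ℕ) → List A → ℕ
  total f []       = 0
  total f (x ∷ xs) = f x + total f xs

  total-mono : ∀ {A : Set} {f g : A → ℕ} xs → All (λ x → f x ≤ g x) xs → total f xs ≤ total g xs
  total-mono []       []       = z≤n
  total-mono (x ∷ xs) (p ∷ ps) = +-mono-≤ p (total-mono xs ps)

  total-+ : ∀ {A : Set} (f g : A → ℕ) xs → total (λ x → f x + g x) xs ≡ total f xs + total g xs
  total-+ f g []       = refl
  total-+ f g (x ∷ xs) = trans (cong (f x + g x +_) (total-+ f g xs)) (rearrange (f x) (g x) (total f xs) (total g xs))
    where
    rearrange : ∀ a b c d → a + b + (c + d) ≡ a + c + (b + d)
    rearrange = solve-∀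

  total-* : ∀ {A : Set} c (f : A → ℕ) xs → total (λ x → c * f x) xs ≡ c * total f xs
  total-* c f []       = sym (*-zeroʳ c)
  total-* c f (x ∷ xs) = trans (cong (c * f x +_) (total-* c f xs)) (sym (*-distribˡ-+ c (f x) (total f xs)))

  total-const : ∀ {A : Set} c (xs : List A) → total (λ _ → c) xs ≡ c * List.length xs
  total-const c []       = sym (*-zeroʳ c)
  total-const c (x ∷ xs) = trans (cong (c +_) (total-const c xs)) (sym (*-suc c (List.length xs)))

  total-zero : ∀ {A : Set} {f : A → ℕ} xs → All (λ x → f x ≡ 0) xs → total f xs ≡ 0
  total-zero []       []       = refl
  total-zero (x ∷ xs) (p ∷ ps) = cong₂ _+_ p (total-zero xs ps)

  -- In the balance Σ ((k + 1) s - d) over the explored red components, one with s edges lacks gap s.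
  gap : ℕ → ℕ
  gap s = d ∸ suc k * s

  -- Since `gap` vanishes from `d` on, `gaps 0 d` is the sum of all gaps.
  gaps : ℕ → ℕ → ℕ
  gaps s zero    = 0
  gaps s (suc n) = gap s + gaps (suc s) n

  gap-mono : ∀ {s s′} → s ≤ s′ → gap s′ ≤ gap s
  gap-mono le = ∸-monoʳ-≤ d (*-monoʳ-≤ (suc k) le)

  gap-zero : ∀ {s} → d ≤ suc k * s → gap s ≡ 0
  gap-zero = m≤n⇒m∸n≡0

  gap-step : ∀ {s} → suc k * suc s ≤ d → gap s ≡ gap (suc s) + suc k
  gap-step {s} le = +-cancelʳ-≡ (suc k * s) _ _ (begin
    gap s + suc k * s                  ≡⟨ m∸n+n≡m (≤-trans (*-monoʳ-≤ (suc k) (n≤1+n s)) le) ⟩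
    d                                  ≡⟨ m∸n+n≡m le ⟨
    gap (suc s) + suc k * suc s        ≡⟨ rearrange (gap (suc s)) k s ⟩
    gap (suc s) + suc k + suc k * s    ∎)
    where
    open ≡-Reasoning
    rearrange : ∀ a k s → a + suc k * suc s ≡ a + suc k + suc k * s
    rearrange = solve-∀

  atMost : ℕ → List ℕ → ℕ
  atMost s = total (λ σ → when (does (σ ≤? s)) 1)

  -- Abel summation: if at most s + 1 entries are ≤ s for every s, the entries are at worst σ , … , σ , σ + 1 , σ + 2 , …
  total-gap : ∀ σs → (∀ s → s < d → atMost s σs ≤ suc s) → ∀ n σ → σ + n ≡ d →
              total (λ τ → gap (τ ⊔ σ)) σs ≤ σ * gap σ + gaps σ n
  total-gap σs few zero σ eq = ≤-trans (≤-reflexive (total-zero σs (All.universal zero-gap σs))) z≤n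
    where
    zero-gap : ∀ τ → gap (τ ⊔ σ) ≡ 0
    zero-gap τ = gap-zero (≤-trans (≤-reflexive (trans (sym eq) (+-identityʳ σ)))
      (≤-trans (m≤n⊔m τ σ) (m≤m+n (τ ⊔ σ) _)))
  total-gap σs few (suc n) σ eq = begin
    total (λ τ → gap (τ ⊔ σ)) σs
      ≤⟨ total-mono σs (All.universal pointwise σs) ⟩
    -- Raising the lower cutoff from σ to σ + 1 changes only the entries up to σ, each by `δ`, and
    -- `few` bounds their number by σ + 1.
    total (λ τ → gap (τ ⊔ suc σ) + δ * when (does (τ ≤? σ)) 1) σs
      ≡⟨ total-+ (λ τ → gap (τ ⊔ suc σ)) (λ τ → δ * when (does (τ ≤? σ)) 1) σs ⟩
    total (λ τ → gap (τ ⊔ suc σ)) σs + total (λ τ → δ * when (does (τ ≤? σ)) 1) σs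
      ≡⟨ cong (total (λ τ → gap (τ ⊔ suc σ)) σs +_) (total-* δ _ σs) ⟩
    total (λ τ → gap (τ ⊔ suc σ)) σs + δ * atMost σ σs
      ≤⟨ +-mono-≤ (total-gap σs few n (suc σ) (trans (sym (+-suc σ n)) eq)) (*-monoʳ-≤ δ (few σ σ<d)) ⟩
    suc σ * gap (suc σ) + gaps (suc σ) n + δ * suc σ
      ≡⟨ rearrange σ (gap (suc σ)) (gaps (suc σ) n) δ ⟩
    σ * (gap (suc σ) + δ) + (gap (suc σ) + δ + gaps (suc σ) n)
      ≡⟨ cong (λ x → σ * x + (x + gaps (suc σ) n)) (m+[n∸m]≡n (gap-mono (n≤1+n σ))) ⟩
    σ * gap σ + gaps σ (suc n) ∎
    where
    open ≤-Reasoning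
    δ : ℕ
    δ = gap σ ∸ gap (suc σ)
    σ<d : σ < d
    σ<d = ≤-trans (m<m+n σ {suc n} (s≤s z≤n)) (≤-reflexive eq)
    rearrange : ∀ σ a b δ → suc σ * a + b + δ * suc σ ≡ σ * (a + δ) + (a + δ + b)
    rearrange = solve-∀
    pointwise : ∀ τ → gap (τ ⊔ σ) ≤ gap (τ ⊔ suc σ) + δ * when (does (τ ≤? σ)) 1
    pointwise τ with ≤-<-connex τ σ
    ... | inj₁ τ≤σ = begin
      gap (τ ⊔ σ)             ≡⟨ cong gap (m≤n⇒m⊔n≡n τ≤σ) ⟩
      gap σ                   ≡⟨ m+[n∸m]≡n (gap-mono (n≤1+n σ)) ⟨
      gap (suc σ) + δ         ≡⟨ cong₂ _+_ (cong gap (sym (m≤n⇒m⊔n≡n (m≤n⇒m≤1+n τ≤σ)))) (sym (*-identityʳ δ)) ⟩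
      gap (τ ⊔ suc σ) + δ * 1 ≡⟨ cong (λ b → gap (τ ⊔ suc σ) + δ * when b 1) (⇒does (τ ≤? σ) τ≤σ) ⟨
      gap (τ ⊔ suc σ) + δ * when (does (τ ≤? σ)) 1 ∎
    ... | inj₂ σ<τ = begin
      gap (τ ⊔ σ)             ≡⟨ cong gap (trans (m≥n⇒m⊔n≡m (<⇒≤ σ<τ)) (sym (m≥n⇒m⊔n≡m σ<τ))) ⟩
      gap (τ ⊔ suc σ)         ≤⟨ m≤m+n _ _ ⟩
      gap (τ ⊔ suc σ) + δ * when (does (τ ≤? σ)) 1 ∎

  -- The left side is largest at σ = 0: passing from σ + 1 to σ raises σ + 1 gaps by k + 1 each, a
  -- gain of k (k + 1) (σ + 1), and loses only k + 1 in the last term.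
  gaps-bound : .{{_ : NonZero k}} → ∀ σ n → σ + n ≡ d → suc k * σ < d →
               k * (σ * gap σ + gaps σ n) + suc k * σ ≤ k * gaps 0 d
  gaps-bound zero n refl lt = ≤-reflexive (trans (cong (k * gaps 0 d +_) (*-zeroʳ (suc k))) (+-identityʳ _))
  gaps-bound (suc σ) n eq lt = begin
    k * (suc σ * gap (suc σ) + gaps (suc σ) n) + suc k * suc σ
      ≡⟨ r₁ k σ (gap (suc σ)) (gaps (suc σ) n) ⟩
    k * (suc σ * gap (suc σ) + gaps (suc σ) n) + suc k * σ + suc k * 1
      ≤⟨ +-monoʳ-≤ (k * (suc σ * gap (suc σ) + gaps (suc σ) n) + suc k * σ)
           (*-monoʳ-≤ (suc k) (*-mono-≤ (>-nonZero⁻¹ k) (s≤s (z≤n {σ})))) ⟩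
    k * (suc σ * gap (suc σ) + gaps (suc σ) n) + suc k * σ + suc k * (k * suc σ)
      ≡⟨ r₂ k σ (gap (suc σ)) (gaps (suc σ) n) ⟩
    k * (σ * (gap (suc σ) + suc k) + (gap (suc σ) + suc k + gaps (suc σ) n)) + suc k * σ
      ≡⟨ cong (λ x → k * (σ * x + (x + gaps (suc σ) n)) + suc k * σ) (sym (gap-step (<⇒≤ lt))) ⟩
    k * (σ * gap σ + gaps σ (suc n)) + suc k * σ
      ≤⟨ gaps-bound σ (suc n) (trans (+-suc σ n) eq) (≤-<-trans (*-monoʳ-≤ (suc k) (n≤1+n σ)) lt) ⟩
    k * gaps 0 d ∎
    where
    open ≤-Reasoning
    r₁ : ∀ k σ a b → k * (suc σ * a + b) + suc k * suc σ ≡ k * (suc σ * a + b) + suc k * σ + suc k * 1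
    r₁ = solve-∀
    r₂ : ∀ k σ a b → k * (suc σ * a + b) + suc k * σ + suc k * (k * suc σ) ≡ k * (σ * (a + suc k) + (a + suc k + b)) + suc k * σ
    r₂ = solve-∀

  least : ∀ x xs → ∃[ σ ] All (σ ≤_) (x ∷ xs) × (∀ {P : ℕ → Set} → All P (x ∷ xs) → P σ)
  least x []       = x , ≤-refl ∷ [] , λ { (p ∷ _) → p }
  least x (y ∷ xs) with least y xs
  ... | σ , lb , mem with ≤-total x σ
  ...   | inj₁ x≤σ = x , ≤-refl ∷ All.map (≤-trans x≤σ) lb , λ { (p ∷ _) → p }
  ...   | inj₂ σ≤x = σ , σ≤x ∷ lb , λ { (_ ∷ ps) → mem ps }

  -- Each of the k trees may use a kth part of the surplus of a parent with `e` edges. If the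
  -- smallest child has σ edges, then `e` is at least `D` minus σ, and `total-gap` bounds the gaps.
  -- By `gaps-bound` the case σ = 0 decides, which is the source of the condition on `D`.
  charge : .{{_ : NonZero k}} → ∀ {D} → d + k * gaps 0 d ≤ suc k * D → ∀ σs e →
           (∀ s → s < d → atMost s σs ≤ suc s) → All (λ σ → D ≤ e + σ) σs →
           k * total gap σs ≤ suc k * e ∸ d
  charge hD [] e few large = ≤-trans (≤-reflexive (*-zeroʳ k)) z≤n
  charge {D = D} hD (x ∷ xs) e few large with least x xs
  ... | σ , lb , mem with suc k * σ <? d
  ...   | no big = ≤-trans (≤-reflexive (trans (cong (k *_) (total-zero (x ∷ xs)
            (All.map (λ le → gap-zero (≤-trans (≮⇒≥ big) (*-monoʳ-≤ (suc k) le))) lb))) (*-zeroʳ k))) z≤n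
  ...   | yes σ< = m+n≤o⇒m≤o∸n (k * total gap (x ∷ xs)) (+-cancelʳ-≤ (suc k * σ) _ _ (begin
    k * total gap (x ∷ xs) + d + suc k * σ    ≤⟨ +-monoˡ-≤ (suc k * σ) (+-monoˡ-≤ d (*-monoʳ-≤ k worst)) ⟩
    k * (σ * gap σ + gaps σ n) + d + suc k * σ ≡⟨ rearrange (k * (σ * gap σ + gaps σ n)) d (suc k * σ) ⟩
    d + (k * (σ * gap σ + gaps σ n) + suc k * σ) ≤⟨ +-monoʳ-≤ d (gaps-bound σ n σ+n σ<) ⟩
    d + k * gaps 0 d                          ≤⟨ hD ⟩
    suc k * D                                 ≤⟨ *-monoʳ-≤ (suc k) (mem large) ⟩
    suc k * (e + σ)                           ≡⟨ *-distribˡ-+ (suc k) e σ ⟩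
    suc k * e + suc k * σ                     ∎))
    where
    open ≤-Reasoning
    n : ℕ
    n = d ∸ σ
    σ+n : σ + n ≡ d
    σ+n = m+[n∸m]≡n (<⇒≤ (≤-<-trans (m≤m+n σ (k * σ)) σ<))
    rearrange : ∀ a b c → a + b + c ≡ b + (a + c)
    rearrange = solve-∀
    worst : total gap (x ∷ xs) ≤ σ * gap σ + gaps σ n
    worst = ≤-trans (total-mono (x ∷ xs) (All.map (λ le → ≤-reflexive (cong gap (sym (m≥n⇒m⊔n≡m le)))) lb))
                    (total-gap (x ∷ xs) few n σ σ+n)

-- Over a common denominator, k + d/(d + k + 1) is (k + 1)(k + d)/(d + k + 1).
Sparse : Graph → ℕ → ℕ → Set
Sparse G k d = ∀ A → 2 ≤ count A → (d + suc k) * count (inside A) ≤ suc k * (k + d) * (count A ∸ 1)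
  where open Connectivity G

-- Charging along the exploration.

module Reduction (G : Graph) (k d D : ℕ) where

  open Connectivity G
  open Colourings G k
  open Improvement G k D
  open Gaps k d

  total-map : ∀ {A B : Set} (f : B → ℕ) (h : A → B) xs → total f (map h xs) ≡ total (λ x → f (h x)) xs
  total-map f h []       = refl
  total-map f h (x ∷ xs) = cong (f (h x) +_) (total-map f h xs)

  total-bump : ∀ {A : Set} {f f′ : A → ℕ} {a c} xs → (∀ x → f x ≤ f′ x) → a ∈ xs → f a + c ≤ f′ a →
               total f xs + c ≤ total f′ xs
  total-bump {f = f} {f′} {a} {c} (x ∷ xs) le (here refl) fa = begin
    f x + total f xs + c     ≡⟨ rearrange (f x) (total f xs) c ⟩
    f x + c + total f xs     ≤⟨ +-mono-≤ fa (total-mono xs (All.universal le xs)) ⟩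
    f′ x + total f′ xs       ∎
    where
    open ≤-Reasoning
    rearrange : ∀ a b c → a + b + c ≡ a + c + b
    rearrange = solve-∀
  total-bump {f = f} {f′} {a} {c} (x ∷ xs) le (there p) fa = begin
    f x + total f xs + c     ≡⟨ +-assoc (f x) _ c ⟩
    f x + (total f xs + c)   ≤⟨ +-mono-≤ (le x) (total-bump xs le p fa) ⟩
    f′ x + total f′ xs       ∎
    where open ≤-Reasoning

  sum-bump : ∀ {n} {f f′ : Fin n → ℕ} {c} i → (∀ j → f j ≤ f′ j) → f i + c ≤ f′ i → sum f + c ≤ sum f′
  sum-bump {suc n} {f} {f′} {c} zero le fi = begin
    f zero + sum (f ∘ suc) + c   ≡⟨ rearrange (f zero) (sum (f ∘ suc)) c ⟩
    f zero + c + sum (f ∘ suc)   ≤⟨ +-mono-≤ fi (sum-mono (λ j → le (suc j))) ⟩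
    f′ zero + sum (f′ ∘ suc)     ∎
    where
    open ≤-Reasoning
    rearrange : ∀ a b c → a + b + c ≡ a + c + b
    rearrange = solve-∀
  sum-bump {suc n} {f} {f′} {c} (suc i) le fi = begin
    f zero + sum (f ∘ suc) + c   ≡⟨ +-assoc (f zero) _ c ⟩
    f zero + (sum (f ∘ suc) + c) ≤⟨ +-mono-≤ (le zero) (sum-bump i (λ j → le (suc j)) fi) ⟩
    f′ zero + sum (f′ ∘ suc)     ∎
    where open ≤-Reasoning

  pairs-lookup : ∀ {A : Set} {R : A → A → Set} → (∀ {a b} → R a b → R b a) → ∀ {xs} → AllPairs R xs →
                 ∀ i j → i ≢ j → R (lookup xs i) (lookup xs j)
  pairs-lookup s {x ∷ xs} (r ∷ rs) zero    zero    ne = ⊥-elim (ne refl)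
  pairs-lookup s {x ∷ xs} (r ∷ rs) zero    (suc j) ne = All.lookup r (∈-lookup j)
  pairs-lookup s {x ∷ xs} (r ∷ rs) (suc i) zero    ne = s (All.lookup r (∈-lookup i))
  pairs-lookup s {x ∷ xs} (r ∷ rs) (suc i) (suc j) ne = pairs-lookup s rs i j (λ eq → ne (cong suc eq))

  length-filter : ∀ {A : Set} (h : A → ℕ) s xs →
                  List.length (filter (λ a → h a ≤? s) xs) ≡ atMost s (map h xs)
  length-filter h s [] = refl
  length-filter h s (x ∷ xs) with does (h x ≤? s)
  ... | true  = cong suc (length-filter h s xs)
  ... | false = length-filter h s xs

  module Charging (r : Vertex) where
    open Child
    open Rooted r
    open Exploration r

    -- The parent of `z` is the entry vertex of the red component containing the tail `w`; `find`
    -- reads it off the proof that `w` is reached.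
    children : ∀ {col zs} → Legal col zs → Vertex → Fin k → List Child
    children root y₀ i₀ = []
    children (extend {w = w} {z} {i} {g} l wr _ _ _ _) y₀ i₀ =
      if does (proj₁ (find wr) Fin.≟ y₀) ∧ does (i Fin.≟ i₀) then child w z g ∷ children l y₀ i₀ else children l y₀ i₀

    -- `fresh` refers to the stage at which `y₀` was entered, because `Improve` works with the
    -- exploration cut back to that stage.
    record IsChild (col : Colouring) (zs : List Vertex) (y₀ : Vertex) (i : Fin k) (c : Child) : Set where
      field
        parent : Reach (Red col) zs y₀
        listed : Reach (Red col) zs (y c)
        y₀∼x   : Conn (Red col) y₀ (x c)
        g∈T    : Tree col i ∋ g c
        joins  : Joins G (g c) (x c) (y c)
        y∼r    : Conn (Tree col i ∖ g c) (y c) r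
        fresh  : ∀ ys → y₀ ∷ ys ≼ zs → ¬ Reach (Red col) (y₀ ∷ ys) (y c)

    ischild-weaken : ∀ {col zs z y₀ i c} → ¬ Reach (Red col) zs z → IsChild col zs y₀ i c → IsChild col (z ∷ zs) y₀ i c
    ischild-weaken {col} {zs} {z} {y₀} {i} {c} new ic = record
      { parent = there parent ; listed = there listed ; y₀∼x = y₀∼x ; g∈T = g∈T ; joins = joins ; y∼r = y∼r
      ; fresh = fresh′ }
      where
      open IsChild ic
      fresh′ : ∀ ys → y₀ ∷ ys ≼ z ∷ zs → ¬ Reach (Red col) (y₀ ∷ ys) (y c)
      fresh′ ys here       = ⊥-elim (new parent)
      fresh′ ys (there le) = fresh ys le

    reach-∈ : ∀ {R zs y} → y ∈ zs → Reach R zs y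
    reach-∈ = Any.map λ { refl → [] }

    children-ok : ∀ {col zs} (l : Legal col zs) y₀ i₀ → All (IsChild col zs y₀ i₀) (children l y₀ i₀)
    children-ok root y₀ i₀ = []
    children-ok {col} (extend {zs} {w} {z} {i} {g} l wr g∈ j zr new) y₀ i₀ with find wr
    ... | y , y∈ , yw with y Fin.≟ y₀ | i Fin.≟ i₀
    ...   | no _     | _        = All.map (ischild-weaken new) (children-ok l y₀ i₀)
    ...   | yes _    | no _     = All.map (ischild-weaken new) (children-ok l y₀ i₀)
    ...   | yes refl | yes refl = record
      { parent = there (reach-∈ y∈) ; listed = here [] ; y₀∼x = yw ; g∈T = g∈ ; joins = j ; y∼r = zr ; fresh = fresh′ }
      ∷ All.map (ischild-weaken new) (children-ok l y₀ i₀)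
      where
      fresh′ : ∀ ys → y ∷ ys ≼ z ∷ zs → ¬ Reach (Red col) (y ∷ ys) z
      fresh′ ys here       = ⊥-elim (new (reach-∈ y∈))
      fresh′ ys (there le) = λ p → new (reach-≼ le p)

    Apart : Colouring → Child → Child → Set
    Apart col c c′ = ¬ Conn (Red col) (y c) (y c′)

    children-apart : ∀ {col zs} (l : Legal col zs) y₀ i₀ → AllPairs (Apart col) (children l y₀ i₀)
    children-apart root y₀ i₀ = []
    children-apart {col} (extend {zs} {w} {z} {i} {g} l wr g∈ j zr new) y₀ i₀
      with does (proj₁ (find wr) Fin.≟ y₀) ∧ does (i Fin.≟ i₀)
    ... | false = children-apart l y₀ i₀
    ... | true  = All.map (λ ic q → new (reach-conn (IsChild.listed ic) (conn-sym q))) (children-ok l y₀ i₀)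
                  ∷ children-apart l y₀ i₀

    lack : Colouring → Vertex → ℕ
    lack col v = gap (size (Red col) v)

    lackChildren : ∀ {col zs} → Legal col zs → Vertex → Fin k → ℕ
    lackChildren {col} l y₀ i = total (λ c → lack col (y c)) (children l y₀ i)

    lackAll : ∀ {col zs} → Legal col zs → Vertex → ℕ
    lackAll l y₀ = sum (lackChildren l y₀)

    -- Every component but the first was entered along one arc, so its lack appears in the sum of
    -- its parent for the tree of this arc. The first component has no parent and is listed
    -- separately.
    lack-charged : ∀ {col zs} (l : Legal col zs) → total (lack col) zs ≤ total (lackAll l) zs + lack col r
    lack-charged {col} root = ≤-trans (≤-reflexive (+-identityʳ _)) (m≤n+m _ _)
    lack-charged {col} (extend {zs} {w} {z} {i} {g} l wr g∈ j zr new) = begin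
      lack col z + total (lack col) zs                      ≤⟨ +-monoʳ-≤ (lack col z) (lack-charged l) ⟩
      lack col z + (total (lackAll l) zs + lack col r)      ≡⟨ rearrange (lack col z) (total (lackAll l) zs) (lack col r) ⟩
      total (lackAll l) zs + lack col z + lack col r        ≤⟨ +-monoˡ-≤ (lack col r)
        (≤-trans (total-bump zs (λ y₀ → sum-mono (grow y₀)) (proj₁ (proj₂ (find wr))) (sum-bump i (grow _) bump)) (m≤n+m _ _)) ⟩
      lackAll l⁺ z + total (lackAll l⁺) zs + lack col r     ∎
      where
      open ≤-Reasoning
      l⁺ : Legal col (z ∷ zs)
      l⁺ = extend l wr g∈ j zr new
      rearrange : ∀ a b c → a + (b + c) ≡ b + a + c
      rearrange = solve-∀
      grow : ∀ y₀ i₀ → lackChildren l y₀ i₀ ≤ lackChildren l⁺ y₀ i₀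
      grow y₀ i₀ with does (proj₁ (find wr) Fin.≟ y₀) ∧ does (i Fin.≟ i₀)
      ... | false = ≤-refl
      ... | true  = m≤n+m _ _
      bump : lackChildren l (proj₁ (find wr)) i + lack col z ≤ lackChildren l⁺ (proj₁ (find wr)) i
      bump rewrite ⇒does (proj₁ (find wr) Fin.≟ proj₁ (find wr)) refl | ⇒does (i Fin.≟ i) refl = ≤-reflexive (+-comm _ (lack col z))

    improved-≼ : ∀ {col ys zs} → ys ≼ zs → Improved r col ys → Improved r col zs
    improved-≼ le im = record
      { col′ = I.col′ ; forests = I.forests ; acyclic = I.acyclic ; no-parked = I.no-parked ; red-count = I.red-count
      ; potential-≤ = I.potential-≤ ; suffix = ≼-trans I.suffix le ; legal = I.legal ; agree = I.agree
      ; smaller = I.smaller ; strict = I.strict }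
      where module I = Improved im

    module Check {col zs} (fo : Forests col) (ac : Acyclic (Red col)) (np : ∀ h → col h ≢ parked)
                 (l : Legal col zs) (sat : Saturated col zs) (d≤D : d ≤ D) where

      improve-from : ∀ y₀ ys i s c cs → y₀ ∷ ys ≼ zs → suc s ≤ D →
                     All (IsChild col zs y₀ i) (c ∷ cs) → AllPairs (Apart col) (c ∷ cs) →
                     All (λ c → size (Red col) (y c) ≤ s) (c ∷ cs) →
                     suc s ≤ List.length cs ⊎ size (Red col) y₀ + suc s ≤ D → Improved r col zs
      improve-from y₀ ys i s c cs le s<D ok apart small gain = improved-≼ le
        (Improve.improve r {X = lookup (c ∷ cs)} fo ac np (legal-≼ le l) (λ i w p → sat i w (reach-≼ le p)) s<D
          record
            { z∼x = λ j → IsChild.y₀∼x (at j)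
            ; g∈T = λ j → IsChild.g∈T (at j)
            ; joins = λ j → IsChild.joins (at j)
            ; y∼r = λ j → IsChild.y∼r (at j)
            ; fresh = λ j → IsChild.fresh (at j) ys le
            ; y≁y = pairs-lookup (λ n q → n (conn-sym q)) apart
            ; small = λ j → All.lookup small (∈-lookup j) }
          gain)
        where
        at : ∀ j → IsChild col zs y₀ i (lookup (c ∷ cs) j)
        at j = All.lookup ok (∈-lookup j)

      check-child : ∀ y₀ ys i → y₀ ∷ ys ≼ zs → ∀ cs → All (IsChild col zs y₀ i) cs →
                    Improved r col zs ⊎ All (λ c → D ≤ size (Red col) y₀ + size (Red col) (y c)) cs
      check-child y₀ ys i le [] [] = inj₂ []
      check-child y₀ ys i le (c ∷ cs) (ok ∷ oks)
        with check-child y₀ ys i le cs oks | D ≤? size (Red col) y₀ + size (Red col) (y c)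
      ... | inj₁ im | _     = inj₁ im
      ... | inj₂ ps | yes p = inj₂ (p ∷ ps)
      -- A single child, with its exact size as `s`: parent, child and the edge between them have at
      -- most `D` edges, so no excess arises even if the child stays attached.
      ... | inj₂ ps | no D≰ = inj₁ (improve-from y₀ ys i (size (Red col) (y c)) c [] le
            (≤-trans (s≤s (m≤n+m _ _)) (≰⇒> D≰)) (ok ∷ []) ([] ∷ []) (≤-refl ∷ [])
            (inj₂ (≤-trans (≤-reflexive (+-suc _ _)) (≰⇒> D≰))))

      -- Sizes from `d` on have no gap, so they need no such bound. Moreover `s < d` yields the
      -- condition `suc s ≤ D` of an exchange.
      check-count : ∀ y₀ ys i → y₀ ∷ ys ≼ zs → ∀ s → s < d →
                    Improved r col zs ⊎ atMost s (map (λ c → size (Red col) (y c)) (children l y₀ i)) ≤ suc s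
      check-count y₀ ys i le s s<d with atMost s (map (λ c → size (Red col) (y c)) (children l y₀ i)) ≤? suc s
      ... | yes p = inj₂ p
      ... | no ≰ = inj₁ (from (filter small? (children l y₀ i))
            (≤-trans (≰⇒> ≰) (≤-reflexive (sym (length-filter (λ c → size (Red col) (y c)) s (children l y₀ i)))))
            (All.filter⁺ small? (children-ok l y₀ i)) (AllPairs.filter⁺ small? (children-apart l y₀ i))
            (All.all-filter small? (children l y₀ i)))
        where
        small? : ∀ c → Dec (size (Red col) (y c) ≤ s)
        small? c = size (Red col) (y c) ≤? s
        from : ∀ cs → suc s < List.length cs → All (IsChild col zs y₀ i) cs → AllPairs (Apart col) cs →
               All (λ c → size (Red col) (y c) ≤ s) cs → Improved r col zs
        from (c ∷ cs) (s≤s lt) ok apart small = improve-from y₀ ys i s c cs le (≤-trans s<d d≤D) ok apart small (inj₁ lt)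

      module _ {{_ : NonZero k}} (hD : d + k * gaps 0 d ≤ suc k * D) where

        check-tree : ∀ y₀ ys → y₀ ∷ ys ≼ zs → ∀ i →
                     Improved r col zs ⊎ k * lackChildren l y₀ i ≤ suc k * size (Red col) y₀ ∸ d
        check-tree y₀ ys le i with check-child y₀ ys i le (children l y₀ i) (children-ok l y₀ i)
                                 | search (λ s → check-count y₀ ys i le (toℕ {d} s) (Fin.toℕ<n s))
        ... | inj₁ im    | _             = inj₁ im
        ... | inj₂ _     | inj₁ (_ , im) = inj₁ im
        ... | inj₂ large | inj₂ few      = inj₂ (subst (λ n → k * n ≤ suc k * size (Red col) y₀ ∸ d)
          (total-map gap h (children l y₀ i)) (charge hD (map h (children l y₀ i)) (size (Red col) y₀) few′ (All.map⁺ large)))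
          where
          h : Child → ℕ
          h c = size (Red col) (y c)
          few′ : ∀ s → s < d → atMost s (map h (children l y₀ i)) ≤ suc s
          few′ s s<d = subst (λ n → atMost n (map h (children l y₀ i)) ≤ suc n) (Fin.toℕ-fromℕ< s<d) (few (fromℕ< s<d))

        check-all : ∀ ws → ws ≼ zs →
                    Improved r col zs ⊎ All (λ y₀ → lackAll l y₀ ≤ suc k * size (Red col) y₀ ∸ d) ws
        check-all [] le = inj₂ []
        check-all (y₀ ∷ ys) le with check-all ys (≼-trans (there here) le) | search (check-tree y₀ ys le)
        ... | inj₁ im | _             = inj₁ im
        ... | inj₂ _  | inj₁ (_ , im) = inj₁ im
        ... | inj₂ ps | inj₂ qs       = inj₂ (*-cancelˡ-≤ k (begin
          k * lackAll l y₀                        ≡⟨ *-distribˡ-sum k (lackChildren l y₀) ⟩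
          sum (λ i → k * lackChildren l y₀ i)     ≤⟨ sum-mono qs ⟩
          sum {k} (λ _ → suc k * size (Red col) y₀ ∸ d) ≡⟨ sum-const k _ ⟩
          k * (suc k * size (Red col) y₀ ∸ d)     ∎) ∷ ps)
          where open ≤-Reasoning

        -- The lack of each component is covered by the surplus `w` of its parent, and the first
        -- component lacks nothing as it has more than `D` edges. Hence a component has d/(k + 1)
        -- edges on average or more.
        size-bound : D < size (Red col) r →
                     Improved r col zs ⊎ d * List.length zs ≤ suc k * total (size (Red col)) zs
        size-bound big with check-all zs here
        ... | inj₁ im = inj₁ im
        ... | inj₂ bounds = inj₂ (+-cancelʳ-≤ (total w zs) _ _ (begin
          d * List.length zs + total w zs                    ≡⟨ cong (_+ total w zs) (total-const d zs) ⟨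
          total (λ _ → d) zs + total w zs                    ≡⟨ total-+ (λ _ → d) w zs ⟨
          total (λ y₀ → d + w y₀) zs                         ≤⟨ total-mono zs (All.universal balance zs) ⟩
          total (λ y₀ → suc k * s y₀ + lack col y₀) zs       ≡⟨ total-+ (λ y₀ → suc k * s y₀) (lack col) zs ⟩
          total (λ y₀ → suc k * s y₀) zs + total (lack col) zs ≤⟨ +-mono-≤ (≤-reflexive (total-* (suc k) s zs)) lack≤ ⟩
          suc k * total s zs + total w zs                    ∎))
          where
          open ≤-Reasoning
          s w : Vertex → ℕ
          s = size (Red col)
          w y₀ = suc k * s y₀ ∸ d
          balance : ∀ y₀ → d + w y₀ ≤ suc k * s y₀ + lack col y₀
          balance y₀ with ≤-total d (suc k * s y₀)
          ... | inj₁ le = ≤-trans (≤-reflexive (m+[n∸m]≡n le)) (m≤m+n _ _)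
          ... | inj₂ ge = begin
            d + w y₀   ≡⟨ cong (d +_) (m≤n⇒m∸n≡0 ge) ⟩
            d + 0      ≡⟨ +-identityʳ d ⟩
            d          ≡⟨ m+[n∸m]≡n ge ⟨
            suc k * s y₀ + lack col y₀ ∎
          root-fine : lack col r ≡ 0
          root-fine = gap-zero (≤-trans d≤D (≤-trans (<⇒≤ big) (m≤m+n (s r) (k * s r))))
          lack≤ : total (lack col) zs ≤ total w zs
          lack≤ = begin
            total (lack col) zs                ≤⟨ lack-charged l ⟩
            total (lackAll l) zs + lack col r  ≡⟨ trans (cong (total (lackAll l) zs +_) root-fine) (+-identityʳ _) ⟩
            total (lackAll l) zs               ≤⟨ total-mono zs bounds ⟩
            total w zs                         ∎

    module _ {col} (ac : Acyclic (Red col)) where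

      reached-vertices : ∀ {zs} → Legal col zs → count (reached col zs) ≤ total (size (Red col)) zs + List.length zs
      reached-vertices l = go l
        where
        component-vertices : ∀ z → count (connᵇ (Red col) z) ≤ suc (size (Red col) z)
        component-vertices z = forest-count z (connᵇ (Red col) z) (component (Red col) z) ac (⇒connᵇ []) owned
          where
          owned : ∀ a → connᵇ (Red col) z a ≡ true → a ≢ z →
                  Σ (FirstEdge (Red col) a z) λ fe → component (Red col) z ∋ FirstEdge.g fe
          owned a p ne with first-edge-of (conn-sym (connᵇ⇒ p)) ne
          ... | fe@(first-edge {g} g∈ j rest) = fe , ⇒component g∈ end
            where
            end : Conn (Red col) (end₁ g) z
            end with joins-unique (joins-ends g) j
            ... | inj₁ (q , _) = subst (λ v → Conn (Red col) v z) (sym q) (conn-sym (connᵇ⇒ p))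
            ... | inj₂ (q , _) = subst (λ v → Conn (Red col) v z) (sym q) (conn-mono (∖-⊑ {Red col} {g}) rest)
        union : ∀ z zs → count (reached col (z ∷ zs)) ≤ count (connᵇ (Red col) z) + count (reached col zs)
        union z zs = ≤-trans (sum-mono pointwise) (≤-reflexive (∑-distrib-+ (λ v → when (connᵇ (Red col) z v) 1) _))
          where
          pointwise : ∀ v → when (reached col (z ∷ zs) v) 1 ≤ when (connᵇ (Red col) z v) 1 + when (reached col zs v) 1
          pointwise v with conn? (Red col) z v
          ... | yes _ = s≤s z≤n
          ... | no _  = ≤-refl
        bound : ∀ z zs → count (reached col zs) ≤ total (size (Red col)) zs + List.length zs →
                count (reached col (z ∷ zs)) ≤ total (size (Red col)) (z ∷ zs) + List.length (z ∷ zs)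
        bound z zs ih = begin
          count (reached col (z ∷ zs))                        ≤⟨ union z zs ⟩
          count (connᵇ (Red col) z) + count (reached col zs)  ≤⟨ +-mono-≤ (component-vertices z) ih ⟩
          suc (size (Red col) z) + (total (size (Red col)) zs + List.length zs)
            ≡⟨ rearrange (size (Red col) z) (total (size (Red col)) zs) (List.length zs) ⟩
          total (size (Red col)) (z ∷ zs) + List.length (z ∷ zs) ∎
          where
          open ≤-Reasoning
          rearrange : ∀ a b c → suc a + (b + c) ≡ a + b + suc c
          rearrange = solve-∀
        go : ∀ {zs} → Legal col zs → count (reached col zs) ≤ total (size (Red col)) zs + List.length zs
        go root = bound r [] (≤-reflexive (sum-zero {f = λ v → when (reached col [] v) 1} λ _ → refl))
        go (extend {zs} {z = z} l _ _ _ _ _) = bound z zs (go l)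

      reached-edges : ∀ {zs} → Legal col zs → total (size (Red col)) zs ≤ count (λ e → Red col e ∧ inside (reached col zs) e)
      reached-edges {zs} l = ≤-trans (go l) (count-mono both)
        where
        touch : List Vertex → EdgeSet
        touch zs e = Red col e ∧ reached col zs (end₁ e)
        touch⇒ : ∀ zs e → touch zs ∋ e → Red col ∋ e × Reach (Red col) zs (end₁ e)
        touch⇒ zs e p = ∧-trueˡ p , reached⇒ col zs _ (∧-trueʳ {Red col e} p)
        ⇒touch : ∀ zs e → Red col ∋ e → Reach (Red col) zs (end₁ e) → touch zs ∋ e
        ⇒touch zs e p q = ∧-true p (⇒reached col zs _ q)
        both : ∀ e → touch zs ∋ e → Red col e ∧ inside (reached col zs) e ≡ true
        both e p with touch⇒ zs e p
        ... | e∈ , q = ∧-true e∈ (inside-joins (reached col zs) (joins-ends e) (⇒reached col zs _ q)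
                         (⇒reached col zs _ (reach-conn q (edge-conn e∈ (joins-ends e)))))
        go : ∀ {zs} → Legal col zs → total (size (Red col)) zs ≤ count (touch zs)
        go root = ≤-trans (≤-reflexive (+-identityʳ _)) (count-mono λ e p →
          let (e∈ , q) = component⇒ (Red col) r e p in ⇒touch (r ∷ []) e e∈ (here (conn-sym q)))
        go (extend {zs} {z = z} l _ _ _ _ new) = ≤-trans (+-monoʳ-≤ (size (Red col) z) (go l))
          (≤-reflexive (sym (count-disjoint split left right disjoint)))
          where
          split : ∀ e → touch (z ∷ zs) ∋ e → component (Red col) z ∋ e ⊎ touch zs ∋ e
          split e p with touch⇒ (z ∷ zs) e p
          ... | e∈ , here q  = inj₁ (⇒component e∈ (conn-sym q))
          ... | e∈ , there q = inj₂ (⇒touch zs e e∈ q)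
          left : ∀ e → component (Red col) z ∋ e → touch (z ∷ zs) ∋ e
          left e p with component⇒ (Red col) z e p
          ... | e∈ , q = ⇒touch (z ∷ zs) e e∈ (here (conn-sym q))
          right : ∀ e → touch zs ∋ e → touch (z ∷ zs) ∋ e
          right e p with touch⇒ zs e p
          ... | e∈ , q = ⇒touch (z ∷ zs) e e∈ (there q)
          disjoint : ∀ e → component (Red col) z ∋ e → touch zs ∋ e → ⊥
          disjoint e p q = new (reach-conn (proj₂ (touch⇒ zs e q)) (proj₂ (component⇒ (Red col) z e p)))

  -- After subtracting the k spanning trees, sparsity leaves (d + k + 1) σ ≤ d (v - 1) for the red
  -- edges. The last two hypotheses give d v ≤ (d + k + 1) σ, a contradiction as d is positive.
  too-dense : ∀ {v e σ n} → 1 ≤ d → 1 ≤ v → (d + suc k) * e ≤ suc k * (k + d) * (v ∸ 1) → k * (v ∸ 1) + σ ≤ e →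
              v ≤ σ + n → d * n ≤ suc k * σ → ⊥
  too-dense {suc v} {e} {σ} {n} 1≤d _ sparse dense few bound = 1+n≰n (≤-trans (+-monoˡ-≤ ((d + suc k) * σ) 1≤d) (begin
    d + (d + suc k) * σ                ≤⟨ +-monoʳ-≤ d red-sparse ⟩
    d + d * v                          ≡⟨ *-suc d v ⟨
    d * suc v                          ≤⟨ *-monoʳ-≤ d few ⟩
    d * (σ + n)                        ≡⟨ *-distribˡ-+ d σ n ⟩
    d * σ + d * n                      ≤⟨ +-monoʳ-≤ (d * σ) bound ⟩
    d * σ + suc k * σ                  ≡⟨ *-distribʳ-+ σ d (suc k) ⟨
    (d + suc k) * σ                    ∎))
    where
    open ≤-Reasoning
    red-sparse : (d + suc k) * σ ≤ d * v
    red-sparse = +-cancelˡ-≤ ((d + suc k) * (k * v)) _ _ (begin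
      (d + suc k) * (k * v) + (d + suc k) * σ ≡⟨ *-distribˡ-+ (d + suc k) (k * v) σ ⟨
      (d + suc k) * (k * v + σ)               ≤⟨ *-monoʳ-≤ (d + suc k) dense ⟩
      (d + suc k) * e                         ≤⟨ sparse ⟩
      suc k * (k + d) * v                     ≡⟨ rearrange d k v ⟩
      (d + suc k) * (k * v) + d * v           ∎)
      where
      rearrange : ∀ d k v → suc k * (k + d) * v ≡ (d + suc k) * (k * v) + d * v
      rearrange = solve-∀

  closed-improves : ∀ {r col zs} {{_ : NonZero k}} → Sparse G k d → 1 ≤ d → d + k * gaps 0 d ≤ suc k * D →
                    Forests col → Acyclic (Red col) → (∀ h → col h ≢ parked) →
                    Rooted.Legal r col zs → Exploration.Closed r col zs → D < size (Red col) r → Improved r col zs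
  closed-improves {r} {col} {zs} sparse 1≤d hD fo ac np l cl big =
    [ id , (λ bound → ⊥-elim (too-dense 1≤d (≤-trans (s≤s z≤n) two) (sparse A two) dense (reached-vertices ac l) bound)) ]′
      (Check.size-bound fo ac np l (Closed.saturated cl) d≤D hD big)
    where
    open Charging r
    open Exploration r
    A : Vertex → Bool
    A = reached col zs
    d≤D : d ≤ D
    -- The first summand of `gaps 0 d` is `gap 0`, which is `d`.
    d≤D = *-cancelˡ-≤ (suc k) (≤-trans (+-monoʳ-≤ d (*-monoʳ-≤ k (d≤gaps′ d refl))) hD)
      where
      d≤gaps′ : ∀ n → n ≡ d → d ≤ gaps 0 n
      d≤gaps′ zero    eq = ≤-reflexive (sym eq)
      d≤gaps′ (suc n) eq = ≤-trans (≤-reflexive (cong (d ∸_) (sym (*-zeroʳ k)))) (m≤m+n (gap 0) (gaps 1 n))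
    dense : k * (count A ∸ 1) + total (size (Red col)) zs ≤ count (inside A)
    dense = ≤-trans (+-monoʳ-≤ (k * (count A ∸ 1)) (reached-edges ac l)) (closed-count fo l cl)
    two : 2 ≤ count A
    two with count>0⇒∃ (component (Red col) r) (≤-<-trans z≤n big)
    ... | e , p with component⇒ (Red col) r e p
    ...   | e∈ , er = count≥2 A (⇒reached col zs _ at₁)
                        (⇒reached col zs _ (reach-conn at₁ (edge-conn e∈ (joins-ends e)))) (Graph.loopless G e)
      where
      at₁ : Reach (Red col) zs (end₁ e)
      at₁ = reach-conn (legal-root l) (conn-sym er)

  -- Descent to a colouring with small red components.

  open Graph G using (#V)
  open Potential excess

  record Better (col : Colouring) : Set where
    field
      {col′} : Colouring
      valid  : Valid col′
      better : count (Red col′) < count (Red col) ⊎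
               (count (Red col′) ≡ count (Red col) × potential (Red col′) < potential (Red col))

  augmentation-better : ∀ {col} → Valid col → Augmentation col → Better col
  augmentation-better {col} va a = record
    { valid = record
      { forests = A.forests
      ; acyclic = acyclic-⊑ (λ e p → ∖-⊑ {Red col} {A.e} e (≡⇒⊑ A.red-eq e p)) (Valid.acyclic va)
      ; no-parked = λ h ph → Valid.no-parked va h (class⇒ col h (≡⇒⊑ A.park-eq h (⇒class A.col′ h ph))) }
    ; better = inj₁ (≤-reflexive (sym A.red-count)) }
    where module A = Augmentation a

  module Search (r : Vertex) {{_ : NonZero k}} (sparse : Sparse G k d) (1≤d : 1 ≤ d) (hD : d + k * gaps 0 d ≤ suc k * D) where
    open Rooted r
    open Exploration r

    -- An improvement behind the root component; the sizes along the exploration then decrease lexicographically.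
    Smaller : Colouring → List Vertex → Set
    Smaller col zs = Σ (Improved r col zs) λ im → Improved.zs′ im ≢ []

    improved-valid : ∀ {col zs} (im : Improved r col zs) → Valid (Improved.col′ im)
    improved-valid im = record { forests = Improved.forests im ; acyclic = Improved.acyclic im ; no-parked = Improved.no-parked im }

    classify : ∀ {col zs} → Legal col zs → D < size (Red col) r → Improved r col zs → Better col ⊎ Smaller col zs
    classify l big im with Improved.zs′ im in eq
    ... | _ ∷ _ = inj₂ (im , λ eq′ → nonempty (trans (sym eq) eq′))
      where
      nonempty : ∀ {y ys} → _≢_ {A = List Vertex} (y ∷ ys) []
      nonempty ()
    ... | [] = inj₁ record { valid = improved-valid im ; better = inj₂ (Improved.red-count im , Improved.strict im eq big′) }
      where
      root-only : ∀ {col z zs} → Legal col (z ∷ zs) → zs ≡ [] → z ≡ r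
      root-only root _ = refl
      root-only (extend () _ _ _ _ _) refl
      big′ : D < size _ (Improved.z′ im)
      big′ = subst (λ v → D < size _ v) (sym (root-only (Improved.legal im) eq)) big

    -- The improvement at `z` leaves all earlier components alone, so what is found afterwards for
    -- the new colouring at or before an entry of `zs` can be stated for the old one.
    module Compose {col z zs} (im : Improved r col (z ∷ zs)) (z≡ : Improved.z′ im ≡ z) (zs≡ : Improved.zs′ im ≡ zs) where
      module I = Improved im
      col₁ : Colouring
      col₁ = I.col′

      agree₁ : AgreeOn (Red col) (Red col₁) zs
      agree₁ = subst (AgreeOn (Red col) (Red col₁)) zs≡ I.agree

      legal₁ : Legal col₁ (z ∷ zs)
      legal₁ = subst₂ (λ a b → Legal col₁ (a ∷ b)) z≡ zs≡ I.legal

      smaller₁ : size (Red col₁) z < size (Red col) z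
      smaller₁ = subst (λ a → size (Red col₁) a < size (Red col) a) z≡ I.smaller

      same-size : ∀ {v} → Reach (Red col) zs v → size (Red col) v ≡ size (Red col₁) v
      same-size p = size-agree λ e c d q → agree₁ e c d (reach-conn p q)

      better : Better col₁ → Better col
      better b = record { valid = Better.valid b ; better = go (Better.better b) }
        where
        go : _ → _
        go (inj₁ lt)        = inj₁ (≤-trans lt (≤-reflexive I.red-count))
        go (inj₂ (eq , lt)) = inj₂ (trans eq I.red-count , ≤-trans lt I.potential-≤)

      smaller : Smaller col₁ zs → Smaller col zs
      smaller (jm , ne) = record
        { col′ = J.col′ ; forests = J.forests ; acyclic = J.acyclic ; no-parked = J.no-parked
        ; red-count = trans J.red-count I.red-count
        ; potential-≤ = ≤-trans J.potential-≤ I.potential-≤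
        ; suffix = J.suffix ; legal = J.legal
        ; agree = λ e c d p j → trans (agree₁ e c d (reach-≼ tail p) j)
                    (J.agree e c d (reach-agree (λ e c d q → agree₁ e c d (reach-≼ tail q)) p) j)
        ; smaller = <-≤-trans J.smaller (≤-reflexive (sym same))
        ; strict = λ eq lt → <-≤-trans (J.strict eq (subst (D <_) same lt)) I.potential-≤ } , ne
        where
        module J = Improved jm
        tail : J.zs′ ≼ zs
        tail = ≼-trans (there here) J.suffix
        same : size (Red col) J.z′ ≡ size (Red col₁) J.z′
        same = same-size (reach-≼ J.suffix (here []))

    legal-tail-root : ∀ {col z zs} → Legal col (z ∷ zs) → zs ≢ [] → Reach (Red col) zs r
    legal-tail-root root ne = ⊥-elim (ne refl)
    legal-tail-root (extend l _ _ _ _ _) _ = legal-root l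

    mutual
      -- The number `n` bounds how many components can still be entered. An improvement at an
      -- earlier component invalidates the later exploration, which is then discarded and redone.
      solve : ∀ n col zs → #V ≤ n + List.length zs → Valid col → Legal col zs → D < size (Red col) r →
              Better col ⊎ Smaller col zs
      solve n col zs len va l big with explore col zs (Valid.forests va) l
      ... | inj₁ a = inj₁ (augmentation-better va a)
      ... | inj₂ (inj₂ cl) = classify l big
            (closed-improves sparse 1≤d hD (Valid.forests va) (Valid.acyclic va) (Valid.no-parked va) l cl big)
      solve zero col zs len va l big | inj₂ (inj₁ (z , l′)) = ⊥-elim (1+n≰n (≤-trans (legal-length l′) len))
      solve (suc n) col zs len va l big | inj₂ (inj₁ (z , l′)) =
        solve-below n (suc (size (Red col) z)) col z zs (≤-trans len (≤-reflexive (sym (+-suc n _)))) va l′ (nonempty l) ≤-refl big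
        where
        nonempty : ∀ {col zs} → Legal col zs → zs ≢ []
        nonempty root ()
        nonempty (extend _ _ _ _ _ _) ()

      -- As long as improvements hit the component of `z`, its size drops below `b` and the search
      -- is repeated from the same stage. The result concerns components before `z` only.
      solve-below : ∀ n b col z zs → #V ≤ n + suc (List.length zs) → Valid col → Legal col (z ∷ zs) → zs ≢ [] →
                    size (Red col) z < b → D < size (Red col) r → Better col ⊎ Smaller col zs
      solve-below n (suc b) col z zs len va l ne (s≤s lt) big with solve n col (z ∷ zs) len va l big
      ... | inj₁ bt = inj₁ bt
      ... | inj₂ (im , ne′) = cases (Improved.suffix im) refl refl
        where
        module I = Improved im
        cases : ∀ {y ys} → y ∷ ys ≼ z ∷ zs → I.z′ ≡ y → I.zs′ ≡ ys → Better col ⊎ Smaller col zs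
        cases (there le) refl refl = inj₂ (record
          { col′ = I.col′ ; forests = I.forests ; acyclic = I.acyclic ; no-parked = I.no-parked ; red-count = I.red-count
          ; potential-≤ = I.potential-≤ ; suffix = le ; legal = I.legal ; agree = I.agree
          ; smaller = I.smaller ; strict = I.strict } , ne′)
        cases here z≡ zs≡ with solve-below n b C.col₁ z zs len (improved-valid im) C.legal₁ ne (<-≤-trans C.smaller₁ lt)
                                 (subst (D <_) (C.same-size (legal-tail-root l ne)) big)
          where module C = Compose im z≡ zs≡
        ... | inj₁ bt = inj₁ (Compose.better im z≡ zs≡ bt)
        ... | inj₂ sm = inj₂ (Compose.smaller im z≡ zs≡ sm)

    better-colouring : ∀ col → Valid col → D < size (Red col) r → Better col
    better-colouring col va big with solve #V col (r ∷ []) (m≤m+n #V 1) va root big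
    ... | inj₁ bt = bt
    ... | inj₂ (im , ne) = ⊥-elim (cases (Improved.suffix im) ne)
      where
      cases : ∀ {y ys} → y ∷ ys ≼ r ∷ [] → ys ≢ [] → ⊥
      cases here ne = ne refl
      cases (there ()) ne

  abstract
    -- Lexicographic induction on the number of red edges and the total excess. An augmentation may
    -- raise the second, which is therefore reset when the first drops.
    small-components : {{_ : NonZero k}} → Sparse G k d → 1 ≤ d → d + k * gaps 0 d ≤ suc k * D →
                       ∀ col → Valid col → ∃[ col′ ] Valid col′ × (∀ v → size (Red col′) v ≤ D)
    small-components sparse 1≤d hD col va = go _ _ col va ≤-refl ≤-refl
      where
      go : ∀ a b col → Valid col → count (Red col) ≤ a → potential (Red col) ≤ b →
           ∃[ col′ ] Valid col′ × (∀ v → size (Red col′) v ≤ D)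
      go a b col va ca cb with Fin.any? (λ v → D <? size (Red col) v)
      ... | no none = col , va , λ v → ≮⇒≥ (λ lt → none (v , lt))
      ... | yes (r , big) = next a b ca cb (Better.better bt)
        where
        bt : Better col
        bt = Search.better-colouring r sparse 1≤d hD col va big
        module B = Better bt
        next : ∀ a b → count (Red col) ≤ a → potential (Red col) ≤ b →
               count (Red B.col′) < count (Red col) ⊎
               (count (Red B.col′) ≡ count (Red col) × potential (Red B.col′) < potential (Red col)) →
               ∃[ col′ ] Valid col′ × (∀ v → size (Red col′) v ≤ D)
        next zero b ca cb (inj₁ lt) = ⊥-elim (n≮0 (<-≤-trans lt ca))
        next (suc a) b ca cb (inj₁ lt) = go a _ B.col′ B.valid (≤-pred (<-≤-trans lt ca)) ≤-refl
        next a zero ca cb (inj₂ (_ , lt)) = ⊥-elim (n≮0 (<-≤-trans lt cb))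
        next a (suc b) ca cb (inj₂ (eq , lt)) = go a b B.col′ B.valid (≤-trans (≤-reflexive eq) ca) (≤-pred (<-≤-trans lt cb))

open import Defs
open import Data.Fin.Subset as Subset using (Subset; ∣_∣)
open import Data.Fin.Subset.Properties using (p⊆q⇒∣p∣≤∣q∣)
open import Data.Integer.Base as ℤ using (ℤ; +_; -[1+_]; +[1+_])
import Data.Integer.DivMod as ℤ
import Data.Integer.Properties as ℤ
import Data.Integer.Tactic.RingSolver as ℤ-Solver
open import Data.List.Relation.Unary.Unique.Propositional using (Unique)
open import Data.Rational.Base as ℚ using (ℚ; mkℚ; toℚᵘ; ½; ↥_; ↧_; _/_)
import Data.Rational.Properties as ℚ
open import Data.Rational.Unnormalised.Base as ℚᵘ using (ℚᵘ; mkℚᵘ; *≡*; *≤*)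
import Data.Rational.Unnormalised.Properties as ℚᵘ
open import Data.Vec.Base using (tabulate)
open import Data.Vec.Properties using (lookup∘tabulate; lookup⇒[]=; []=⇒lookup)

-- Ceilings and the closed form of the bound.

floor-≤ : ∀ p → ℚ.floor p ℤ.* ↧ p ℤ.≤ ↥ p
floor-≤ p@record{} = ℤ.[n/d]*d≤n (↥ p) (↧ p)

<-suc-floor : ∀ p → ↥ p ℤ.< ℤ.suc (ℚ.floor p) ℤ.* ↧ p
<-suc-floor p@record{} = subst (λ n → ↥ p ℤ.< ℤ.suc n ℤ.* ↧ p) (sym (ℤ.div-pos-is-/ℕ (↥ p) (ℚ.↧ₙ p)))
  (ℤ.n<s[n/ℕd]*d (↥ p) (ℚ.↧ₙ p))

ceiling-≥ : ∀ p → ↥ p ℤ.≤ ℚ.ceiling p ℤ.* ↧ p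
ceiling-≥ p@record{} = ℤ.neg-cancel-≤ (begin
  ℤ.- (ℤ.- floor ℤ.* ↧ p)       ≡⟨ neg-neg floor (↧ p) ⟩
  floor ℤ.* ↧ p                 ≡⟨ cong (floor ℤ.*_) (ℚ.↧-neg p) ⟨
  floor ℤ.* ↧ (ℚ.- p)           ≤⟨ floor-≤ (ℚ.- p) ⟩
  ↥ (ℚ.- p)                     ≡⟨ ℚ.↥-neg p ⟩
  ℤ.- ↥ p                       ∎)
  where
  open ℤ.≤-Reasoning
  floor : ℤ
  floor = ℚ.floor (ℚ.- p)
  neg-neg : ∀ a b → ℤ.- (ℤ.- a ℤ.* b) ≡ a ℤ.* b
  neg-neg = ℤ-Solver.solve-∀

ceiling-< : ∀ p → (ℚ.ceiling p ℤ.- + 1) ℤ.* ↧ p ℤ.< ↥ p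
ceiling-< p@record{} = ℤ.neg-cancel-< (begin-strict
  ℤ.- ↥ p                                   ≡⟨ ℚ.↥-neg p ⟨
  ↥ (ℚ.- p)                                 <⟨ <-suc-floor (ℚ.- p) ⟩
  ℤ.suc floor ℤ.* ↧ (ℚ.- p)                 ≡⟨ cong (ℤ.suc floor ℤ.*_) (ℚ.↧-neg p) ⟩
  ℤ.suc floor ℤ.* ↧ p                       ≡⟨ rearrange floor (↧ p) ⟩
  ℤ.- ((ℤ.- floor ℤ.- + 1) ℤ.* ↧ p)         ∎)
  where
  open ℤ.≤-Reasoning
  floor : ℤ
  floor = ℚ.floor (ℚ.- p)
  rearrange : ∀ a b → (+ 1 ℤ.+ a) ℤ.* b ≡ ℤ.- ((ℤ.- a ℤ.- + 1) ℤ.* b)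
  rearrange = ℤ-Solver.solve-∀

-- The fraction `u` need not be in lowest terms, so that the explicit numerator and denominator of
-- an expression can be used.
ceiling-upper : ∀ p u → toℚᵘ p ℚᵘ.≃ u → ℚᵘ.↥ u ℤ.≤ ℚ.ceiling p ℤ.* ℚᵘ.↧ u
ceiling-upper p@(mkℚ n d-1 _) u@(mkℚᵘ m e-1) (*≡* eq) = ℤ.*-cancelʳ-≤-pos m _ (↧ p) (begin
  m ℤ.* ↧ p                          ≡⟨ eq ⟨
  n ℤ.* ℚᵘ.↧ u                       ≤⟨ ℤ.*-monoʳ-≤-nonNeg (ℚᵘ.↧ u) (ceiling-≥ p) ⟩
  ℚ.ceiling p ℤ.* ↧ p ℤ.* ℚᵘ.↧ u     ≡⟨ swap (ℚ.ceiling p) (↧ p) (ℚᵘ.↧ u) ⟩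
  ℚ.ceiling p ℤ.* ℚᵘ.↧ u ℤ.* ↧ p     ∎)
  where
  open ℤ.≤-Reasoning
  swap : ∀ a b c → a ℤ.* b ℤ.* c ≡ a ℤ.* c ℤ.* b
  swap = ℤ-Solver.solve-∀

ceiling-lower : ∀ p u → toℚᵘ p ℚᵘ.≃ u → (ℚ.ceiling p ℤ.- + 1) ℤ.* ℚᵘ.↧ u ℤ.< ℚᵘ.↥ u
ceiling-lower p@(mkℚ n d-1 _) u@(mkℚᵘ m e-1) (*≡* eq) = ℤ.*-cancelʳ-<-nonNeg (↧ p) (begin-strict
  (ℚ.ceiling p ℤ.- + 1) ℤ.* ℚᵘ.↧ u ℤ.* ↧ p   ≡⟨ swap (ℚ.ceiling p ℤ.- + 1) (ℚᵘ.↧ u) (↧ p) ⟩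
  (ℚ.ceiling p ℤ.- + 1) ℤ.* ↧ p ℤ.* ℚᵘ.↧ u   <⟨ ℤ.*-monoʳ-<-pos (ℚᵘ.↧ u) (ceiling-< p) ⟩
  n ℤ.* ℚᵘ.↧ u                               ≡⟨ eq ⟩
  m ℤ.* ↧ p                                  ∎)
  where
  open ℤ.≤-Reasoning
  swap : ∀ a b c → a ℤ.* b ℤ.* c ≡ a ℤ.* c ℤ.* b
  swap = ℤ-Solver.solve-∀

/-≃ : ∀ n d → toℚᵘ (n ℚ./ suc d) ℚᵘ.≃ mkℚᵘ n d
/-≃ n d = ℚ.toℚᵘ-fromℚᵘ (mkℚᵘ n d)

ceiling-positive : ∀ {d k} j → 1 ≤ d → + d ℤ.≤ j ℤ.* + suc k → (j ℤ.- + 1) ℤ.* + suc k ℤ.< + d →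
                   ∃[ i ] j ≡ + suc i × suc k * i < d × d ≤ suc k * suc i
ceiling-positive {d} {k} (+ zero) 1≤d up lo = ⊥-elim (1+n≰n (≤-trans 1≤d (ℤ.drop‿+≤+ up)))
ceiling-positive {d} {k} +[1+ i ] 1≤d up lo = i , refl
  , subst (_< d) (*-comm i (suc k)) (ℤ.drop‿+<+ (subst (ℤ._< + d) (sym (ℤ.pos-* i (suc k))) lo))
  , ≤-trans (ℤ.drop‿+≤+ up) (≤-reflexive (*-comm (suc i) (suc k)))
ceiling-positive {suc d} {k} -[1+ i ] 1≤d () lo

module _ (k d : ℕ) where
  open Gaps k d

  gaps-++ : ∀ s m n → gaps s (m + n) ≡ gaps s m + gaps (s + m) n
  gaps-++ s zero    n = cong (λ t → gaps t n) (sym (+-identityʳ s))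
  gaps-++ s (suc m) n = trans (cong (λ n → gap s + n) (trans (gaps-++ (suc s) m n)
    (cong (λ t → gaps (suc s) m + gaps t n) (sym (+-suc s m))))) (sym (+-assoc (gap s) _ _))

  gaps-zero : ∀ s n → d ≤ suc k * s → gaps s n ≡ 0
  gaps-zero s zero    le = refl
  gaps-zero s (suc n) le = cong₂ _+_ (gap-zero le) (gaps-zero (suc s) n (≤-trans le (*-monoʳ-≤ (suc k) (n≤1+n s))))

  -- As long as the subtraction is not truncated, the gaps form an arithmetic progression with
  -- difference -(k + 1). Doubling avoids the half in its sum.
  gaps-arithmetic : ∀ i s → suc k * (s + i) ≤ d →
                    2 * gaps s (suc i) + suc k * (suc i * (2 * s + i)) ≡ 2 * (suc i * d)
  gaps-arithmetic zero s le = begin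
    2 * (gap s + 0) + suc k * (1 * (2 * s + 0))  ≡⟨ r₁ (gap s) k s ⟩
    2 * (1 * (gap s + suc k * s))                ≡⟨ cong (λ n → 2 * (1 * n)) (m∸n+n≡m (subst (λ n → suc k * n ≤ d) (+-identityʳ s) le)) ⟩
    2 * (1 * d)                                      ∎
    where
    open ≡-Reasoning
    r₁ : ∀ a k s → 2 * (a + 0) + suc k * (1 * (2 * s + 0)) ≡ 2 * (1 * (a + suc k * s))
    r₁ = solve-∀
  gaps-arithmetic (suc i) s le = begin
    2 * (gap s + gaps (suc s) (suc i)) + suc k * (suc (suc i) * (2 * s + suc i))
      ≡⟨ r₁ (gap s) (gaps (suc s) (suc i)) k s i ⟩
    2 * (gap s + suc k * s) + (2 * gaps (suc s) (suc i) + suc k * (suc i * (2 * suc s + i)))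
      ≡⟨ cong₂ (λ a b → 2 * a + b) (m∸n+n≡m (≤-trans (*-monoʳ-≤ (suc k) (m≤m+n s (suc i))) le))
           (gaps-arithmetic i (suc s) (subst (λ n → suc k * n ≤ d) (+-suc s i) le)) ⟩
    2 * d + 2 * (suc i * d)   ≡⟨ *-distribˡ-+ 2 d (suc i * d) ⟨
    2 * (suc (suc i) * d)     ∎
    where
    open ≡-Reasoning
    r₁ : ∀ a b k s i → 2 * (a + b) + suc k * (suc (suc i) * (2 * s + suc i)) ≡
                       2 * (a + suc k * s) + (2 * b + suc k * (suc i * (2 * suc s + i)))
    r₁ = solve-∀

  -- The hypotheses say that i + 1 is ⌈d/(k + 1)⌉, which is the number of nonzero gaps.
  gaps-closed : ∀ i → suc k * i < d → d ≤ suc k * suc i →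
                2 * gaps 0 d + suc k * (suc i * i) ≡ 2 * (suc i * d)
  gaps-closed i lo up = trans (cong (λ n → 2 * n + suc k * (suc i * i)) all-gaps) (gaps-arithmetic i 0 (<⇒≤ lo))
    where
    all-gaps : gaps 0 d ≡ gaps 0 (suc i)
    all-gaps = begin
      gaps 0 d                                            ≡⟨ cong (gaps 0) (m+[n∸m]≡n i<d) ⟨
      gaps 0 (suc i + (d ∸ suc i))                        ≡⟨ gaps-++ 0 (suc i) (d ∸ suc i) ⟩
      gaps 0 (suc i) + gaps (suc i) (d ∸ suc i)       ≡⟨ cong (λ n → gaps 0 (suc i) + n) (gaps-zero (suc i) (d ∸ suc i) up) ⟩
      gaps 0 (suc i) + 0                                  ≡⟨ +-identityʳ _ ⟩
      gaps 0 (suc i)                                      ∎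
      where
      open ≡-Reasoning
      i<d : suc i ≤ d
      i<d = ≤-<-trans (m≤m+n i (k * i)) lo

  -- As an unnormalised fraction, k (c - 1) (q - c/2) with q = d/(k+1) and c = j.
  surplus : ℤ → ℚᵘ
  surplus j = mkℚᵘ (+ k) 0 ℚᵘ.* (mkℚᵘ j 0 ℚᵘ.- mkℚᵘ (+ 1) 0) ℚᵘ.* (mkℚᵘ (+ d) k ℚᵘ.- mkℚᵘ (+ 1) 1 ℚᵘ.* mkℚᵘ j 0)

  surplus-≃ : ∀ j c q → toℚᵘ c ℚᵘ.≃ mkℚᵘ j 0 → toℚᵘ q ℚᵘ.≃ mkℚᵘ (+ d) k →
              toℚᵘ ((+ k ℚ./ 1) ℚ.* (c ℚ.- ℚ.1ℚ) ℚ.* (q ℚ.- ½ ℚ.* c)) ℚᵘ.≃ surplus j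
  surplus-≃ j c q c≃ q≃ = ℚᵘ.≃-trans (ℚ.toℚᵘ-homo-* ((+ k ℚ./ 1) ℚ.* (c ℚ.- ℚ.1ℚ)) (q ℚ.- ½ ℚ.* c)) (ℚᵘ.*-cong
    (ℚᵘ.≃-trans (ℚ.toℚᵘ-homo-* (+ k ℚ./ 1) (c ℚ.- ℚ.1ℚ)) (ℚᵘ.*-cong (/-≃ (+ k) 0)
      (minus c ℚ.1ℚ c≃ (/-≃ (+ 1) 0))))
    (minus q (½ ℚ.* c) q≃ (ℚᵘ.≃-trans (ℚ.toℚᵘ-homo-* ½ c) (ℚᵘ.*-cong (/-≃ (+ 1) 1) c≃))))
    where
    minus : ∀ a b {a′ b′} → toℚᵘ a ℚᵘ.≃ a′ → toℚᵘ b ℚᵘ.≃ b′ → toℚᵘ (a ℚ.- b) ℚᵘ.≃ a′ ℚᵘ.- b′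
    minus a b p r = ℚᵘ.≃-trans (ℚ.toℚᵘ-homo-+ a (ℚ.- b)) (ℚᵘ.+-cong p
      (ℚᵘ.≃-trans (ℚ.toℚᵘ-homo‿- b) (ℚᵘ.-‿cong r)))

  surplus-≤ : ∀ j C → ℚᵘ.↥ (surplus j) ℤ.≤ C ℤ.* ℚᵘ.↧ (surplus j) →
              + k ℤ.* (j ℤ.- + 1) ℤ.* (+ 2 ℤ.* + d ℤ.- j ℤ.* + suc k) ℤ.≤ C ℤ.* (+ 2 ℤ.* + suc k)
  surplus-≤ j C = subst₂ (λ a b → a ℤ.≤ C ℤ.* b) (numerator (+ k) j (+ d) (+ suc k))
    (trans (cong +_ (denominator k)) (ℤ.pos-* 2 (suc k)))
    where
    numerator : ∀ k j d s → k ℤ.* (j ℤ.* + 1 ℤ.+ -[1+ 0 ] ℤ.* + 1) ℤ.* (d ℤ.* + 2 ℤ.+ ℤ.- (+ 1 ℤ.* j) ℤ.* s)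
                ≡ k ℤ.* (j ℤ.- + 1) ℤ.* (+ 2 ℤ.* d ℤ.- j ℤ.* s)
    numerator = ℤ-Solver.solve-∀
    denominator : ∀ k → (1 * 1) * 1 * (suc k * (2 * 1)) ≡ 2 * suc k
    denominator = solve-∀

  -- With c = ⌈d/(k + 1)⌉ the closed form gives d + k Σ gap = (k + 1)(d + k (c - 1)(d/(k + 1) -
  -- c/2)). Hence the stated bound, before rounding up, is the least admissible value of `D`.
  bound-large : ∀ j C → 1 ≤ d → + d ℤ.≤ j ℤ.* + suc k → (j ℤ.- + 1) ℤ.* + suc k ℤ.< + d →
                + k ℤ.* (j ℤ.- + 1) ℤ.* (+ 2 ℤ.* + d ℤ.- j ℤ.* + suc k) ℤ.≤ C ℤ.* (+ 2 ℤ.* + suc k) →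
                + (2 * (d + k * gaps 0 d)) ℤ.≤ (+ d ℤ.+ C) ℤ.* (+ 2 ℤ.* + suc k)
  bound-large j C 1≤d up lo upper with ceiling-positive {d} {k} j 1≤d up lo
  ... | i , refl , lo′ , up′ = begin
    + (2 * (d + k * gaps 0 d))                ≡⟨ cast ⟩
    + 2 ℤ.* (D′ ℤ.+ K′ ℤ.* Γ)                      ≡⟨ r₁ D′ K′ Γ ⟩
    + 2 ℤ.* D′ ℤ.+ K′ ℤ.* (+ 2 ℤ.* Γ)              ≡⟨ cong (λ x → + 2 ℤ.* D′ ℤ.+ K′ ℤ.* x) closed ⟩
    + 2 ℤ.* D′ ℤ.+ K′ ℤ.* (+ 2 ℤ.* (J′ ℤ.* D′) ℤ.- S ℤ.* (J′ ℤ.* I))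
                                                  ≡⟨ r₂ D′ K′ I ⟩
    D′ ℤ.* (+ 2 ℤ.* S) ℤ.+ K′ ℤ.* (J′ ℤ.- + 1) ℤ.* (+ 2 ℤ.* D′ ℤ.- J′ ℤ.* S)
                                                  ≤⟨ ℤ.+-monoʳ-≤ (D′ ℤ.* (+ 2 ℤ.* S)) upper ⟩
    D′ ℤ.* (+ 2 ℤ.* S) ℤ.+ C ℤ.* (+ 2 ℤ.* S)       ≡⟨ ℤ.*-distribʳ-+ (+ 2 ℤ.* S) D′ C ⟨
    (D′ ℤ.+ C) ℤ.* (+ 2 ℤ.* S)                     ∎
    where
    open ℤ.≤-Reasoning
    D′ K′ Γ I J′ S : ℤ
    D′ = + d
    K′ = + k
    Γ  = + gaps 0 d
    I  = + i
    J′ = + 1 ℤ.+ I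
    S  = + 1 ℤ.+ K′
    cast : + (2 * (d + k * gaps 0 d)) ≡ + 2 ℤ.* (D′ ℤ.+ K′ ℤ.* Γ)
    cast = trans (ℤ.pos-* 2 (d + k * gaps 0 d))
      (cong (+ 2 ℤ.*_) (trans (ℤ.pos-+ d (k * gaps 0 d)) (cong (λ x → D′ ℤ.+ x) (ℤ.pos-* k (gaps 0 d)))))
    closed-cast : + 2 ℤ.* Γ ℤ.+ S ℤ.* (J′ ℤ.* I) ≡ + 2 ℤ.* (J′ ℤ.* D′)
    closed-cast = trans (sym (trans (ℤ.pos-+ (2 * gaps 0 d) (suc k * (suc i * i))) (cong₂ ℤ._+_ (ℤ.pos-* 2 (gaps 0 d))
        (trans (ℤ.pos-* (suc k) (suc i * i)) (cong (S ℤ.*_) (ℤ.pos-* (suc i) i))))))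
      (trans (cong +_ (gaps-closed i lo′ up′)) (trans (ℤ.pos-* 2 (suc i * d)) (cong (+ 2 ℤ.*_) (ℤ.pos-* (suc i) d))))
    closed : + 2 ℤ.* Γ ≡ + 2 ℤ.* (J′ ℤ.* D′) ℤ.- S ℤ.* (J′ ℤ.* I)
    closed = trans (r₃ (+ 2 ℤ.* Γ) (S ℤ.* (J′ ℤ.* I))) (cong (ℤ._- S ℤ.* (J′ ℤ.* I)) closed-cast)
      where
      r₃ : ∀ a b → a ≡ a ℤ.+ b ℤ.- b
      r₃ = ℤ-Solver.solve-∀
    r₁ : ∀ d k g → + 2 ℤ.* (d ℤ.+ k ℤ.* g) ≡ + 2 ℤ.* d ℤ.+ k ℤ.* (+ 2 ℤ.* g)
    r₁ = ℤ-Solver.solve-∀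
    r₂ : ∀ d k i → + 2 ℤ.* d ℤ.+ k ℤ.* (+ 2 ℤ.* ((+ 1 ℤ.+ i) ℤ.* d) ℤ.- (+ 1 ℤ.+ k) ℤ.* ((+ 1 ℤ.+ i) ℤ.* i)) ≡
         d ℤ.* (+ 2 ℤ.* (+ 1 ℤ.+ k)) ℤ.+ k ℤ.* ((+ 1 ℤ.+ i) ℤ.- + 1) ℤ.* (+ 2 ℤ.* d ℤ.- (+ 1 ℤ.+ i) ℤ.* (+ 1 ℤ.+ k))
    r₂ = ℤ-Solver.solve-∀

  -- A negative `B` would make the right side of the hypothesis negative, so only the nonnegative
  -- case is left.
  nonneg-bound : ∀ P B → + (2 * P) ℤ.≤ B ℤ.* (+ 2 ℤ.* + suc k) → ∃[ D ] B ≡ + D × P ≤ suc k * D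
  nonneg-bound P (+ D) le = D , refl , *-cancelˡ-≤ 2 (≤-trans (ℤ.drop‿+≤+ (subst (+ (2 * P) ℤ.≤_) cast le))
      (≤-reflexive (rearrange D k)))
    where
    cast : + D ℤ.* (+ 2 ℤ.* + suc k) ≡ + (D * (2 * suc k))
    cast = sym (trans (ℤ.pos-* D (2 * suc k)) (cong (+ D ℤ.*_) (ℤ.pos-* 2 (suc k))))
    rearrange : ∀ D k → D * (2 * suc k) ≡ 2 * (suc k * D)
    rearrange = solve-∀

  ceiling-large : 1 ≤ d → ∀ q c x → toℚᵘ q ℚᵘ.≃ mkℚᵘ (+ d) k → c ≡ ℚ.ceiling q ℚ./ 1 →
                  x ≡ (+ k ℚ./ 1) ℚ.* (c ℚ.- ℚ.1ℚ) ℚ.* (q ℚ.- ½ ℚ.* c) →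
                  ∃[ D ] + d ℤ.+ ℚ.ceiling x ≡ + D × d + k * gaps 0 d ≤ suc k * D
  ceiling-large 1≤d q c x q≃ refl refl = nonneg-bound (d + k * gaps 0 d) (+ d ℤ.+ ℚ.ceiling x)
    (bound-large j (ℚ.ceiling x) 1≤d (ceiling-upper q (mkℚᵘ (+ d) k) q≃) (ceiling-lower q (mkℚᵘ (+ d) k) q≃)
      (surplus-≤ j (ℚ.ceiling x) (ceiling-upper x (surplus j) (surplus-≃ j c q (/-≃ j 0) q≃))))
    where
    j : ℤ
    j = ℚ.ceiling q

  componentBound-large : 1 ≤ d → ∃[ D ] componentBound d k ≡ + D × d + k * gaps 0 d ≤ suc k * D
  componentBound-large 1≤d = ceiling-large 1≤d _ _ _ (/-≃ (+ d) k) refl refl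

-- Translation between Boolean edge sets and the stated notions.

∣tabulate∣ : ∀ {n} (p : Fin n → Bool) → ∣ tabulate p ∣ ≡ count p
∣tabulate∣ {zero}  p = refl
∣tabulate∣ {suc n} p with p zero
... | true  = cong suc (∣tabulate∣ (p ∘ suc))
... | false = ∣tabulate∣ (p ∘ suc)

⇒∈tabulate : ∀ {n} (p : Fin n → Bool) {i} → p i ≡ true → i Subset.∈ tabulate p
⇒∈tabulate p {i} eq = lookup⇒[]= i (tabulate p) (trans (lookup∘tabulate p i) eq)

∈tabulate⇒ : ∀ {n} (p : Fin n → Bool) {i} → i Subset.∈ tabulate p → p i ≡ true
∈tabulate⇒ p {i} i∈ = trans (sym (lookup∘tabulate p i)) ([]=⇒lookup i∈)

density-≤ : ∀ d k e m → (+ e / suc m) ℚ.≤ (+ k / 1) ℚ.+ (+ d / suc (d + k)) →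
            (d + suc k) * e ≤ suc k * (k + d) * suc m
density-≤ d k e m le = begin
  (d + suc k) * e                          ≡⟨ r₁ d k e ⟩
  e * (1 * suc (d + k))                    ≤⟨ ℤ.drop‿+≤+ (subst₂ ℤ._≤_ left right (drop ineq)) ⟩
  (k * suc (d + k) + d * 1) * suc m        ≡⟨ r₂ d k m ⟩
  suc k * (k + d) * suc m                  ∎
  where
  open ≤-Reasoning
  r₁ : ∀ d k e → (d + suc k) * e ≡ e * (1 * suc (d + k))
  r₁ = solve-∀
  r₂ : ∀ d k m → (k * suc (d + k) + d * 1) * suc m ≡ suc k * (k + d) * suc m
  r₂ = solve-∀
  ineq : mkℚᵘ (+ e) m ℚᵘ.≤ mkℚᵘ (+ k) 0 ℚᵘ.+ mkℚᵘ (+ d) (d + k)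
  ineq = ℚᵘ.≤-respˡ-≃ (/-≃ (+ e) m) (ℚᵘ.≤-respʳ-≃
    (ℚᵘ.≃-trans (ℚ.toℚᵘ-homo-+ (+ k / 1) (+ d / suc (d + k))) (ℚᵘ.+-cong (/-≃ (+ k) 0) (/-≃ (+ d) (d + k))))
    (ℚ.toℚᵘ-mono-≤ le))
  drop : ∀ {p q} → p ℚᵘ.≤ q → ℚᵘ.↥ p ℤ.* ℚᵘ.↧ q ℤ.≤ ℚᵘ.↥ q ℤ.* ℚᵘ.↧ p
  drop (*≤* h) = h
  left : + e ℤ.* + (1 * suc (d + k)) ≡ + (e * (1 * suc (d + k)))
  left = sym (ℤ.pos-* e (1 * suc (d + k)))
  right : (+ k ℤ.* + suc (d + k) ℤ.+ + d ℤ.* + 1) ℤ.* + suc m ≡ + ((k * suc (d + k) + d * 1) * suc m)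
  right = sym (trans (ℤ.pos-* (k * suc (d + k) + d * 1) (suc m)) (cong (ℤ._* + suc m)
    (trans (ℤ.pos-+ (k * suc (d + k)) (d * 1)) (cong₂ ℤ._+_ (ℤ.pos-* k (suc (d + k))) (ℤ.pos-* d 1)))))

module _ (G : Graph) (d k : ℕ) where
  open Graph G
  open Connectivity G
  open Colourings G k

  γ-sparse : γ G ℚ.≤ (+ k / 1) ℚ.+ (+ d / suc (d + k)) → Sparse G k d
  γ-sparse γ≤ A two = subst₂ (λ m n → (d + suc k) * m ≤ suc k * (k + d) * (n ∸ 1)) (∣tabulate∣ (inside A)) (∣tabulate∣ A)
    (from (v G H) refl (subst (2 ≤_) (sym (∣tabulate∣ A)) two))
    where
    closed : Closed G (tabulate A) (tabulate (inside A))
    closed e e∈ = ⇒∈tabulate A (∧-trueˡ both) , ⇒∈tabulate A (∧-trueʳ {A (proj₁ (ends e))} both)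
      where
      both : inside A e ≡ true
      both = ∈tabulate⇒ (inside A) e∈
    H : Subgraph G
    H = subgraph (tabulate A) (tabulate (inside A)) closed
    from : ∀ n → v G H ≡ n → 2 ≤ n → (d + suc k) * e G H ≤ suc k * (k + d) * (n ∸ 1)
    from (suc zero) eq (s≤s ())
    from (suc (suc m)) eq _ = density-≤ d k (e G H) m (dens (v G H) eq (subst NonTrivial (sym eq) _) (ℚ.≤-trans (γ-upper G H (subst NonTrivial (sym eq) _)) γ≤))
      where
      -- Making the number of vertices a variable allows it to be replaced by m + 2 in the
      -- denominator; irrelevance of the `NonTrivial` proof makes the densities agree.
      dens : ∀ n → n ≡ suc (suc m) → .(nt : NonTrivial n) →
             (_/_ (+ e G H) (pred n) {{pred-nonZero G n {{nt}}}}) ℚ.≤ (+ k / 1) ℚ.+ (+ d / suc (d + k)) →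
             (+ e G H / suc m) ℚ.≤ (+ k / 1) ℚ.+ (+ d / suc (d + k))
      dens _ refl nt le = le

  -- The edges of a cycle are distinct, so the rest of the cycle joins the ends of its first edge
  -- without using it, although that edge is a bridge.
  acyclic-forest : ∀ S → Acyclic S → Forest G (tabulate S)
  acyclic-forest S ac c = go (Cycle.walk c) (Cycle.nonempty c) (Cycle.distinct-edges c)
    where
    to-conn : ∀ {f a b} (w : Walk G (tabulate S) a b) → All (f ≢_) (edges G w) → Conn (S ∖ f) a b
    to-conn [] [] = []
    to-conn (cons e e∈ j w) (ne ∷ nes) = step e (∖-intro {S} (∈tabulate⇒ S e∈) (λ eq → ne (sym eq))) j (to-conn w nes)
    go : ∀ {a} (w : Walk G (tabulate S) a a) → edges G w ≢ [] → Unique (edges G w) → ⊥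
    go [] ne _ = ne refl
    go (cons e e∈ j w) _ (fresh ∷ _) = ac e _ _ (∈tabulate⇒ S e∈) j (conn-sym (to-conn w fresh))

  component-size : ∀ S D → (∀ v → size S v ≤ D) → ∀ C → Component G (tabulate S) C → e G C ≤ D
  component-size S D small C comp = ≤-trans (p⊆q⇒∣p∣≤∣q∣ within′) (≤-trans (≤-reflexive (∣tabulate∣ (component S x))) (small x))
    where
    open Component comp
    open Subgraph C
    x : Fin #V
    x = proj₁ (proj₁ connected)
    to-conn : ∀ {a b} → Walk G E a b → Conn S a b
    to-conn [] = []
    to-conn (cons e e∈ j w) = step e (∈tabulate⇒ S (within e∈)) j (to-conn w)
    within′ : E Subset.⊆ tabulate (component S x)
    within′ {e} e∈ = ⇒∈tabulate (component S x) (⇒component (∈tabulate⇒ S (within e∈))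
      (to-conn (proj₂ connected _ x (proj₁ (closed e e∈)) (proj₂ (proj₁ connected)))))

  -- One of the k + 1 trees becomes the red forest. The default clause also sends the old red and
  -- parked colours to red, but the colouring from `nash-williams` uses tree colours only.
  demote : Fin (2 + suc k) → Fin (2 + k)
  demote (suc (suc (suc i))) = tree i
  demote _                   = red

  initial : (∀ A → 2 ≤ count A → count (inside A) ≤ suc k * (count A ∸ 1)) → ∃[ col ] Valid col
  initial sparse with Colourings.nash-williams G (suc k) sparse
  ... | col₀ , fo , trees = col , record { forests = λ i → acyclic-⊑ (trees⊑ i) (fo (suc i))
                                         ; acyclic = acyclic-⊑ red⊑ (fo zero) ; no-parked = none }
    where
    col : Colouring
    col e = demote (col₀ e)
    trees⊑ : ∀ i → Tree col i ⊑ Colourings.Tree G (suc k) col₀ (suc i)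
    trees⊑ i e p = Colourings.⇒class G (suc k) col₀ e (from (col₀ e) (class⇒ col e p))
      where
      from : ∀ c → demote c ≡ tree i → c ≡ suc (suc (suc i))
      from (suc (suc (suc i))) refl = refl
    red⊑ : Red col ⊑ Colourings.Tree G (suc k) col₀ zero
    red⊑ e p with trees e
    ... | zero  , eq = Colourings.⇒class G (suc k) col₀ e eq
    ... | suc i , eq with () ← trans (sym (cong demote eq)) (class⇒ col e p)
    none : ∀ e → col e ≢ parked
    none e p = not-parked (col₀ e) p
      where
      not-parked : ∀ c → demote c ≢ parked
      not-parked zero                ()
      not-parked (suc zero)          ()
      not-parked (suc (suc zero))    ()
      not-parked (suc (suc (suc _))) ()

  parts : Colouring → Fin (suc k) → Subset #E
  parts col zero    = tabulate (Red col)
  parts col (suc i) = tabulate (Tree col i)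

  parts-partition : ∀ {col} → Valid col → EdgePartition G (parts col)
  parts-partition {col} va e with col e in eq
  ... | red    = zero , ⇒∈tabulate (Red col) (⇒class col e eq) , λ { {zero} _ → refl ; {suc i} i∈ →
                 ⊥-elim (red≢tree (trans (sym eq) (class⇒ col e (∈tabulate⇒ (Tree col i) i∈)))) }
    where
    red≢tree : ∀ {i : Fin k} → _≢_ {A = Fin (2 + k)} red (tree i)
    red≢tree ()
  ... | parked = ⊥-elim (Valid.no-parked va e eq)
  ... | tree i = suc i , ⇒∈tabulate (Tree col i) (⇒class col e eq) , λ { {zero} i∈ →
                 ⊥-elim (tree≢red (trans (sym eq) (class⇒ col e (∈tabulate⇒ (Red col) i∈)))) ; {suc j} i∈ →
                 cong suc (tree-injective (trans (sym eq) (class⇒ col e (∈tabulate⇒ (Tree col j) i∈)))) }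
    where
    tree≢red : ∀ {i : Fin k} → _≢_ {A = Fin (2 + k)} (tree i) red
    tree≢red ()
    tree-injective : ∀ {i j : Fin k} → _≡_ {A = Fin (2 + k)} (tree i) (tree j) → i ≡ j
    tree-injective refl = refl

  -- Since d/(d + k + 1) < 1, the density bound is below k + 1, which is what a decomposition into k
  -- + 1 forests asks for.
  sparse-arboric : Sparse G k d → ∀ A → 2 ≤ count A → count (inside A) ≤ suc k * (count A ∸ 1)
  sparse-arboric sparse A two = *-cancelˡ-≤ (d + suc k) {{>-nonZero (≤-trans (s≤s z≤n) (m≤n+m (suc k) d))}} (begin
    (d + suc k) * count (inside A)              ≤⟨ sparse A two ⟩
    suc k * (k + d) * (count A ∸ 1)             ≤⟨ *-monoˡ-≤ (count A ∸ 1) (*-monoʳ-≤ (suc k)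
                                                   (≤-trans (≤-reflexive (+-comm k d)) (+-monoʳ-≤ d (n≤1+n k)))) ⟩
    suc k * (d + suc k) * (count A ∸ 1)         ≡⟨ rearrange (suc k) (d + suc k) (count A ∸ 1) ⟩
    (d + suc k) * (suc k * (count A ∸ 1))       ∎)
    where
    open ≤-Reasoning
    rearrange : ∀ a b c → a * b * c ≡ b * (a * c)
    rearrange = solve-∀

  decompose : ∀ D {{_ : NonZero k}} → 1 ≤ d → d + k * Gaps.gaps k d 0 d ≤ suc k * D → Sparse G k d →
              ∃[ F ] EdgePartition G {suc k} F × (∀ i → Forest G (F i)) ×
                     (∀ C → Component G (F zero) C → e G C ≤ D)
  decompose D 1≤d hD sparse = parts col , parts-partition va , forests , component-size (Red col) D (proj₂ (proj₂ final))
    where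
    start : ∃[ col ] Valid col
    start = initial (sparse-arboric sparse)
    final : ∃[ col ] Valid col × (∀ v → size (Red col) v ≤ D)
    final = Reduction.small-components G k d D sparse 1≤d hD (proj₁ start) (proj₂ start)
    col : Colouring
    col = proj₁ final
    va : Valid col
    va = proj₁ (proj₂ final)
    forests : ∀ i → Forest G (parts col i)
    forests zero    = acyclic-forest (Red col) (Valid.acyclic va)
    forests (suc i) = acyclic-forest (Tree col i) (Valid.forests va i)

decompose-within : ∀ G d k B → .{{_ : NonZero d}} → .{{_ : NonZero k}} →
  ∃[ D ] B ≡ + D × d + k * Gaps.gaps k d 0 d ≤ suc k * D → Sparse G k d →
  ∃[ F ] EdgePartition G {suc k} F × (∀ i → Forest G (F i)) × (∃[ i ] (∀ C → Component G (F i) C → + e G C ℤ.≤ B))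
decompose-within G d k B (D , refl , hD) sparse =
  proj₁ r , proj₁ (proj₂ r) , proj₁ (proj₂ (proj₂ r)) , zero , λ C comp → ℤ.+≤+ (proj₂ (proj₂ (proj₂ r)) C comp)
  where
  r : ∃[ F ] EdgePartition G {suc k} F × (∀ i → Forest G (F i)) × (∀ C → Component G (F zero) C → e G C ≤ D)
  r = decompose G d k D {{>-nonZero (>-nonZero⁻¹ k)}} (>-nonZero⁻¹ d) hD sparse

theorem1p6 : (G : Graph) (d k : ℕ) → .{{_ : NonZero d}} → .{{_ : NonZero k}} →
    γ G ℚ.≤ (+ k / 1) ℚ.+ (+ d / suc (d + k)) →
    ∃[ F ] EdgePartition G {suc k} F ×
    (∀ i → Forest G (F i)) ×
    (∃[ i ] (∀ C → Component G (F i) C → + e G C ℤ.≤ componentBound d k))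
theorem1p6 G d k γ≤ =
  decompose-within G d k (componentBound d k) (componentBound-large k d (>-nonZero⁻¹ d)) (γ-sparse G d k γ≤)
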